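{- For every integer $n\ge 2$, the Poincaré polynomial of $\overline{\mathcal{M}}_{0,n+1}$ is \[P_{\overline{\mathcal{M}}_{0,n+1}}(x) = \sum_{\lambda \vdash [n-1]} \frac{(n-1+\ell(\lambda))!}{(n-1)!} \prod_{i=1}^{\ell(\lambda)} \frac{ \overline{\chi}_{\lambda_i+1}(x)}{\lambda_i +1},\] where the sum is over all set partitions $\lambda$ of $[n-1]=\{1,\dots,n-1\}$ into $\ell(\lambda)$ nonempty blocks, $\lambda_i$ is the cardinality of the $i$-th block, and $\overline{\chi}_{m}(x) := (x-2)(x-3)\cdots (x-m+1)$ (an empty product, equal to $1$, when $m\le 2$).
   Context: $\overline{\mathcal{M}}_{0,n+1}$ is the Deligne–Knudsen–Mumford moduli space of stable rational curves with $n+1$ marked points; its cohomology is concentrated in even degrees, and its Poincaré polynomial is $P_{\overline{\mathcal{M}}_{0,n+1}}(x)=\sum_{i\ge0}\dim_\mathbb{Q}H^{2i}(\overline{\mathcal{M}}_{0,n+1};\mathbb{Q})\,x^i$. Equivalently, $P_{\overline{\mathcal{M}}_{0,n+1}}(x)$ equals the Hilbert series of the Feichtner–Yuzvinsky Chow ring of the graphic matroid of the complete graph $K_n$ with respect to its minimal building set (the nonempty connected flats). -}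

module Defs where

open import Data.Nat as ℕ using (ℕ; zero; suc; _∸_; _≤?_; _!)
open import Data.Nat.Properties using (_!≢0)
open import Data.Integer as ℤ using (+_)
open import Data.Rational as ℚ using (ℚ; 0ℚ; 1ℚ; _/_)
open import Data.Fin as Fin using (Fin)
open import Data.Fin.Subset using (Subset; _∈_; _⊆_; ∣_∣; outside; inside)
open import Data.Fin.Subset.Properties using (_∈?_)
open import Data.Vec as Vec using (Vec; []; _∷_)
open import Data.Vec.Properties using (≡-dec)
open import Data.List as List using (List; []; _∷_; [_]; length; concatMap; filter; upTo; allFin)
open import Data.List.Membership.Propositional using () renaming (_∈_ to _∈ₗ_)
open import Data.Product using (Σ; Σ-syntax; ∃; _×_; _,_)
open import Relation.Nullary using (¬_; yes; no)
open import Relation.Nullary.Decidable using (_×-dec_)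
open import Relation.Binary.PropositionalEquality using (_≡_; _≢_)

subsets : (n : ℕ) → List (Subset n)
subsets zero    = [ [] ]
subsets (suc n) = concatMap (λ s → (outside ∷ s) ∷ (inside ∷ s) ∷ []) (subsets n)

-- The minimal building set of the lattice of flats of M(K_n): the nonempty
-- connected flats, i.e. the edge sets of complete subgraphs K_S on vertex
-- sets S ⊆ Fin n with |S| ≥ 2.  We identify such a flat with S.
building : (n : ℕ) → List (Subset n)
building n = filter (λ s → 2 ≤? ∣ s ∣) (subsets n)

N : ℕ → ℕ
N n = length (building n)

G : (n : ℕ) → Fin (N n) → Subset n
G n j = List.lookup (building n) j

Mono : ℕ → Set
Mono m = Vec ℕ m

monos : (m k : ℕ) → List (Mono m)
monos zero    zero    = [ [] ]
monos zero    (suc k) = []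
monos (suc m) k       = concatMap (λ e → List.map (e ∷_) (monos m (k ∸ e))) (upTo (suc k))

Poly : ℕ → Set
Poly m = List (ℚ × Mono m)

coeff : ∀ {m} → Poly m → Mono m → ℚ
coeff []              μ = 0ℚ
coeff ((q , ν) ∷ p)   μ with ≡-dec ℕ._≟_ ν μ
... | yes _ = q ℚ.+ coeff p μ
... | no  _ = coeff p μ

mulMono : ∀ {m} → Mono m → Poly m → Poly m
mulMono μ = List.map (λ { (q , ν) → (q , Vec.zipWith ℕ._+_ μ ν) })

sqfree : ∀ {m} → Subset m → Mono m
sqfree = Vec.map (λ { outside → 0 ; inside → 1 })

var : ∀ {m} → Fin m → Mono m
var j = Vec.updateAt (Vec.replicate _ 0) j (λ _ → 1)

-- A set S of elements of the building set is nested iff it is laminar: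
-- any two of its members are comparable or disjoint.  "Not nested" thus
-- means: two members that are incomparable and intersect.
NotNested : (n : ℕ) → Subset (N n) → Set
NotNested n S =
  Σ[ j ∈ Fin (N n) ] Σ[ k ∈ Fin (N n) ]
    (j ∈ S) × (k ∈ S) × ¬ (G n j ⊆ G n k) × ¬ (G n k ⊆ G n j)
    × (Σ[ v ∈ Fin n ] (v ∈ G n j) × (v ∈ G n k))

-- Linear generator for the atom {a,b} (an edge of K_n):
-- the sum of x_G over all G in the building set containing that atom.
linGen : (n : ℕ) → Fin n → Fin n → Poly (N n)
linGen n a b =
  List.map (λ j → (1ℚ , var j))
    (filter (λ j → (a ∈? G n j) ×-dec (b ∈? G n j)) (allFin (N n)))

-- Homogeneous generators of the Feichtner–Yuzvinsky ideal, with degrees.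
data FYGen (n : ℕ) : Poly (N n) → ℕ → Set where
  nonNested : (S : Subset (N n)) → NotNested n S →
              FYGen n [ (1ℚ , sqfree S) ] ∣ S ∣
  atom      : (a b : Fin n) → a ≢ b → FYGen n (linGen n a b) 1

-- Spanning family of the degree-i part of the ideal: μ·g with g a
-- generator of degree d and μ a monomial of degree k, k + d = i.
IdealSpan : (n i : ℕ) → Poly (N n) → Set
IdealSpan n i v =
  Σ[ g ∈ Poly (N n) ] Σ[ d ∈ ℕ ] Σ[ k ∈ ℕ ] Σ[ μ ∈ Mono (N n) ]
    FYGen n g d × (k ℕ.+ d ≡ i) × (μ ∈ₗ monos (N n) k) × (v ≡ mulMono μ g)

combo : ∀ {m r} → Vec ℚ r → Vec (Poly m) r → Mono m → ℚ
combo []       []       μ = 0ℚ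
combo (c ∷ cs) (b ∷ bs) μ = c ℚ.* coeff b μ ℚ.+ combo cs bs μ

LinIndep : ∀ {m r} → Vec (Poly m) r → Set
LinIndep {m} {r} bs =
  (c : Vec ℚ r) → (∀ μ → combo c bs μ ≡ 0ℚ) → ∀ k → Vec.lookup c k ≡ 0ℚ

InSpan : ∀ {m r} → Vec (Poly m) r → Poly m → Set
InSpan {m} {r} bs v = Σ[ c ∈ Vec ℚ r ] (∀ μ → coeff v μ ≡ combo c bs μ)

HasRank : ∀ {m} → (Poly m → Set) → ℕ → Set
HasRank {m} P r =
  Σ[ bs ∈ Vec (Poly m) r ]
    (∀ k → P (Vec.lookup bs k)) × LinIndep bs × (∀ v → P v → InSpan bs v)

-- dim_ℚ of the degree-i part of the FY Chow ring D(L(K_n), G_min) is d: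
-- d = (number of degree-i monomials) − dim(degree-i part of the ideal).
-- By the context, this is dim H^{2i}(M̄_{0,n+1}; ℚ).
ChowDim : (n i d : ℕ) → Set
ChowDim n i d =
  Σ[ r ∈ ℕ ] HasRank (IdealSpan n i) r × (d ℕ.+ r ≡ length (monos (N n) i))

-- univariate polynomials: coefficient lists, constant term first
UPoly : Set
UPoly = List ℚ

_⊕_ : UPoly → UPoly → UPoly
[]       ⊕ q        = q
(a ∷ p)  ⊕ []       = a ∷ p
(a ∷ p)  ⊕ (b ∷ q)  = (a ℚ.+ b) ∷ (p ⊕ q)

scale : ℚ → UPoly → UPoly
scale c = List.map (c ℚ.*_)

_⊗_ : UPoly → UPoly → UPoly
[]      ⊗ q = []
(a ∷ p) ⊗ q = scale a q ⊕ (0ℚ ∷ (p ⊗ q))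

uconst : ℚ → UPoly
uconst c = [ c ]

coeffAt : ℕ → UPoly → ℚ
coeffAt i    []      = 0ℚ
coeffAt zero (a ∷ p) = a
coeffAt (suc i) (a ∷ p) = coeffAt i p

chibar : ℕ → UPoly
chibar zero = uconst 1ℚ
chibar (suc zero) = uconst 1ℚ
chibar (suc (suc zero)) = uconst 1ℚ
chibar (suc (suc (suc k))) =
  chibar (suc (suc k)) ⊗ (ℚ.- (+ (suc (suc k)) / 1) ∷ 1ℚ ∷ [])

-- Set partitions of [k] = {1,…,k}, as lists of blocks (each set
-- partition occurs exactly once): the element k+1 is either a new
-- singleton block or inserted into one existing block.
insertEach : ℕ → List (List ℕ) → List (List (List ℕ))
insertEach x []       = []
insertEach x (B ∷ Bs) = ((x ∷ B) ∷ Bs) ∷ List.map (B ∷_) (insertEach x Bs)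

setPartitions : ℕ → List (List (List ℕ))
setPartitions zero    = [ [] ]
setPartitions (suc k) =
  concatMap (λ p → ([ suc k ] ∷ p) ∷ insertEach (suc k) p) (setPartitions k)

usum : List UPoly → UPoly
usum = List.foldr _⊕_ []

uprod : List UPoly → UPoly
uprod = List.foldr _⊗_ (uconst 1ℚ)

term : ℕ → List (List ℕ) → UPoly
term n λp =
  scale ((+ ((n ∸ 1 ℕ.+ length λp) !) / ((n ∸ 1) !)) {{(n ∸ 1) !≢0}})
    (uprod (List.map (λ B → scale (+ 1 / suc (length B))
                                  (chibar (suc (length B)))) λp))

rhs : ℕ → UPoly
rhs n = usum (List.map (term n) (setPartitions (n ∸ 1)))

{-# OPTIONS --safe #-}
module Submission where

-- Write h_T for the sum of the x_G over all G ⊇ T.  By Möbius inversion the Chow ring is generated by the h_T, and its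
-- relations become h_{a,b} = 0 and (h_S - h_U)(h_T - h_U) = 0 for S ∩ T ≠ ∅, U = S ∪ T.  Forgetting a point a, the
-- monomials on X ∪ a are spanned by the basis monomials on X together with the products h_{S ∪ a} w₁ w₂ over S ⊆ X,
-- |S| ≥ 2, where w₁ and w₂ are basis monomials on S and on the quotient of X ∪ a by S ∪ a: a linear form that kills these
-- and the relations is zero, by downward induction on S.  Independence is dual: the degree map sends a monomial
-- ∏ h_{S_j} to 1 if every V contains at most |V| - 2 of the S_j (a count matroid condition, for which the quadratic
-- relation is an exchange property) and to 0 otherwise, and products of degree maps along the divisors S ∪ a pair with
-- the basis triangularly.
--
-- Counting the basis gives F ′ = 1 + F + x F ′ (F - u) for the exponential generating function F of the Poincaré
-- polynomials.  Its powers satisfy a linear recursion, which is also satisfied by the coefficients of (1 - h) ^ (- n)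
-- predicted by Lagrange inversion, h being the generating function of the χ̄_{k+1}/(k+1).  Expanding (1 - h) ^ (- n) over
-- set partitions yields the formula at every rational x, hence as an identity of polynomials.

open import Defs
open import Data.Bool using (Bool; true; false)
open import Data.Empty using (⊥; ⊥-elim)
open import Data.Fin as Fin using (Fin)
import Data.Fin.Properties as Finₚ
open import Data.Fin.Subset using (Subset; _∈_; _∉_; ∣_∣; _∪_; _∩_; ⁅_⁆; inside; outside) renaming (⊥ to ⊥ₛ)
open import Data.Fin.Subset.Properties as Subsetₚ
  using (_∈?_; _⊆?_; ⊆-antisym; x∈p∪q⁺; x∈p∪q⁻; x∈p∩q⁺; x∈p∩q⁻; x∈⁅x⁆; x∈⁅y⁆⇒x≡y; ∪-comm; ∪-assoc;
         anySubset?; p⊂q⇒∣p∣<∣q∣; p⊆q⇒∣p∣≤∣q∣; ∣p∣≤n)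
open import Data.List as List using (List; []; _∷_; _++_; [_]; length; filter; concatMap)
import Data.List.Properties as Listₚ
open import Data.List.Membership.Propositional using (find) renaming (_∈_ to _∈ₗ_; _∉_ to _∉ₗ_)
import Data.List.Membership.Propositional.Properties as ∈ₗ
open import Data.List.Relation.Unary.All as All using (All; []; _∷_)
import Data.List.Relation.Unary.All.Properties as Allₚ
open import Data.List.Relation.Unary.Any as Any using (Any; here; there)
open import Data.List.Relation.Unary.AllPairs as AllPairs using (AllPairs; []; _∷_)
open import Data.List.Relation.Unary.Unique.Propositional using (Unique)
import Data.List.Relation.Unary.Unique.Propositional.Properties as Uniqueₚ
import Data.List.Relation.Unary.AllPairs.Properties as AllPairsₚ
open import Data.List.Relation.Binary.Permutation.Propositional as Perm using (_↭_; prep; swap; ↭-sym; ↭-trans; ↭-refl)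
import Data.List.Relation.Binary.Permutation.Propositional.Properties as Permₚ
open import Data.Nat as ℕ using (ℕ; zero; suc; _∸_; _≤_; _<_; z≤n; s≤s)
import Data.Nat.Properties as ℕₚ
open import Data.Product using (Σ; ∃; _×_; _,_; proj₁; proj₂)
open import Data.Rational as ℚ using (ℚ; 0ℚ; 1ℚ; _+_; _*_; _-_; -_; _/_)
import Data.Rational.Properties as ℚₚ
open import Data.Sum using (_⊎_; inj₁; inj₂; [_,_]′)
open import Data.Vec as Vec using (Vec)
import Data.Vec.Properties as Vecₚ
open import Function using (_∘_; id; case_of_)
open import Relation.Binary.PropositionalEquality hiding ([_])
open import Relation.Nullary using (¬_; Dec; yes; no; does)
open import Relation.Nullary.Decidable using (_×-dec_; _⊎-dec_; ¬?; dec-true; decidable-stable)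
open import Relation.Unary using (Decidable)
open import Algebra.Bundles using (CommutativeRing)
open import Algebra.Properties.CommutativeMonoid.Sum ℚₚ.+-0-commutativeMonoid using (sum; sum-cong-≗; ∑-distrib-+; ∑-comm; sum-replicate-zero)
open import Algebra.Properties.Semiring.Sum (CommutativeRing.semiring ℚₚ.+-*-commutativeRing) using (*-distribˡ-sum)
import Data.Integer as ℤ
import Data.Integer.Properties as ℤₚ
open import Data.Nat using (_!)
open import Data.Nat.Properties using (_!≢0)
open import Data.Rational.Solver using (module +-*-Solver)
open import Data.Rational.Unnormalised as ℚᵘ using (mkℚᵘ; *≡*)
import Data.Rational.Unnormalised.Properties as ℚᵘₚ

-- The quotient ring is never formed. Classes are tested by linear forms on monomials: spanning
-- means that a valid form killing the basis is zero, and multiplying by a class is precomposition.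
-- This fits `ChowDim`, which speaks only of ranks. The obstacle is the case S = X. For proper S the
-- divisor of S ∪ a is a product of two smaller spaces, but for S = X the set S ∪ a is the whole
-- ground set and there is no such product. The dual form then has to come from the map forgetting
-- a: up to sign, h of the whole set has degree one on its fibres, and pulled-back classes push
-- forward to zero. For the recursion to reproduce this, every basis monomial carries its dual forms
-- for all lists J of added points at once. The recursion has the additive shape of Keel's blow-up:
-- the space on X ∪ a is the space on X times a line, blown up along one copy of each boundary
-- divisor of the space on X. The summand S = X belongs to the line, the proper S to the blown-up
-- divisors. The series h is the one for which u (1 - h) is the compositional inverse of F.

splits : ∀ {A : Set} → List A → List (List A × List A)
splits []       = [ ([] , []) ]
splits (x ∷ xs) = List.map (λ (S , R) → S , x ∷ R) (splits xs) ++ List.map (λ (S , R) → x ∷ S , R) (splits xs)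

bigSplits : ∀ {A : Set} → List A → List (List A × List A)
bigSplits xs = filter (λ (S , _) → 2 ℕ.≤? length S) (splits xs)

indicator : ∀ {P : Set} → Dec P → ℚ
indicator (yes _) = 1ℚ
indicator (no _)  = 0ℚ

indicator-cong : ∀ {P Q : Set} → (P → Q) → (Q → P) → (P? : Dec P) (Q? : Dec Q) → indicator P? ≡ indicator Q?
indicator-cong f g (yes p) (yes q) = refl
indicator-cong f g (yes p) (no ¬q) = ⊥-elim (¬q (f p))
indicator-cong f g (no ¬p) (yes q) = ⊥-elim (¬p (g q))
indicator-cong f g (no ¬p) (no ¬q) = refl

indicator-no : ∀ {P : Set} → ¬ P → (P? : Dec P) → indicator P? ≡ 0ℚ
indicator-no ¬p (yes p) = ⊥-elim (¬p p)
indicator-no ¬p (no _)  = refl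

-- Subsets of the ground set, blow-up and contraction

module _ {n : ℕ} where

  sep : {P : Fin n → Set} → Decidable P → Subset n
  sep P? = Vec.tabulate (does ∘ P?)

  ∈-sep⁺ : {P : Fin n → Set} (P? : Decidable P) {x : Fin n} → P x → x ∈ sep P?
  ∈-sep⁺ P? {x} px = Vecₚ.lookup⇒[]= x _ (trans (Vecₚ.lookup∘tabulate _ x) (dec-true (P? x) px))

  ∈-sep⁻ : {P : Fin n → Set} (P? : Decidable P) {x : Fin n} → x ∈ sep P? → P x
  ∈-sep⁻ P? {x} x∈ with P? x | trans (sym (Vecₚ.lookup∘tabulate (does ∘ P?) x)) (Vecₚ.[]=⇒lookup x∈)
  ... | yes px | _ = px
  ... | no _   | ()

  infix 4 _⊑_ _⊑?_ _∈ₗ?_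

  _⊑_ : Subset n → Subset n → Set
  A ⊑ B = ∀ x → x ∈ A → x ∈ B

  abstract

    _⊑?_ : (A B : Subset n) → Dec (A ⊑ B)
    A ⊑? B = Finₚ.all? λ x → implies (x ∈? A) (x ∈? B)
      where
      implies : ∀ {P Q : Set} → Dec P → Dec Q → Dec (P → Q)
      implies _       (yes q) = yes λ _ → q
      implies (no ¬p) _       = yes λ p → ⊥-elim (¬p p)
      implies (yes p) (no ¬q) = no λ f → ¬q (f p)

  ⊑-antisym : {A B : Subset n} → A ⊑ B → B ⊑ A → A ≡ B
  ⊑-antisym A⊑B B⊑A = ⊆-antisym (A⊑B _) (B⊑A _)

  ⊑-trans : {A B C : Subset n} → A ⊑ B → B ⊑ C → A ⊑ C
  ⊑-trans A⊑B B⊑C x = B⊑C x ∘ A⊑B x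

  ¬⊑⇒∃ : {A B : Subset n} → ¬ A ⊑ B → ∃ λ x → x ∈ A × x ∉ B
  ¬⊑⇒∃ {A} {B} A⋢B with Finₚ.any? (λ x → (x ∈? A) ×-dec ¬? (x ∈? B))
  ... | yes w = w
  ... | no ¬w = ⊥-elim (A⋢B λ x x∈A → decidable-stable (x ∈? B) λ x∉B → ¬w (x , x∈A , x∉B))

  ∪⁺ˡ : (A B : Subset n) → A ⊑ A ∪ B
  ∪⁺ˡ A B x = x∈p∪q⁺ ∘ inj₁

  ∪⁺ʳ : (A B : Subset n) → B ⊑ A ∪ B
  ∪⁺ʳ A B x = x∈p∪q⁺ ∘ inj₂

  ∪-lub : {A B C : Subset n} → A ⊑ C → B ⊑ C → A ∪ B ⊑ C
  ∪-lub {A} {B} f g x x∈ = [ f x , g x ]′ (x∈p∪q⁻ A B x∈)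

  ∪-absorb : {A B : Subset n} → A ⊑ B → A ∪ B ≡ B
  ∪-absorb {A} {B} A⊑B = ⊑-antisym (∪-lub A⊑B (λ _ → id)) (∪⁺ʳ A B)

  ⁅⁆⊑ : {a : Fin n} {A : Subset n} → a ∈ A → ⁅ a ⁆ ⊑ A
  ⁅⁆⊑ {a} {A} a∈A x x∈ = subst (_∈ A) (sym (x∈⁅y⁆⇒x≡y a x∈)) a∈A

  pair⊑ : {a b : Fin n} {A : Subset n} → a ∈ A → b ∈ A → ⁅ a ⁆ ∪ ⁅ b ⁆ ⊑ A
  pair⊑ a∈A b∈A = ∪-lub (⁅⁆⊑ a∈A) (⁅⁆⊑ b∈A)

  Meets : Subset n → Subset n → Set
  Meets A B = ∃ λ x → x ∈ A × x ∈ B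

  abstract

    meets? : (A B : Subset n) → Dec (Meets A B)
    meets? A B = Finₚ.any? λ x → (x ∈? A) ×-dec (x ∈? B)

  Big : Subset n → Set
  Big A = ∃ λ a → ∃ λ b → a ∈ A × b ∈ A × a ≢ b

  abstract

    big? : (A : Subset n) → Dec (Big A)
    big? A = Finₚ.any? λ a → Finₚ.any? λ b → (a ∈? A) ×-dec (b ∈? A) ×-dec ¬? (a Fin.≟ b)

  Big-mono : {A B : Subset n} → A ⊑ B → Big A → Big B
  Big-mono A⊑B (a , b , a∈ , b∈ , a≢b) = a , b , A⊑B a a∈ , A⊑B b b∈ , a≢b

  pair-big : {a b : Fin n} → a ≢ b → Big (⁅ a ⁆ ∪ ⁅ b ⁆)
  pair-big {a} {b} a≢b = a , b , ∪⁺ˡ ⁅ a ⁆ ⁅ b ⁆ a (x∈⁅x⁆ a) , ∪⁺ʳ ⁅ a ⁆ ⁅ b ⁆ b (x∈⁅x⁆ b) , a≢b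

  small-nonempty : {c : Fin n} {A : Subset n} → c ∈ A → ¬ Big A → A ≡ ⁅ c ⁆
  small-nonempty {c} c∈A ¬big =
    ⊑-antisym (λ x x∈A → subst (_∈ ⁅ c ⁆) (decidable-stable (c Fin.≟ x) λ c≢x → ¬big (c , x , c∈A , x∈A , c≢x)) (x∈⁅x⁆ c))
              (⁅⁆⊑ c∈A)

  _∈ₗ?_ : (x : Fin n) (xs : List (Fin n)) → Dec (x ∈ₗ xs)
  x ∈ₗ? xs = Any.any? (x Fin.≟_) xs

  abstract

    ⟦_⟧ : List (Fin n) → Subset n
    ⟦ xs ⟧ = sep (_∈ₗ? xs)

    ∈-⟦⟧⁺ : ∀ xs {x} → x ∈ₗ xs → x ∈ ⟦ xs ⟧
    ∈-⟦⟧⁺ xs = ∈-sep⁺ (_∈ₗ? xs)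

    ∈-⟦⟧⁻ : ∀ xs {x} → x ∈ ⟦ xs ⟧ → x ∈ₗ xs
    ∈-⟦⟧⁻ xs = ∈-sep⁻ (_∈ₗ? xs)

  ⟦∷⟧⁻ : ∀ a xs {x} → x ∈ ⟦ a ∷ xs ⟧ → x ≡ a ⊎ x ∈ ⟦ xs ⟧
  ⟦∷⟧⁻ a xs x∈ with ∈-⟦⟧⁻ (a ∷ xs) x∈
  ... | here x≡a = inj₁ x≡a
  ... | there x∈xs = inj₂ (∈-⟦⟧⁺ xs x∈xs)

  ⟦∷⟧-there : ∀ a xs → ⟦ xs ⟧ ⊑ ⟦ a ∷ xs ⟧
  ⟦∷⟧-there a xs x x∈ = ∈-⟦⟧⁺ (a ∷ xs) (there (∈-⟦⟧⁻ xs x∈))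

  ⟦∷⟧-here : ∀ a xs → a ∈ ⟦ a ∷ xs ⟧
  ⟦∷⟧-here a xs = ∈-⟦⟧⁺ (a ∷ xs) (here refl)

  -- In the quotient the point a names the collapsed set S. A set T of the quotient is pulled back
  -- by putting S in the place of a; the point a itself is dropped, so that for S inside X the
  -- result lies in X and not only in X ∪ a.
  InBlowUp : Fin n → Subset n → Subset n → Fin n → Set
  InBlowUp a S T x = (x ∈ T × x ≢ a) ⊎ (a ∈ T × x ∈ S)

  abstract

    inBlowUp? : ∀ a S T → Decidable (InBlowUp a S T)
    inBlowUp? a S T x = ((x ∈? T) ×-dec ¬? (x Fin.≟ a)) ⊎-dec ((a ∈? T) ×-dec (x ∈? S))

    blowUp : Fin n → Subset n → Subset n → Subset n
    blowUp a S T = sep (inBlowUp? a S T)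

    ∈-blowUp⁺ : ∀ a S T {x} → InBlowUp a S T x → x ∈ blowUp a S T
    ∈-blowUp⁺ a S T = ∈-sep⁺ (inBlowUp? a S T)

    ∈-blowUp⁻ : ∀ a S T {x} → x ∈ blowUp a S T → InBlowUp a S T x
    ∈-blowUp⁻ a S T = ∈-sep⁻ (inBlowUp? a S T)

  -- The image of T under the map that collapses Q to q and fixes all other points. The quotient
  -- stays inside `Fin n`, so words on it have the same type as words on the whole.
  InContract : Subset n → Fin n → Subset n → Fin n → Set
  InContract Q q T x = (x ∈ T × x ∉ Q) ⊎ (x ≡ q × Meets T Q)

  abstract

    inContract? : ∀ Q q T → Decidable (InContract Q q T)
    inContract? Q q T x = ((x ∈? T) ×-dec ¬? (x ∈? Q)) ⊎-dec ((x Fin.≟ q) ×-dec meets? T Q)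

    contract : Subset n → Fin n → Subset n → Subset n
    contract Q q T = sep (inContract? Q q T)

    ∈-contract⁺ : ∀ Q q T {x} → InContract Q q T x → x ∈ contract Q q T
    ∈-contract⁺ Q q T = ∈-sep⁺ (inContract? Q q T)

    ∈-contract⁻ : ∀ Q q T {x} → x ∈ contract Q q T → InContract Q q T x
    ∈-contract⁻ Q q T = ∈-sep⁻ (inContract? Q q T)

  blowUp-∪ : ∀ a S A B → blowUp a S (A ∪ B) ≡ blowUp a S A ∪ blowUp a S B
  blowUp-∪ a S A B = ⊑-antisym to (∪-lub (from (∪⁺ˡ A B)) (from (∪⁺ʳ A B)))
    where
    from : ∀ {C} → C ⊑ A ∪ B → blowUp a S C ⊑ blowUp a S (A ∪ B)
    from {C} C⊑ x x∈ with ∈-blowUp⁻ a S C x∈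
    ... | inj₁ (p , q) = ∈-blowUp⁺ a S (A ∪ B) (inj₁ (C⊑ x p , q))
    ... | inj₂ (p , q) = ∈-blowUp⁺ a S (A ∪ B) (inj₂ (C⊑ a p , q))
    to : blowUp a S (A ∪ B) ⊑ blowUp a S A ∪ blowUp a S B
    to x x∈ with ∈-blowUp⁻ a S (A ∪ B) x∈
    ... | inj₁ (p , q) with x∈p∪q⁻ A B p
    ...   | inj₁ r = x∈p∪q⁺ (inj₁ (∈-blowUp⁺ a S A (inj₁ (r , q))))
    ...   | inj₂ r = x∈p∪q⁺ (inj₂ (∈-blowUp⁺ a S B (inj₁ (r , q))))
    to x x∈ | inj₂ (p , q) with x∈p∪q⁻ A B p
    ...   | inj₁ r = x∈p∪q⁺ (inj₁ (∈-blowUp⁺ a S A (inj₂ (r , q))))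
    ...   | inj₂ r = x∈p∪q⁺ (inj₂ (∈-blowUp⁺ a S B (inj₂ (r , q))))

  contract-∪ : ∀ Q q A B → contract Q q (A ∪ B) ≡ contract Q q A ∪ contract Q q B
  contract-∪ Q q A B = ⊑-antisym to (∪-lub (from (∪⁺ˡ A B)) (from (∪⁺ʳ A B)))
    where
    from : ∀ {C} → C ⊑ A ∪ B → contract Q q C ⊑ contract Q q (A ∪ B)
    from {C} C⊑ x x∈ with ∈-contract⁻ Q q C x∈
    ... | inj₁ (p , r) = ∈-contract⁺ Q q (A ∪ B) (inj₁ (C⊑ x p , r))
    ... | inj₂ (p , y , y∈C , y∈Q) = ∈-contract⁺ Q q (A ∪ B) (inj₂ (p , y , C⊑ y y∈C , y∈Q))
    to : contract Q q (A ∪ B) ⊑ contract Q q A ∪ contract Q q B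
    to x x∈ with ∈-contract⁻ Q q (A ∪ B) x∈
    ... | inj₁ (p , r) with x∈p∪q⁻ A B p
    ...   | inj₁ s = x∈p∪q⁺ (inj₁ (∈-contract⁺ Q q A (inj₁ (s , r))))
    ...   | inj₂ s = x∈p∪q⁺ (inj₂ (∈-contract⁺ Q q B (inj₁ (s , r))))
    to x x∈ | inj₂ (p , y , y∈AB , y∈Q) with x∈p∪q⁻ A B y∈AB
    ...   | inj₁ s = x∈p∪q⁺ (inj₁ (∈-contract⁺ Q q A (inj₂ (p , y , s , y∈Q))))
    ...   | inj₂ s = x∈p∪q⁺ (inj₂ (∈-contract⁺ Q q B (inj₂ (p , y , s , y∈Q))))

  blowUp-∉ : ∀ a S {T} → a ∉ T → blowUp a S T ≡ T
  blowUp-∉ a S {T} a∉T = ⊑-antisym to from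
    where
    to : blowUp a S T ⊑ T
    to x x∈ with ∈-blowUp⁻ a S T x∈
    ... | inj₁ (p , _) = p
    ... | inj₂ (p , _) = ⊥-elim (a∉T p)
    from : T ⊑ blowUp a S T
    from x x∈ = ∈-blowUp⁺ a S T (inj₁ (x∈ , λ x≡a → a∉T (subst (_∈ T) x≡a x∈)))

  S⊑blowUp : ∀ a S {T} → a ∈ T → S ⊑ blowUp a S T
  S⊑blowUp a S {T} a∈T x x∈ = ∈-blowUp⁺ a S T (inj₂ (a∈T , x∈))

  blowUp-meets : ∀ a {S A B} → Meets S S → Meets A B → Meets (blowUp a S A) (blowUp a S B)
  blowUp-meets a {S} {A} {B} (s , s∈ , _) (x , x∈A , x∈B) with x Fin.≟ a
  ... | yes refl = s , S⊑blowUp a S x∈A s s∈ , S⊑blowUp a S x∈B s s∈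
  ... | no x≢a = x , ∈-blowUp⁺ a S A (inj₁ (x∈A , x≢a)) , ∈-blowUp⁺ a S B (inj₁ (x∈B , x≢a))

  blowUp-pair : ∀ a {S c} → c ≢ a → blowUp a S (⁅ a ⁆ ∪ ⁅ c ⁆) ≡ S ∪ ⁅ c ⁆
  blowUp-pair a {S} {c} c≢a = ⊑-antisym to (∪-lub (S⊑blowUp a S (∪⁺ˡ ⁅ a ⁆ ⁅ c ⁆ a (x∈⁅x⁆ a))) (⁅⁆⊑ c∈))
    where
    to : blowUp a S (⁅ a ⁆ ∪ ⁅ c ⁆) ⊑ S ∪ ⁅ c ⁆
    to x x∈ with ∈-blowUp⁻ a S _ x∈
    ... | inj₂ (_ , q) = x∈p∪q⁺ (inj₁ q)
    ... | inj₁ (p , x≢a) with x∈p∪q⁻ ⁅ a ⁆ ⁅ c ⁆ p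
    ...   | inj₁ x∈a = ⊥-elim (x≢a (x∈⁅y⁆⇒x≡y a x∈a))
    ...   | inj₂ x∈c = x∈p∪q⁺ (inj₂ x∈c)
    c∈ : c ∈ blowUp a S (⁅ a ⁆ ∪ ⁅ c ⁆)
    c∈ = ∈-blowUp⁺ a S _ (inj₁ (∪⁺ʳ ⁅ a ⁆ ⁅ c ⁆ c (x∈⁅x⁆ c) , c≢a))

  -- Contraction turns a set P that meets S into a set through the collapsed point a, and blowing up
  -- puts all of S back. This makes S ∪ P a pull-back from the quotient, although P is not.
  blowUp-contract : ∀ a {S P} → a ∉ P → a ∉ S → Meets P S → blowUp a S (contract S a P) ≡ S ∪ P
  blowUp-contract a {S} {P} a∉P a∉S P∩S = ⊑-antisym to (∪-lub (S⊑blowUp a S a∈) from)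
    where
    a∈ : a ∈ contract S a P
    a∈ = ∈-contract⁺ S a P (inj₂ (refl , P∩S))
    to : blowUp a S (contract S a P) ⊑ S ∪ P
    to x x∈ with ∈-blowUp⁻ a S _ x∈
    ... | inj₂ (_ , q) = x∈p∪q⁺ (inj₁ q)
    ... | inj₁ (p , x≢a) with ∈-contract⁻ S a P p
    ...   | inj₁ (x∈P , _) = x∈p∪q⁺ (inj₂ x∈P)
    ...   | inj₂ (x≡a , _) = ⊥-elim (x≢a x≡a)
    from : P ⊑ blowUp a S (contract S a P)
    from x x∈P with x ∈? S
    ... | yes x∈S = S⊑blowUp a S a∈ x x∈S
    ... | no x∉S = ∈-blowUp⁺ a S _ (inj₁ (∈-contract⁺ S a P (inj₁ (x∈P , x∉S)) , λ { refl → a∉P x∈P }))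

  contract-disjoint : ∀ Q q {P} → ¬ Meets P Q → contract Q q P ≡ P
  contract-disjoint Q q {P} ¬m = ⊑-antisym to from
    where
    to : contract Q q P ⊑ P
    to x x∈ with ∈-contract⁻ Q q P x∈
    ... | inj₁ (p , _) = p
    ... | inj₂ (_ , m) = ⊥-elim (¬m m)
    from : P ⊑ contract Q q P
    from x x∈ = ∈-contract⁺ Q q P (inj₁ (x∈ , λ x∈Q → ¬m (x , x∈ , x∈Q)))

  -- Monomials in the h_T, forms on them, and the candidate basis

  Word : Set
  Word = List (Subset n)

  -- A word is a monomial in the h_T, and F M the value of a linear form at the monomial M.
  Functional : Set
  Functional = Word → ℚ

  On : Subset n → Word → Set
  On X = All λ T → T ⊑ X × Big T

  On-mono : ∀ {X Y M} → X ⊑ Y → On X M → On Y M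
  On-mono X⊑Y = All.map λ (p , q) → ⊑-trans p X⊑Y , q

  -- The fields are the relations of the ring, each times a monomial, tested on F: commutativity,
  -- (h_S - h_U)(h_T - h_U) = 0 with the negative terms moved to the right, and h_{a,b} = 0. They
  -- are relative to X so that a form on a ground set restricts to smaller ones.
  record ValidOn (X : Subset n) (F : Functional) : Set where
    field
      perm : ∀ {M N} → M ↭ N → F M ≡ F N
      quad : ∀ S T M → S ⊑ X → T ⊑ X → Big S → Big T → Meets S T → On X M →
             F (S ∷ T ∷ M) + F (S ∪ T ∷ S ∪ T ∷ M) ≡ F (S ∷ S ∪ T ∷ M) + F (T ∷ S ∪ T ∷ M)
      pair : ∀ a b M → a ∈ X → b ∈ X → a ≢ b → On X M → F (⁅ a ⁆ ∪ ⁅ b ⁆ ∷ M) ≡ 0ℚ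

  abstract

    count⊑ : Subset n → Word → ℕ
    count⊑ V M = length (filter (_⊑? V) M)

    count-[] : ∀ V → count⊑ V [] ≡ 0
    count-[] V = refl

    count-yes : ∀ V {T} M → T ⊑ V → count⊑ V (T ∷ M) ≡ suc (count⊑ V M)
    count-yes V M T⊑ = cong length (Listₚ.filter-accept (_⊑? V) {xs = M} T⊑)

    count-no : ∀ V {T} M → ¬ T ⊑ V → count⊑ V (T ∷ M) ≡ count⊑ V M
    count-no V M T⋢ = cong length (Listₚ.filter-reject (_⊑? V) {xs = M} T⋢)

    count-↭ : ∀ V {M N} → M ↭ N → count⊑ V M ≡ count⊑ V N
    count-↭ V p = Permₚ.↭-length (Permₚ.filter-↭ (_⊑? V) p)

    count-≤-length : ∀ V M → count⊑ V M ≤ length M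
    count-≤-length V M = Listₚ.length-filter (_⊑? V) M

    count-all : ∀ V {M} → All (_⊑ V) M → count⊑ V M ≡ length M
    count-all V all = cong length (Listₚ.filter-all (_⊑? V) all)

  Sparse : Word → Set
  Sparse M = ∀ V → count⊑ V M ≤ ∣ V ∣ ∸ 2

  abstract

    sparse? : (M : Word) → Dec (Sparse M)
    sparse? M with anySubset? (λ V → ¬? (count⊑ V M ℕ.≤? ∣ V ∣ ∸ 2))
    ... | yes (V , ¬p) = no λ sp → ¬p (sp V)
    ... | no ¬∃ = yes λ V → decidable-stable (count⊑ V M ℕ.≤? ∣ V ∣ ∸ 2) λ ¬p → ¬∃ (V , ¬p)

  -- The degree map on j + 2 points; the truncation in ∣ V ∣ ∸ 2 also makes it vanish on words containing small sets.
  top : ℕ → Functional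
  top j M = indicator (sparse? M ×-dec (length M ℕ.≟ j))

  -- The form on the divisor of Q, where the quotient by Q is realised by contracting Q to the point q.
  infix 8 _⊗[_,_]_

  _⊗[_,_]_ : Functional → Subset n → Fin n → Functional → Functional
  (F ⊗[ Q , q ] G) M = F (filter (_⊑? Q) M) * G (List.map (contract Q q) (filter (λ T → ¬? (T ⊑? Q)) M))

  -- A basis monomial on a ground set X, with a family of forms dual to it: the form for the list J lives on X ∪ J and is
  -- the composite of the form for [] with the push-forward along the map forgetting the points of J.
  Item : Set
  Item = Word × (List (Fin n) → Functional)

  -- Pull-back along the map forgetting one new point. The dual form lives on the divisor of
  -- `⟦ xs ⟧`, which is a section of that map; once the points of J are added, the quotient consists
  -- of the contracted point, the new point and J. These are |J| + 2 points, as `top (length J)`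
  -- expects.
  lift : Fin n → List (Fin n) → Item → Item
  lift a xs (w , Φ) = w , λ J → Φ [] ⊗[ ⟦ xs ⟧ , a ] top (length J)

  -- When R is empty, a ∪ S is the whole ground set X, and a is treated as one more point to be
  -- forgotten, next to J. Otherwise the form is a product on the divisor of a ∪ S, where the inner
  -- factor has a as its only added point and the points of J all go to the quotient.
  graftF : Fin n → List (Fin n) → List (Fin n) → (List (Fin n) → Functional) → (List (Fin n) → Functional) → List (Fin n) → Functional
  graftF a S []      Φ₁ Φ₂ J = Φ₁ (J ++ [ a ])
  graftF a S (_ ∷ _) Φ₁ Φ₂ J = Φ₁ [ a ] ⊗[ ⁅ a ⁆ ∪ ⟦ S ⟧ , a ] Φ₂ J

  graftW : Fin n → List (Fin n) → Word → Word → Word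
  graftW a S w₁ w₂ = ⁅ a ⁆ ∪ ⟦ S ⟧ ∷ w₁ ++ List.map (blowUp a ⟦ S ⟧) w₂

  graft : Fin n → List (Fin n) → List (Fin n) → Item → Item → Item
  graft a S R (w₁ , Φ₁) (w₂ , Φ₂) = graftW a S w₁ w₂ , graftF a S R Φ₁ Φ₂

  tensor : (Item → Item → Item) → List Item → List Item → List Item
  tensor g L₁ L₂ = concatMap (λ p → List.map (g p) L₂) L₁

  -- The first argument is fuel, in use at least the length of the list: S and a ∷ R are shorter
  -- than the list but not structural parts of it. The grafts stand before the lifts, and in the
  -- order of the splits, since in this order the pairing with the dual forms is block triangular.
  basis : ℕ → List (Fin n) → List Item
  basis zero    _            = []
  basis (suc k) []           = []
  basis (suc k) (a ∷ [])     = [ ([] , λ J → top (length J)) ]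
  basis (suc k) (a ∷ b ∷ xs) =
    concatMap (λ (S , R) → tensor (graft a S R) (basis k S) (basis k (a ∷ R))) (bigSplits (b ∷ xs))
    ++ List.map (lift b (b ∷ xs)) (basis k (b ∷ xs))

-- Splittings of the ground set

splits-union : ∀ {A : Set} (xs : List A) {S R} → (S , R) ∈ₗ splits xs →
               (∀ {x} → x ∈ₗ xs → x ∈ₗ S ⊎ x ∈ₗ R) × (∀ {x} → x ∈ₗ S → x ∈ₗ xs) × (∀ {x} → x ∈ₗ R → x ∈ₗ xs)
splits-union [] (here refl) = (λ ()) , (λ ()) , (λ ())
splits-union (x ∷ xs) SR∈ with ∈ₗ.∈-++⁻ (List.map _ (splits xs)) SR∈
... | inj₁ p with ∈ₗ.∈-map⁻ _ p
...   | ((S , R) , q , refl) with splits-union xs q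
...     | f , g , h = (λ { (here e) → inj₂ (here e) ; (there z) → [ inj₁ , inj₂ ∘ there ]′ (f z) })
                      , there ∘ g , λ { (here e) → here e ; (there z) → there (h z) }
splits-union (x ∷ xs) SR∈ | inj₂ p with ∈ₗ.∈-map⁻ _ p
...   | ((S , R) , q , refl) with splits-union xs q
...     | f , g , h = (λ { (here e) → inj₁ (here e) ; (there z) → [ inj₁ ∘ there , inj₂ ]′ (f z) })
                      , (λ { (here e) → here e ; (there z) → there (g z) }) , there ∘ h

splits-unique : ∀ {A : Set} (xs : List A) {S R} → (S , R) ∈ₗ splits xs → Unique xs →
                Unique S × Unique R × (∀ {x} → x ∈ₗ S → x ∉ₗ R)
splits-unique [] (here refl) [] = [] , [] , λ ()
splits-unique (x ∷ xs) SR∈ (x∉ ∷ u) with ∈ₗ.∈-++⁻ (List.map _ (splits xs)) SR∈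
... | inj₁ p with ∈ₗ.∈-map⁻ _ p
...   | ((S , R) , q , refl) with splits-unique xs q u | splits-union xs q
...     | uS , uR , d | _ , g , h =
          uS , All.tabulate (λ z → All.lookup x∉ (h z)) ∷ uR
          , λ { s∈ (here refl) → All.lookup x∉ (g s∈) refl ; s∈ (there r∈) → d s∈ r∈ }
splits-unique (x ∷ xs) SR∈ (x∉ ∷ u) | inj₂ p with ∈ₗ.∈-map⁻ _ p
...   | ((S , R) , q , refl) with splits-unique xs q u | splits-union xs q
...     | uS , uR , d | _ , g , h =
          All.tabulate (λ z → All.lookup x∉ (g z)) ∷ uS , uR
          , λ { (here refl) r∈ → All.lookup x∉ (h r∈) refl ; (there s∈) r∈ → d s∈ r∈ }

splits-length : ∀ {A : Set} (xs : List A) {S R} → (S , R) ∈ₗ splits xs → length S ℕ.+ length R ≡ length xs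
splits-length [] (here refl) = refl
splits-length (x ∷ xs) SR∈ with ∈ₗ.∈-++⁻ (List.map _ (splits xs)) SR∈
... | inj₁ p with ∈ₗ.∈-map⁻ _ p
...   | ((S , R) , q , refl) = trans (ℕₚ.+-suc (length S) (length R)) (cong suc (splits-length xs q))
splits-length (x ∷ xs) SR∈ | inj₂ p with ∈ₗ.∈-map⁻ _ p
...   | ((S , R) , q , refl) = cong suc (splits-length xs q)

splits-filter : ∀ {A : Set} {P : A → Set} (P? : Decidable P) (xs : List A) →
                (filter P? xs , filter (¬? ∘ P?) xs) ∈ₗ splits xs
splits-filter P? [] = here refl
splits-filter P? (x ∷ xs) with does (P? x)
... | true  = ∈ₗ.∈-++⁺ʳ (List.map _ (splits xs)) (∈ₗ.∈-map⁺ _ (splits-filter P? xs))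
... | false = ∈ₗ.∈-++⁺ˡ (∈ₗ.∈-map⁺ _ (splits-filter P? xs))

module _ {n : ℕ} where

  nonempty-resp : ∀ {S : Subset n} → Big S → Meets S S
  nonempty-resp (a , _ , a∈ , _) = a , a∈ , a∈

  big⟦⟧ : {xs : List (Fin n)} → Unique xs → 2 ≤ length xs → Big ⟦ xs ⟧
  big⟦⟧ {a ∷ b ∷ xs} ((a≢b ∷ _) ∷ _) _ = a , b , ⟦∷⟧-here a (b ∷ xs) , ⟦∷⟧-there a (b ∷ xs) b (⟦∷⟧-here b xs) , a≢b
  big⟦⟧ {_ ∷ []} _ (s≤s ())

  big-length : (xs : List (Fin n)) → Big ⟦ xs ⟧ → 2 ≤ length xs
  big-length xs (a , b , a∈ , b∈ , a≢b) with xs | ∈-⟦⟧⁻ xs a∈ | ∈-⟦⟧⁻ xs b∈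
  ... | _ ∷ _ ∷ _ | _ | _ = s≤s (s≤s z≤n)
  ... | _ ∷ [] | here refl | here refl = ⊥-elim (a≢b refl)

  record Split (a : Fin n) (xs S R : List (Fin n)) : Set where
    field
      S⊑     : ⟦ S ⟧ ⊑ ⟦ xs ⟧
      R⊑     : ⟦ R ⟧ ⊑ ⟦ xs ⟧
      cover  : ∀ x → x ∈ ⟦ xs ⟧ → x ∈ ⟦ S ⟧ ⊎ x ∈ ⟦ R ⟧
      disj   : ∀ x → x ∈ ⟦ S ⟧ → x ∉ ⟦ R ⟧
      uS     : Unique S
      uR     : Unique (a ∷ R)
      bigS   : Big ⟦ S ⟧
      lenS   : length S ≤ length xs
      lenR   : length (a ∷ R) ≤ length xs
      len2   : 2 ≤ length S

  split : ∀ a xs {S R} → Unique (a ∷ xs) → (S , R) ∈ₗ bigSplits xs → Split a xs S R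
  split a xs {S} {R} (a∉ ∷ u) SR∈ with ∈ₗ.∈-filter⁻ (λ (S , _) → 2 ℕ.≤? length S) {xs = splits xs} SR∈
  ... | q , 2≤ with splits-union xs q | splits-unique xs q u | splits-length xs q
  ...   | f , g , h | uS , uR , d | len = record
    { S⊑ = λ x x∈ → ∈-⟦⟧⁺ xs (g (∈-⟦⟧⁻ S x∈))
    ; R⊑ = λ x x∈ → ∈-⟦⟧⁺ xs (h (∈-⟦⟧⁻ R x∈))
    ; cover = λ x x∈ → [ inj₁ ∘ ∈-⟦⟧⁺ S , inj₂ ∘ ∈-⟦⟧⁺ R ]′ (f (∈-⟦⟧⁻ xs x∈))
    ; disj = λ x x∈ x∈′ → d (∈-⟦⟧⁻ S x∈) (∈-⟦⟧⁻ R x∈′)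
    ; uS = uS
    ; uR = All.tabulate (λ z → All.lookup a∉ (h z)) ∷ uR
    ; bigS = big⟦⟧ uS 2≤
    ; lenS = subst (length S ≤_) len (ℕₚ.m≤m+n _ _)
    ; lenR = subst (suc (length R) ≤_) len (ℕₚ.+-monoˡ-≤ (length R) (ℕₚ.≤-trans (s≤s z≤n) 2≤))
    ; len2 = 2≤
    }

  a∉⟦⟧ : ∀ {a : Fin n} {xs} → Unique (a ∷ xs) → a ∉ ⟦ xs ⟧
  a∉⟦⟧ {xs = xs} (a∉ ∷ _) a∈ = All.lookup a∉ (∈-⟦⟧⁻ xs a∈) refl

  blowUp-on : ∀ {a xs S R} → Split a xs S R → ∀ {M} → On ⟦ a ∷ R ⟧ M → On ⟦ xs ⟧ (List.map (blowUp a ⟦ S ⟧) M)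
  blowUp-on {a} {xs} {S} {R} sp on = Allₚ.map⁺ (All.map (λ (p , q) → one p q) on)
    where
    open Split sp
    one : ∀ {T} → T ⊑ ⟦ a ∷ R ⟧ → Big T → blowUp a ⟦ S ⟧ T ⊑ ⟦ xs ⟧ × Big (blowUp a ⟦ S ⟧ T)
    one {T} T⊑ bigT = to , big
      where
      to : blowUp a ⟦ S ⟧ T ⊑ ⟦ xs ⟧
      to x x∈ with ∈-blowUp⁻ a ⟦ S ⟧ T x∈
      ... | inj₂ (_ , q) = S⊑ x q
      ... | inj₁ (p , x≢a) with ⟦∷⟧⁻ a R (T⊑ x p)
      ...   | inj₁ x≡a = ⊥-elim (x≢a x≡a)
      ...   | inj₂ x∈R = R⊑ x x∈R
      big : Big (blowUp a ⟦ S ⟧ T)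
      big with a ∈? T
      ... | yes a∈T = Big-mono (S⊑blowUp a ⟦ S ⟧ a∈T) bigS
      ... | no a∉T = subst Big (sym (blowUp-∉ a ⟦ S ⟧ a∉T)) bigT

  star⊑ : ∀ a {xs} {S : Subset n} → S ⊑ ⟦ xs ⟧ → ⁅ a ⁆ ∪ S ⊑ ⟦ a ∷ xs ⟧
  star⊑ a {xs} S⊑ = ∪-lub (⁅⁆⊑ (⟦∷⟧-here a xs)) (⊑-trans S⊑ (⟦∷⟧-there a xs))

  basis-on : ∀ k (xs : List (Fin n)) → Unique xs → ∀ {p} → p ∈ₗ basis k xs → On ⟦ xs ⟧ (proj₁ p)
  basis-on (suc k) (a ∷ []) u (here refl) = []
  basis-on (suc k) (a ∷ b ∷ xs) u@(_ ∷ u′) p∈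
    with ∈ₗ.∈-++⁻ (concatMap (λ (S , R) → tensor (graft a S R) (basis k S) (basis k (a ∷ R))) (bigSplits (b ∷ xs))) p∈
  ... | inj₂ q with ∈ₗ.∈-map⁻ _ q
  ...   | (_ , r , refl) = On-mono (⟦∷⟧-there a (b ∷ xs)) (basis-on k (b ∷ xs) u′ r)
  basis-on (suc k) (a ∷ b ∷ xs) u@(_ ∷ u′) p∈ | inj₁ q
    with find (∈ₗ.∈-concatMap⁻ _ {xs = bigSplits (b ∷ xs)} q)
  ... | ((S , R) , SR∈ , r) with find (∈ₗ.∈-concatMap⁻ _ {xs = basis k S} r)
  ...   | ((w₁ , _) , w₁∈ , s) with ∈ₗ.∈-map⁻ _ s
  ...     | ((w₂ , _) , w₂∈ , refl) =
    (star⊑ a S⊑ , Big-mono (∪⁺ʳ ⁅ a ⁆ ⟦ S ⟧) bigS)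
    ∷ On-mono (⟦∷⟧-there a (b ∷ xs)) (Allₚ.++⁺ (On-mono S⊑ (basis-on k S uS w₁∈)) (blowUp-on sp (basis-on k (a ∷ R) uR w₂∈)))
    where
    sp = split a (b ∷ xs) u SR∈
    open Split sp

-- The basis spans

star-∪ : ∀ {n} (A S T : Subset n) → (A ∪ S) ∪ (A ∪ T) ≡ A ∪ (S ∪ T)
star-∪ A S T = ⊑-antisym
  (∪-lub (∪-lub (∪⁺ˡ A (S ∪ T)) (⊑-trans (∪⁺ˡ S T) (∪⁺ʳ A (S ∪ T))))
         (∪-lub (∪⁺ˡ A (S ∪ T)) (⊑-trans (∪⁺ʳ S T) (∪⁺ʳ A (S ∪ T)))))
  (∪-lub (⊑-trans (∪⁺ˡ A S) (∪⁺ˡ (A ∪ S) (A ∪ T)))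
         (∪-lub (⊑-trans (∪⁺ʳ A S) (∪⁺ˡ (A ∪ S) (A ∪ T))) (⊑-trans (∪⁺ʳ A T) (∪⁺ʳ (A ∪ S) (A ∪ T)))))

module ℚ-Lemmas where
  open import Algebra.Properties.Group ℚₚ.+-0-group using () renaming (∙-cancelˡ to +-cancelˡ)

  -- Here and in the next two lemmas p + q = r + s is the quadratic relation, with p, q, r, s the
  -- values at S T, U U, S U, T U; the lemmas differ in which of the four terms vanish.
  drop-ends : ∀ {p q r s} → p + q ≡ r + s → q ≡ 0ℚ → s ≡ 0ℚ → p ≡ r
  drop-ends {p} {_} {r} e refl refl = trans (sym (ℚₚ.+-identityʳ p)) (trans e (ℚₚ.+-identityʳ r))

  zero-sum : ∀ {p q r s} → p + q ≡ r + s → q ≡ 0ℚ → r ≡ 0ℚ → s ≡ 0ℚ → p ≡ 0ℚ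
  zero-sum {p} e refl refl refl = trans (sym (ℚₚ.+-identityʳ p)) e

  cross-ends : ∀ {p q r s} → p + q ≡ r + s → p ≡ 0ℚ → s ≡ 0ℚ → q ≡ r
  cross-ends {_} {q} {r} e refl refl = trans (sym (ℚₚ.+-identityˡ q)) (trans e (ℚₚ.+-identityʳ r))

  cancel-mid : ∀ {p q r} → p + q ≡ q + r → p ≡ r
  cancel-mid {p} {q} {r} e = +-cancelˡ q p r (trans (ℚₚ.+-comm q p) e)

open ℚ-Lemmas public

-- The induction hypothesis quantifies over all forms, because it is applied not only to F but also
-- to F precomposed with multiplication by h_{S ∪ a} and by a word on one of the two factors.
module Spanning {n : ℕ} {k : ℕ} {a b : Fin n} {xs : List (Fin n)} (u : Unique (a ∷ b ∷ xs))
  {F : Functional {n}} (valid : ValidOn ⟦ a ∷ b ∷ xs ⟧ F)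
  (kills : ∀ {p : Item {n}} → p ∈ₗ basis (suc k) (a ∷ b ∷ xs) → F (proj₁ p) ≡ 0ℚ)
  (len : length (b ∷ xs) ≤ k)
  (IH : ∀ (ys : List (Fin n)) {G : Functional {n}} → length ys ≤ k → 1 ≤ length ys → Unique ys → ValidOn ⟦ ys ⟧ G →
        (∀ {p : Item {n}} → p ∈ₗ basis k ys → G (proj₁ p) ≡ 0ℚ) → ∀ M → On ⟦ ys ⟧ M → G M ≡ 0ℚ) where

  open ValidOn valid

  X X′ : Subset n
  X  = ⟦ a ∷ b ∷ xs ⟧
  X′ = ⟦ b ∷ xs ⟧

  X′⊑X : X′ ⊑ X
  X′⊑X = ⟦∷⟧-there a (b ∷ xs)

  a∈X : a ∈ X
  a∈X = ⟦∷⟧-here a (b ∷ xs)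

  a∉X′ : a ∉ X′
  a∉X′ = a∉⟦⟧ u

  st : Subset n → Subset n
  st S = ⁅ a ⁆ ∪ S

  st⊑ : ∀ {S} → S ⊑ X′ → st S ⊑ X
  st⊑ = star⊑ a

  st-big : ∀ {S} → Big S → Big (st S)
  st-big {S} = Big-mono (∪⁺ʳ ⁅ a ⁆ S)

  a∈st : ∀ S → a ∈ st S
  a∈st S = ∪⁺ˡ ⁅ a ⁆ S a (x∈⁅x⁆ a)

  on′ : ∀ {M} → On X′ M → On X M
  on′ = On-mono X′⊑X

  no-a : ∀ M → On X′ M → F M ≡ 0ℚ
  no-a M on = IH (b ∷ xs) len (s≤s z≤n) (AllPairs.tail u)
    (record { perm = perm
            ; quad = λ S T N S⊑ T⊑ bS bT m o → quad S T N (⊑-trans S⊑ X′⊑X) (⊑-trans T⊑ X′⊑X) bS bT m (on′ o)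
            ; pair = λ c d N c∈ d∈ c≢d o → pair c d N (X′⊑X c c∈) (X′⊑X d d∈) c≢d (on′ o) })
    (λ {p} p∈ → kills (∈ₗ.∈-++⁺ʳ (concatMap (λ (S , R) → tensor (graft a S R) (basis k S) (basis k (a ∷ R))) (bigSplits (b ∷ xs)))
                               (∈ₗ.∈-map⁺ (lift b (b ∷ xs)) p∈)))
    M on

  -- The quadratic relation for U and an edge {a, c} with c in U: their union is U ∪ a, and the two
  -- terms containing h_{a,c} vanish.
  square : ∀ U M → U ⊑ X′ → Big U → On X M → F (st U ∷ st U ∷ M) ≡ F (U ∷ st U ∷ M)
  square U M U⊑ bU@(c , _ , c∈ , _) on =
    cross-ends
      (subst (λ V → F (U ∷ ac ∷ M) + F (V ∷ V ∷ M) ≡ F (U ∷ V ∷ M) + F (ac ∷ V ∷ M)) eq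
        (quad U ac M (⊑-trans U⊑ X′⊑X) ac⊑ bU (pair-big a≢c) (c , c∈ , ∪⁺ʳ ⁅ a ⁆ ⁅ c ⁆ c (x∈⁅x⁆ c)) on))
      (trans (perm (swap U ac ↭-refl)) (pair a c (U ∷ M) a∈X c∈X a≢c ((⊑-trans U⊑ X′⊑X , bU) ∷ on)))
      (pair a c (st U ∷ M) a∈X c∈X a≢c ((st⊑ U⊑ , st-big bU) ∷ on))
    where
    ac = ⁅ a ⁆ ∪ ⁅ c ⁆
    c∈X = X′⊑X c (U⊑ c c∈)
    ac⊑ = pair⊑ a∈X c∈X
    a≢c : a ≢ c
    a≢c refl = a∉X′ (U⊑ c c∈)
    eq : U ∪ ac ≡ st U
    eq = trans (cong (U ∪_) (∪-comm ⁅ a ⁆ ⁅ c ⁆)) (trans (sym (∪-assoc U ⁅ c ⁆ ⁅ a ⁆))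
           (trans (∪-comm (U ∪ ⁅ c ⁆) ⁅ a ⁆) (cong (⁅ a ⁆ ∪_) (trans (∪-comm U ⁅ c ⁆) (∪-absorb (⁅⁆⊑ c∈))))))

  -- If h_{U ∪ a} is killed for all U ⊋ S, then multiplying by h_{S ∪ a} identifies h_P with h_{P ∪ S} whenever P crosses S.
  module Claim (S : Subset n) (S⊑ : S ⊑ X′) (bS : Big S)
    (larger : ∀ U → U ⊑ X′ → S ⊑ U → ¬ U ⊑ S → ∀ M → On X′ M → F (st U ∷ M) ≡ 0ℚ) where

    -- In the quadratic relation for S ∪ a and P the union is U ∪ a with U larger than S. The terms
    -- h_{U ∪ a}² (through `square`) and h_P h_{U ∪ a} are h_{U ∪ a} times a word on X′, hence zero
    -- by `larger`. The term h_{S ∪ a} h_{U ∪ a} remains, as its other factor contains a too.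
    grow : ∀ P M → P ⊑ X′ → Big P → Meets P S → ¬ P ⊑ S → On X′ M → F (st S ∷ P ∷ M) ≡ F (st S ∷ st (S ∪ P) ∷ M)
    grow P M P⊑ bP (x , x∈P , x∈S) P⋢S on =
      drop-ends
        (subst (λ V → F (st S ∷ P ∷ M) + F (V ∷ V ∷ M) ≡ F (st S ∷ V ∷ M) + F (P ∷ V ∷ M)) (∪-assoc ⁅ a ⁆ S P)
          (quad (st S) P M (st⊑ S⊑) (⊑-trans P⊑ X′⊑X) (st-big bS) bP (x , ∪⁺ʳ ⁅ a ⁆ S x x∈S , x∈P) (on′ on)))
        (trans (square U M U⊑ bU (on′ on)) (trans (perm (swap U (st U) ↭-refl)) (zeroU (U ∷ M) ((U⊑ , bU) ∷ on))))
        (trans (perm (swap P (st U) ↭-refl)) (zeroU (P ∷ M) ((P⊑ , bP) ∷ on)))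
      where
      U = S ∪ P
      U⊑ = ∪-lub S⊑ P⊑
      bU = Big-mono (∪⁺ˡ S P) bS
      zeroU = larger U U⊑ (∪⁺ˡ S P) (λ U⊑S → P⋢S (⊑-trans (∪⁺ʳ S P) U⊑S))

    -- P and S ∪ P have the same union with S, so `grow` sends both to the same product, which is
    -- thereby eliminated.
    absorb : ∀ P M → P ⊑ X′ → Big P → Meets P S → ¬ P ⊑ S → On X′ M → F (st S ∷ P ∷ M) ≡ F (st S ∷ S ∪ P ∷ M)
    absorb P M P⊑ bP m@(x , x∈P , x∈S) P⋢S on =
      trans (grow P M P⊑ bP m P⋢S on)
        (sym (trans (grow (S ∪ P) M (∪-lub S⊑ P⊑) (Big-mono (∪⁺ˡ S P) bS) (x , ∪⁺ˡ S P x x∈S , x∈S)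
                          (λ q → P⋢S (⊑-trans (∪⁺ʳ S P) q)) on)
                    (cong (λ V → F (st S ∷ st V ∷ M)) (∪-absorb (∪⁺ˡ S P)))))

    Sl Rl : List (Fin n)
    Sl = filter (_∈? S) (b ∷ xs)
    Rl = filter (¬? ∘ (_∈? S)) (b ∷ xs)

    Sl≡S : ⟦ Sl ⟧ ≡ S
    Sl≡S = ⊑-antisym
      (λ x x∈ → proj₂ (∈ₗ.∈-filter⁻ (_∈? S) {xs = b ∷ xs} (∈-⟦⟧⁻ Sl x∈)))
      (λ x x∈ → ∈-⟦⟧⁺ Sl (∈ₗ.∈-filter⁺ (_∈? S) (∈-⟦⟧⁻ (b ∷ xs) (S⊑ x x∈)) x∈))

    SR∈ : (Sl , Rl) ∈ₗ bigSplits (b ∷ xs)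
    SR∈ = ∈ₗ.∈-filter⁺ (λ (S , _) → 2 ℕ.≤? length S) (splits-filter (_∈? S) (b ∷ xs))
            (big-length Sl (subst Big (sym Sl≡S) bS))

    sp : Split a (b ∷ xs) Sl Rl
    sp = split a (b ∷ xs) u SR∈

    module Sp = Split sp

    bl : Subset n → Subset n
    bl = blowUp a S

    bl-on : ∀ {M} → On ⟦ a ∷ Rl ⟧ M → On X′ (List.map bl M)
    bl-on {M} on = subst (λ V → On X′ (List.map (blowUp a V) M)) Sl≡S (blowUp-on sp {M} on)

    on-S : ∀ {M} → On ⟦ Sl ⟧ M → On X′ M
    on-S = On-mono Sp.S⊑

    front₂ : ∀ A B (M N : Word) → F (st S ∷ M ++ A ∷ B ∷ N) ≡ F (A ∷ B ∷ st S ∷ M ++ N)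
    front₂ A B M N = perm (↭-trans (prep (st S) (↭-trans (Permₚ.shift A M (B ∷ N)) (prep A (Permₚ.shift B M N))))
                                   (↭-trans (swap (st S) A ↭-refl) (prep A (swap (st S) B ↭-refl))))

    second : ∀ A (M N : Word) → F (st S ∷ M ++ A ∷ N) ≡ F (st S ∷ A ∷ M ++ N)
    second A M N = perm (prep (st S) (Permₚ.shift A M N))

    front : ∀ A (M N : Word) → F (st S ∷ M ++ A ∷ N) ≡ F (A ∷ st S ∷ M ++ N)
    front A M N = trans (second A M N) (perm (swap (st S) A ↭-refl))

    outer : Word → Functional
    outer M₁ M₂ = F (st S ∷ M₁ ++ List.map bl M₂)

    stS-on : st S ⊑ X × Big (st S)
    stS-on = st⊑ S⊑ , st-big bS

    R⊑X′ : ∀ {c} → c ∈ ⟦ Rl ⟧ → c ∈ X′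
    R⊑X′ {c} = Sp.R⊑ c

    outer-valid : ∀ M₁ → On ⟦ Sl ⟧ M₁ → ValidOn ⟦ a ∷ Rl ⟧ (outer M₁)
    outer-valid M₁ on₁ = record
      { perm = λ p → perm (prep (st S) (Permₚ.++⁺ˡ M₁ (Permₚ.map⁺ bl p)))
      ; quad = λ A B M A⊑ B⊑ bA bB m on → q A B M A⊑ B⊑ bA bB m on
      ; pair = pr
      }
      where
      rest-on : ∀ {M} → On ⟦ a ∷ Rl ⟧ M → On X (st S ∷ M₁ ++ List.map bl M)
      rest-on on = stS-on ∷ on′ (Allₚ.++⁺ (on-S on₁) (bl-on on))
      q : ∀ A B M → A ⊑ ⟦ a ∷ Rl ⟧ → B ⊑ ⟦ a ∷ Rl ⟧ → Big A → Big B → Meets A B → On ⟦ a ∷ Rl ⟧ M →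
          outer M₁ (A ∷ B ∷ M) + outer M₁ (A ∪ B ∷ A ∪ B ∷ M) ≡ outer M₁ (A ∷ A ∪ B ∷ M) + outer M₁ (B ∷ A ∪ B ∷ M)
      q A B M A⊑ B⊑ bA bB m on with bl-on ((A⊑ , bA) ∷ (B⊑ , bB) ∷ on)
      ... | (A⊑′ , bA′) ∷ (B⊑′ , bB′) ∷ _
        rewrite blowUp-∪ a S A B
              | front₂ (bl A) (bl B) M₁ (List.map bl M)
              | front₂ (bl A ∪ bl B) (bl A ∪ bl B) M₁ (List.map bl M)
              | front₂ (bl A) (bl A ∪ bl B) M₁ (List.map bl M)
              | front₂ (bl B) (bl A ∪ bl B) M₁ (List.map bl M)
        = quad (bl A) (bl B) _ (⊑-trans A⊑′ X′⊑X) (⊑-trans B⊑′ X′⊑X) bA′ bB′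
               (blowUp-meets a (nonempty-resp bS) m) (rest-on on)
      -- The edge from the collapsed point a to c blows up to S ∪ c, which is no edge. But `absorb`,
      -- read backwards, replaces S ∪ c by the edge from any s in S to c, and the linear relation
      -- for that edge applies.
      with-a : ∀ c M → c ∈ ⟦ Rl ⟧ → a ≢ c → On ⟦ a ∷ Rl ⟧ M → outer M₁ (⁅ a ⁆ ∪ ⁅ c ⁆ ∷ M) ≡ 0ℚ
      with-a c M c∈ a≢c on = begin
        F (st S ∷ M₁ ++ bl (⁅ a ⁆ ∪ ⁅ c ⁆) ∷ N₂)    ≡⟨ cong (λ V → F (st S ∷ M₁ ++ V ∷ N₂)) (blowUp-pair a (a≢c ∘ sym)) ⟩
        F (st S ∷ M₁ ++ S ∪ ⁅ c ⁆ ∷ N₂)             ≡⟨ cong (λ V → F (st S ∷ M₁ ++ V ∷ N₂)) eq ⟩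
        F (st S ∷ M₁ ++ S ∪ sc ∷ N₂)                ≡⟨ second (S ∪ sc) M₁ N₂ ⟩
        F (st S ∷ S ∪ sc ∷ M₁ ++ N₂)                ≡⟨ sym (absorb sc (M₁ ++ N₂) sc⊑ (pair-big s≢c) (s , s∈sc , s∈) (λ sc⊑S → c∉S (sc⊑S c c∈sc)) (Allₚ.++⁺ (on-S on₁) (bl-on on))) ⟩
        F (st S ∷ sc ∷ M₁ ++ N₂)                    ≡⟨ perm (swap (st S) sc ↭-refl) ⟩
        F (sc ∷ st S ∷ M₁ ++ N₂)                    ≡⟨ pair s c _ (X′⊑X s (S⊑ s s∈)) (X′⊑X c (R⊑X′ c∈)) s≢c (rest-on on) ⟩
        0ℚ                                         ∎
        where
        open ≡-Reasoning
        N₂ = List.map bl M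
        s = proj₁ bS
        s∈ = proj₁ (proj₂ (proj₂ bS))
        sc = ⁅ s ⁆ ∪ ⁅ c ⁆
        c∉S : c ∉ S
        c∉S c∈S = Sp.disj c (subst (c ∈_) (sym Sl≡S) c∈S) c∈
        s≢c : s ≢ c
        s≢c s≡c = c∉S (subst (_∈ S) s≡c s∈)
        s∈sc = ∪⁺ˡ ⁅ s ⁆ ⁅ c ⁆ s (x∈⁅x⁆ s)
        c∈sc = ∪⁺ʳ ⁅ s ⁆ ⁅ c ⁆ c (x∈⁅x⁆ c)
        sc⊑ : sc ⊑ X′
        sc⊑ = pair⊑ (S⊑ s s∈) (R⊑X′ c∈)
        eq : S ∪ ⁅ c ⁆ ≡ S ∪ sc
        eq = trans (cong (_∪ ⁅ c ⁆) (trans (sym (∪-absorb (⁅⁆⊑ s∈))) (∪-comm ⁅ s ⁆ S))) (∪-assoc S ⁅ s ⁆ ⁅ c ⁆)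
      a∉pair : ∀ {c d} → c ≢ a → d ≢ a → a ∉ ⁅ c ⁆ ∪ ⁅ d ⁆
      a∉pair {c} {d} c≢a d≢a a∈ = [ (λ z → c≢a (sym (x∈⁅y⁆⇒x≡y c z))) , (λ z → d≢a (sym (x∈⁅y⁆⇒x≡y d z))) ]′ (x∈p∪q⁻ ⁅ c ⁆ ⁅ d ⁆ a∈)
      pr : ∀ c d M → c ∈ ⟦ a ∷ Rl ⟧ → d ∈ ⟦ a ∷ Rl ⟧ → c ≢ d → On ⟦ a ∷ Rl ⟧ M → outer M₁ (⁅ c ⁆ ∪ ⁅ d ⁆ ∷ M) ≡ 0ℚ
      pr c d M c∈ d∈ c≢d on with ⟦∷⟧⁻ a Rl c∈ | ⟦∷⟧⁻ a Rl d∈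
      ... | inj₁ refl | inj₁ refl = ⊥-elim (c≢d refl)
      ... | inj₁ refl | inj₂ d∈R  = with-a d M d∈R c≢d on
      ... | inj₂ c∈R  | inj₁ refl = trans (cong (λ V → outer M₁ (V ∷ M)) (∪-comm ⁅ c ⁆ ⁅ a ⁆)) (with-a c M c∈R (c≢d ∘ sym) on)
      ... | inj₂ c∈R  | inj₂ d∈R =
        trans (cong (λ V → F (st S ∷ M₁ ++ V ∷ List.map bl M))
                    (blowUp-∉ a S (a∉pair (λ { refl → a∉X′ (R⊑X′ c∈R) }) (λ { refl → a∉X′ (R⊑X′ d∈R) }))))
          (trans (front _ M₁ (List.map bl M))
                 (pair c d _ (X′⊑X c (R⊑X′ c∈R)) (X′⊑X d (R⊑X′ d∈R)) c≢d (rest-on on)))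

    inner-valid : ∀ M₂ → On ⟦ a ∷ Rl ⟧ M₂ → ValidOn ⟦ Sl ⟧ (λ M₁ → outer M₁ M₂)
    inner-valid M₂ on₂ = record
      { perm = λ p → perm (prep (st S) (Permₚ.++⁺ʳ (List.map bl M₂) p))
      ; quad = λ A B M A⊑ B⊑ bA bB m on →
          subst₂ _≡_ (cong₂ _+_ (sym (front₂ A B [] _)) (sym (front₂ (A ∪ B) (A ∪ B) [] _)))
                     (cong₂ _+_ (sym (front₂ A (A ∪ B) [] _)) (sym (front₂ B (A ∪ B) [] _)))
            (quad A B _ (⊑-trans A⊑ Sl⊑X) (⊑-trans B⊑ Sl⊑X) bA bB m (rest-on on))
      ; pair = λ c d M c∈ d∈ c≢d on → trans (front _ [] _) (pair c d _ (Sl⊑X c c∈) (Sl⊑X d d∈) c≢d (rest-on on))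
      }
      where
      Sl⊑X = ⊑-trans Sp.S⊑ X′⊑X
      rest-on : ∀ {M} → On ⟦ Sl ⟧ M → On X (st S ∷ M ++ List.map bl M₂)
      rest-on on = stS-on ∷ on′ (Allₚ.++⁺ (on-S on) (bl-on on₂))

    -- Products of two spanning sets span the tensor product. For a basis word M₁ the form in M₂
    -- kills the basis of the quotient, since these are grafted basis words, so it is zero; hence
    -- for every M₂ the form in M₁ kills the basis of S.
    outer-zero : ∀ M₁ M₂ → On ⟦ Sl ⟧ M₁ → On ⟦ a ∷ Rl ⟧ M₂ → outer M₁ M₂ ≡ 0ℚ
    outer-zero M₁ M₂ on₁ on₂ =
      IH Sl (ℕₚ.≤-trans Sp.lenS len) (ℕₚ.≤-trans (s≤s z≤n) Sp.len2) Sp.uS (inner-valid M₂ on₂)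
        (λ {p₁} p₁∈ → IH (a ∷ Rl) (ℕₚ.≤-trans Sp.lenR len) (s≤s z≤n) Sp.uR
          (outer-valid (proj₁ p₁) (basis-on k Sl Sp.uS p₁∈))
          (λ {p₂} p₂∈ → subst (λ V → F (⁅ a ⁆ ∪ V ∷ proj₁ p₁ ++ List.map (blowUp a V) (proj₁ p₂)) ≡ 0ℚ) Sl≡S
            (kills (∈ₗ.∈-++⁺ˡ (∈ₗ.∈-concatMap⁺ (λ (S , R) → tensor (graft a S R) (basis k S) (basis k (a ∷ R)))
              (Any.map (λ { refl → ∈ₗ.∈-concatMap⁺ (λ p → List.map (graft a Sl Rl p) (basis k (a ∷ Rl)))
                 (Any.map (λ { refl → ∈ₗ.∈-map⁺ (graft a Sl Rl p₁) p₂∈ }) p₁∈) }) SR∈)))))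
          M₂ on₂)
        M₁ on₁

    -- Letters leave M one at a time. Those inside S go to M₁; the others go to M₂ as pull-backs
    -- from the quotient, after `absorb` if they cross S.
    distribute : ∀ M M₁ M₂ → On X′ M → On ⟦ Sl ⟧ M₁ → On ⟦ a ∷ Rl ⟧ M₂ → F (st S ∷ M ++ (M₁ ++ List.map bl M₂)) ≡ 0ℚ
    distribute [] M₁ M₂ _ on₁ on₂ = outer-zero M₁ M₂ on₁ on₂
    distribute (P ∷ M) M₁ M₂ ((P⊑ , bP) ∷ on) on₁ on₂ with P ⊑? S
    ... | yes P⊑S = trans (perm (prep (st S) (↭-sym (Permₚ.shift P M _))))
                      (distribute M (P ∷ M₁) M₂ on ((subst (P ⊑_) (sym Sl≡S) P⊑S , bP) ∷ on₁) on₂)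
    ... | no P⋢S = trans (step (meets? P S))
                     (trans (perm (prep (st S) (↭-trans (↭-sym (Permₚ.shift _ M _)) (Permₚ.++⁺ˡ M (↭-sym (Permₚ.shift _ M₁ _))))))
                       (distribute M M₁ (T ∷ M₂) on on₁ ((T⊑ , bT (meets? P S)) ∷ on₂)))
      where
      T = contract S a P
      rest = M ++ (M₁ ++ List.map bl M₂)
      a∉P : a ∉ P
      a∉P a∈ = a∉X′ (P⊑ a a∈)
      step : Dec (Meets P S) → F (st S ∷ P ∷ rest) ≡ F (st S ∷ bl T ∷ rest)
      step (yes m) = trans (absorb P rest P⊑ bP m P⋢S (Allₚ.++⁺ on (Allₚ.++⁺ (on-S on₁) (bl-on on₂))))
                           (cong (λ V → F (st S ∷ V ∷ rest)) (sym (blowUp-contract a a∉P (λ a∈S → a∉X′ (S⊑ a a∈S)) m)))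
      step (no ¬m) = cong (λ V → F (st S ∷ V ∷ rest)) (sym (trans (cong bl (contract-disjoint S a ¬m)) (blowUp-∉ a S a∉P)))
      T⊑ : T ⊑ ⟦ a ∷ Rl ⟧
      T⊑ x x∈ with ∈-contract⁻ S a P x∈
      ... | inj₂ (refl , _) = ⟦∷⟧-here a Rl
      ... | inj₁ (x∈P , x∉S) = ⟦∷⟧-there a Rl x (∈-⟦⟧⁺ Rl (∈ₗ.∈-filter⁺ (¬? ∘ (_∈? S)) (∈-⟦⟧⁻ (b ∷ xs) (P⊑ x x∈P)) x∉S))
      bT : Dec (Meets P S) → Big T
      bT (no ¬m) = subst Big (sym (contract-disjoint S a ¬m)) bP
      bT (yes m) with ¬⊑⇒∃ P⋢S
      ... | (y , y∈P , y∉S) = a , y , ∈-contract⁺ S a P (inj₂ (refl , m)) , ∈-contract⁺ S a P (inj₁ (y∈P , y∉S)) , λ { refl → a∉P y∈P }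

    claim : ∀ M → On X′ M → F (st S ∷ M) ≡ 0ℚ
    claim M on = trans (cong (λ N → F (st S ∷ N)) (sym (Listₚ.++-identityʳ M))) (distribute M [] [] on [] [])

  -- The downward induction on S. The number m bounds n - |S|, the room left above S; for m = 0 no
  -- larger set exists.
  one-a : ∀ m S → n ≤ m ℕ.+ ∣ S ∣ → S ⊑ X′ → Big S → ∀ M → On X′ M → F (st S ∷ M) ≡ 0ℚ
  one-a m S n≤ S⊑ bS = Claim.claim S S⊑ bS λ U U⊑ S⊑U U⋢S →
    let S<U = p⊂q⇒∣p∣<∣q∣ ((λ {x} → S⊑U x) , (let (y , y∈ , y∉) = ¬⊑⇒∃ U⋢S in y , y∈ , y∉))
    in descend m n≤ U U⊑ S<U (Big-mono S⊑U bS)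
    where
    descend : ∀ m → n ≤ m ℕ.+ ∣ S ∣ → ∀ U → U ⊑ X′ → ∣ S ∣ < ∣ U ∣ → Big U → ∀ M → On X′ M → F (st U ∷ M) ≡ 0ℚ
    descend zero n≤S U _ S<U _ = ⊥-elim (ℕₚ.<-irrefl refl (ℕₚ.<-≤-trans S<U (ℕₚ.≤-trans (∣p∣≤n U) n≤S)))
    descend (suc m) n≤ U U⊑ S<U bU = one-a m U (ℕₚ.≤-trans n≤ (subst (_≤ m ℕ.+ ∣ U ∣) (ℕₚ.+-suc m ∣ S ∣) (ℕₚ.+-monoʳ-≤ m S<U))) U⊑ bU

  st-small : ∀ S M → S ⊑ X′ → Meets S S → ¬ Big S → On X M → F (st S ∷ M) ≡ 0ℚ
  st-small S M S⊑ (c , c∈ , _) ¬b on =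
    trans (cong (λ V → F (⁅ a ⁆ ∪ V ∷ M)) (small-nonempty c∈ ¬b))
      (pair a c M a∈X (X′⊑X c (S⊑ c c∈)) (λ { refl → a∉X′ (S⊑ c c∈) }) on)

  Part : Subset n → Set
  Part S = S ⊑ X′ × Meets S S

  st-on : ∀ {S} → Part S → st S ⊑ X × Big (st S)
  st-on {S} (S⊑ , c , c∈ , _) = st⊑ S⊑ , a , c , a∈st S , ∪⁺ʳ ⁅ a ⁆ S c c∈ , λ { refl → a∉X′ (S⊑ c c∈) }

  -- Induction on the number of letters through a. With U = S ∪ T the quadratic relation expresses
  -- h_{S ∪ a} h_{T ∪ a} by products containing h_{U ∪ a}, and for V inside U one has h_{V ∪ a} h_{U
  -- ∪ a} = h_{V ∪ a} h_U, by `square` and the relation for U and V ∪ a. So one letter through a is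
  -- always exchanged for a letter on X′.
  many-a : ∀ S Ss M → Part S → All Part Ss → On X′ M → F (st S ∷ List.map st Ss ++ M) ≡ 0ℚ
  many-a S Ss M pS pSs on with big? S
  ... | no ¬b = st-small S _ (proj₁ pS) (proj₂ pS) ¬b (Allₚ.++⁺ (Allₚ.map⁺ (All.map st-on pSs)) (on′ on))
  many-a S [] M pS _ on | yes bS = one-a n S (ℕₚ.m≤m+n n _) (proj₁ pS) bS M on
  many-a S (T ∷ Ts) M pS (pT ∷ pTs) on | yes bS with big? T
  ... | no ¬b = trans (perm (swap (st S) (st T) ↭-refl))
                  (st-small T _ (proj₁ pT) (proj₂ pT) ¬b (st-on pS ∷ Allₚ.++⁺ (Allₚ.map⁺ (All.map st-on pTs)) (on′ on)))
  ... | yes bT = zero-sum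
        (subst (λ V → F (st S ∷ st T ∷ N₂) + F (V ∷ V ∷ N₂) ≡ F (st S ∷ V ∷ N₂) + F (st T ∷ V ∷ N₂)) (star-∪ ⁅ a ⁆ S T)
          (quad (st S) (st T) N₂ (proj₁ (st-on pS)) (proj₁ (st-on pT)) (st-big bS) (st-big bT) (a , a∈st S , a∈st T) N₂-on))
        squareU
        (with-U S (proj₁ pS) bS pS (∪⁺ˡ S T))
        (with-U T (proj₁ pT) bT pT (∪⁺ʳ S T))
    where
    U = S ∪ T
    N₂ = List.map st Ts ++ M
    N₂-on : On X N₂
    N₂-on = Allₚ.++⁺ (Allₚ.map⁺ (All.map st-on pTs)) (on′ on)
    U⊑ = ∪-lub (proj₁ pS) (proj₁ pT)
    bU = Big-mono (∪⁺ˡ S T) bS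
    reduce : ∀ V → Part V → F (U ∷ st V ∷ N₂) ≡ 0ℚ
    reduce V pV = trans (perm (↭-trans (swap U (st V) ↭-refl) (prep (st V) (↭-sym (Permₚ.shift U (List.map st Ts) M)))))
                    (many-a V Ts (U ∷ M) pV pTs ((U⊑ , bU) ∷ on))
    squareU : F (st U ∷ st U ∷ N₂) ≡ 0ℚ
    squareU = trans (square U N₂ U⊑ bU N₂-on) (reduce U (U⊑ , nonempty-resp bU))
    with-U : ∀ V → V ⊑ X′ → Big V → Part V → V ⊑ U → F (st V ∷ st U ∷ N₂) ≡ 0ℚ
    with-U V V⊑ bV@(c , _ , c∈ , _) pV V⊑U = trans (sym (cancel-mid-sq e)) (reduce V pV)
      where
      e : F (U ∷ st V ∷ N₂) + F (st U ∷ st U ∷ N₂) ≡ F (U ∷ st U ∷ N₂) + F (st V ∷ st U ∷ N₂)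
      e = subst (λ W → F (U ∷ st V ∷ N₂) + F (W ∷ W ∷ N₂) ≡ F (U ∷ W ∷ N₂) + F (st V ∷ W ∷ N₂))
            (trans (∪-comm U (st V)) (trans (∪-assoc ⁅ a ⁆ V U) (cong (⁅ a ⁆ ∪_) (∪-absorb V⊑U))))
            (quad U (st V) N₂ (⊑-trans U⊑ X′⊑X) (st⊑ V⊑) bU (st-big bV) (c , V⊑U c c∈ , ∪⁺ʳ ⁅ a ⁆ V c c∈) N₂-on)
      cancel-mid-sq : ∀ {p r} → p + F (st U ∷ st U ∷ N₂) ≡ F (U ∷ st U ∷ N₂) + r → p ≡ r
      cancel-mid-sq e′ = cancel-mid (trans e′ (cong (_+ _) (sym (square U N₂ U⊑ bU N₂-on))))

  part-a : ∀ M Ss N → On X M → All Part Ss → On X′ N → F (M ++ (List.map st Ss ++ N)) ≡ 0ℚ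
  part-a [] [] N _ _ on = no-a N on
  part-a [] (S ∷ Ss) N _ (pS ∷ pSs) on = many-a S Ss N pS pSs on
  part-a (P ∷ M) Ss N ((P⊑ , bP) ∷ onM) pSs on with a ∈? P
  ... | no a∉P = trans (perm (↭-trans (↭-sym (Permₚ.shift P M _)) (Permₚ.++⁺ˡ M (↭-sym (Permₚ.shift P (List.map st Ss) N)))))
                   (part-a M Ss (P ∷ N) onM pSs ((P⊑′ , bP) ∷ on))
    where
    P⊑′ : P ⊑ X′
    P⊑′ x x∈ with ⟦∷⟧⁻ a (b ∷ xs) (P⊑ x x∈)
    ... | inj₁ refl = ⊥-elim (a∉P x∈)
    ... | inj₂ x∈X′ = x∈X′
  ... | yes a∈P = trans (perm (↭-sym (Permₚ.shift P M _)))
                    (trans (cong (λ V → F (M ++ V ∷ List.map st Ss ++ N)) P≡) (part-a M (P ∩ X′ ∷ Ss) N onM (part ∷ pSs) on))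
    where
    P≡ : P ≡ st (P ∩ X′)
    P≡ = ⊑-antisym to (∪-lub (⁅⁆⊑ a∈P) (λ x x∈ → proj₁ (x∈p∩q⁻ P X′ x∈)))
      where
      to : P ⊑ st (P ∩ X′)
      to x x∈ with ⟦∷⟧⁻ a (b ∷ xs) (P⊑ x x∈)
      ... | inj₁ refl = a∈st (P ∩ X′)
      ... | inj₂ x∈X′ = ∪⁺ʳ ⁅ a ⁆ (P ∩ X′) x (x∈p∩q⁺ (x∈ , x∈X′))
    other : ∀ {c} → c ∈ P → a ≢ c → Meets (P ∩ X′) (P ∩ X′)
    other {c} c∈ a≢c with ⟦∷⟧⁻ a (b ∷ xs) (P⊑ c c∈)
    ... | inj₁ refl = ⊥-elim (a≢c refl)
    ... | inj₂ c∈X′ = c , x∈p∩q⁺ (c∈ , c∈X′) , x∈p∩q⁺ (c∈ , c∈X′)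
    part : Part (P ∩ X′)
    part = (λ x x∈ → proj₂ (x∈p∩q⁻ P X′ x∈)) , m bP
      where
      m : Big P → Meets (P ∩ X′) (P ∩ X′)
      m (c , d , c∈ , d∈ , c≢d) with a Fin.≟ c
      ... | no a≢c = other c∈ a≢c
      ... | yes refl = other d∈ c≢d

  all-zero : ∀ M → On X M → F M ≡ 0ℚ
  all-zero M on = trans (cong F (sym (Listₚ.++-identityʳ M))) (part-a M [] [] on [] [])

basis-spans : ∀ {n} k (xs : List (Fin n)) {F : Functional} → length xs ≤ k → 1 ≤ length xs → Unique xs → ValidOn ⟦ xs ⟧ F →
              (∀ {p} → p ∈ₗ basis k xs → F (proj₁ p) ≡ 0ℚ) → ∀ M → On ⟦ xs ⟧ M → F M ≡ 0ℚ
basis-spans zero (_ ∷ _) () _ _ _ _ _ _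
basis-spans (suc k) (a ∷ []) _ _ u valid kills [] _ = kills (here refl)
basis-spans (suc k) (a ∷ []) _ _ u valid kills (T ∷ _) ((T⊑ , bT) ∷ _) =
  ⊥-elim (ℕₚ.<-irrefl refl (big-length [ a ] (Big-mono T⊑ bT)))
basis-spans (suc k) (a ∷ b ∷ xs) (s≤s len) _ u valid kills M on =
  Spanning.all-zero {k = k} u valid kills len (basis-spans k) M on

-- The degree map and products along divisors

module _ {n : ℕ} where

  record Valid (F : Functional {n}) : Set where
    field
      perm : ∀ {M N} → M ↭ N → F M ≡ F N
      quad : ∀ S T M → Meets S T →
             F (S ∷ T ∷ M) + F (S ∪ T ∷ S ∪ T ∷ M) ≡ F (S ∷ S ∪ T ∷ M) + F (T ∷ S ∪ T ∷ M)
      pair : ∀ a b M → a ≢ b → F (⁅ a ⁆ ∪ ⁅ b ⁆ ∷ M) ≡ 0ℚ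

  count-≤-∷ : ∀ V T M → count⊑ {n} V M ≤ count⊑ V (T ∷ M)
  count-≤-∷ V T M with T ⊑? V
  ... | yes T⊑ = subst (count⊑ V M ≤_) (sym (count-yes V M T⊑)) (ℕₚ.n≤1+n _)
  ... | no T⋢ = ℕₚ.≤-reflexive (sym (count-no V M T⋢))

  count-mono : ∀ V {S T} M N → S ⊑ T → count⊑ {n} V M ≤ count⊑ V N → count⊑ V (T ∷ M) ≤ count⊑ V (S ∷ N)
  count-mono V {S} {T} M N S⊑T M≤N with T ⊑? V
  ... | yes T⊑ = subst₂ _≤_ (sym (count-yes V M T⊑)) (sym (count-yes V N (⊑-trans S⊑T T⊑))) (s≤s M≤N)
  ... | no T⋢ = subst (_≤ count⊑ V (S ∷ N)) (sym (count-no V M T⋢)) (ℕₚ.≤-trans M≤N (count-≤-∷ V S N))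

  sparse-mono : ∀ {M N} → (∀ V → count⊑ {n} V N ≤ count⊑ V M) → Sparse M → Sparse N
  sparse-mono le sp V = ℕₚ.≤-trans (le V) (sp V)

  -- Letter by letter: a set inside both V and W is inside V ∩ W, and a set inside either is inside
  -- V ∪ W.
  supermodular : ∀ V W M → count⊑ {n} V M ℕ.+ count⊑ W M ≤ count⊑ (V ∪ W) M ℕ.+ count⊑ (V ∩ W) M
  supermodular V W [] = subst (_≤ count⊑ (V ∪ W) [] ℕ.+ count⊑ (V ∩ W) []) (sym (cong₂ ℕ._+_ (count-[] V) (count-[] W))) z≤n
  supermodular V W (T ∷ M) = go (T ⊑? V) (T ⊑? W)
    where
    ih = supermodular V W M
    ∩ˡ : V ∩ W ⊑ V
    ∩ˡ x x∈ = proj₁ (x∈p∩q⁻ V W x∈)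
    ∩ʳ : V ∩ W ⊑ W
    ∩ʳ x x∈ = proj₂ (x∈p∩q⁻ V W x∈)
    go : Dec (T ⊑ V) → Dec (T ⊑ W) → count⊑ V (T ∷ M) ℕ.+ count⊑ W (T ∷ M) ≤ count⊑ (V ∪ W) (T ∷ M) ℕ.+ count⊑ (V ∩ W) (T ∷ M)
    go (yes p) (yes q)
      rewrite count-yes V M p | count-yes W M q
            | count-yes (V ∪ W) M (⊑-trans p (∪⁺ˡ V W))
            | count-yes (V ∩ W) M (λ x x∈ → x∈p∩q⁺ (p x x∈ , q x x∈))
            | ℕₚ.+-suc (count⊑ V M) (count⊑ W M) | ℕₚ.+-suc (count⊑ (V ∪ W) M) (count⊑ (V ∩ W) M) = s≤s (s≤s ih)
    go (yes p) (no ¬q)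
      rewrite count-yes V M p | count-no W M ¬q
            | count-yes (V ∪ W) M (⊑-trans p (∪⁺ˡ V W))
            | count-no (V ∩ W) M (λ r → ¬q (⊑-trans r ∩ʳ)) = s≤s ih
    go (no ¬p) (yes q)
      rewrite count-no V M ¬p | count-yes W M q
            | count-yes (V ∪ W) M (⊑-trans q (∪⁺ʳ V W))
            | count-no (V ∩ W) M (λ r → ¬p (⊑-trans r ∩ˡ))
            | ℕₚ.+-suc (count⊑ V M) (count⊑ W M) = s≤s ih
    go (no ¬p) (no ¬q)
      rewrite count-no V M ¬p | count-no W M ¬q
            | count-no (V ∩ W) M (λ r → ¬p (⊑-trans r ∩ˡ)) =
        ℕₚ.≤-trans ih (ℕₚ.+-monoˡ-≤ _ (count-≤-∷ (V ∪ W) T M))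

∣∪∣+∣∩∣ : ∀ {n} (V W : Subset n) → ∣ V ∪ W ∣ ℕ.+ ∣ V ∩ W ∣ ≡ ∣ V ∣ ℕ.+ ∣ W ∣
∣∪∣+∣∩∣ Vec.[] Vec.[] = refl
∣∪∣+∣∩∣ (outside Vec.∷ V) (outside Vec.∷ W) = ∣∪∣+∣∩∣ V W
∣∪∣+∣∩∣ (outside Vec.∷ V) (inside Vec.∷ W)  = trans (cong suc (∣∪∣+∣∩∣ V W)) (sym (ℕₚ.+-suc ∣ V ∣ ∣ W ∣))
∣∪∣+∣∩∣ (inside Vec.∷ V)  (outside Vec.∷ W) = cong suc (∣∪∣+∣∩∣ V W)
∣∪∣+∣∩∣ (inside Vec.∷ V)  (inside Vec.∷ W)  =
  cong suc (trans (ℕₚ.+-suc _ _) (trans (cong suc (∣∪∣+∣∩∣ V W)) (sym (ℕₚ.+-suc ∣ V ∣ ∣ W ∣))))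

∣∪∣≤ : ∀ {n} (V W : Subset n) → ∣ V ∪ W ∣ ≤ ∣ V ∣ ℕ.+ ∣ W ∣
∣∪∣≤ V W = subst (∣ V ∪ W ∣ ≤_) (∣∪∣+∣∩∣ V W) (ℕₚ.m≤m+n _ _)

∣⁅⁆∣≡1 : ∀ {n} (a : Fin n) → ∣ ⁅ a ⁆ ∣ ≡ 1
∣⁅⁆∣≡1 = Subsetₚ.∣⁅x⁆∣≡1

⊑⇒∣∣≤ : ∀ {n} {V W : Subset n} → V ⊑ W → ∣ V ∣ ≤ ∣ W ∣
⊑⇒∣∣≤ V⊑W = p⊆q⇒∣p∣≤∣q∣ (λ {x} → V⊑W x)

1≤∣∣ : ∀ {n} {V : Subset n} {x} → x ∈ V → 1 ≤ ∣ V ∣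
1≤∣∣ {V = V} {x} x∈ = subst (_≤ ∣ V ∣) (∣⁅⁆∣≡1 x) (⊑⇒∣∣≤ (⁅⁆⊑ x∈))

∸2-< : ∀ {m v} → ¬ m ≤ v ∸ 2 → v ≤ suc m
∸2-< {m} {v} ¬le = ℕₚ.≤-trans (ℕₚ.m≤n+m∸n v 2) (s≤s (ℕₚ.≰⇒> ¬le))

2+≤∸2 : ∀ {g w} → suc (suc g) ≤ w ∸ 2 → 4 ℕ.+ g ≤ w
2+≤∸2 {g} {suc (suc w)} le = s≤s (s≤s le)

≤∸2⇒< : ∀ {h c} → h ≤ c ∸ 2 → 1 ≤ c → suc h ≤ c
≤∸2⇒< {c = suc zero} z≤n _ = s≤s z≤n
≤∸2⇒< {c = suc (suc c)} le _ = s≤s (ℕₚ.m≤n⇒m≤1+n le)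

-- v, v′, w, c are the sizes of two tight sets, their union and their intersection, and f, f′, g, h
-- the letters of M in them. The 4 is 2 from sparsity and 2 from the letters U U, which the union
-- contains. For the intersection only h < c is assumed, since it may be a single point; this strict
-- inequality gives the contradiction.
tight-absurd : ∀ {f f′ g h v v′ w c} → w ℕ.+ c ≡ v ℕ.+ v′ → f ℕ.+ f′ ≤ g ℕ.+ h →
               v ≤ suc (suc f) → v′ ≤ suc (suc f′) → 4 ℕ.+ g ≤ w → suc h ≤ c → ⊥
tight-absurd {f} {f′} {g} {h} {v} {v′} {w} {c} e le v≤ v′≤ g≤ h<c = ℕₚ.<-irrefl refl (begin-strict
  v ℕ.+ v′                        ≤⟨ ℕₚ.+-mono-≤ v≤ v′≤ ⟩
  suc (suc f) ℕ.+ suc (suc f′)    ≡⟨ cong (suc ∘ suc) (trans (ℕₚ.+-suc f (suc f′)) (cong suc (ℕₚ.+-suc f f′))) ⟩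
  4 ℕ.+ (f ℕ.+ f′)                ≤⟨ ℕₚ.+-monoʳ-≤ 4 le ⟩
  (4 ℕ.+ g) ℕ.+ h                 <⟨ ℕₚ.+-mono-≤-< g≤ h<c ⟩
  w ℕ.+ c                         ≡⟨ e ⟩
  v ℕ.+ v′                        ∎)
  where open ℕₚ.≤-Reasoning

module _ {n : ℕ} where

  -- The four products differ only in which of S, T, U each set V sees.  If S U and T U both fail, two tight
  -- sets V ⊇ S and W ⊇ T meet, and supermodularity of V ↦ count⊑ V M makes V ∪ W violate sparsity of U U.
  module SparseExchange (S T : Subset n) (M : Word {n}) (S∩T : Meets S T) where

    U = S ∪ T

    S⊑U = ∪⁺ˡ S T
    T⊑U = ∪⁺ʳ S T

    ST⇒SU : Sparse (S ∷ T ∷ M) → Sparse (S ∷ U ∷ M)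
    ST⇒SU = sparse-mono {M = S ∷ T ∷ M} λ V → count-mono V (U ∷ M) (T ∷ M) (λ _ → id) (count-mono V M M T⊑U ℕₚ.≤-refl)

    ST⇒TU : Sparse (S ∷ T ∷ M) → Sparse (T ∷ U ∷ M)
    ST⇒TU = sparse-mono {M = S ∷ T ∷ M} λ V → subst (_≤ count⊑ V (S ∷ T ∷ M)) (count-↭ V (swap U T ↭-refl))
                (count-mono V (T ∷ M) (T ∷ M) S⊑U ℕₚ.≤-refl)

    SU⇒UU : Sparse (S ∷ U ∷ M) → Sparse (U ∷ U ∷ M)
    SU⇒UU = sparse-mono {M = S ∷ U ∷ M} λ V → count-mono V (U ∷ M) (U ∷ M) S⊑U ℕₚ.≤-refl

    TU⇒UU : Sparse (T ∷ U ∷ M) → Sparse (U ∷ U ∷ M)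
    TU⇒UU = sparse-mono {M = T ∷ U ∷ M} λ V → count-mono V (U ∷ M) (U ∷ M) T⊑U ℕₚ.≤-refl

    -- Each V sees in S T as many letters as in one of the other products: U U if it contains both
    -- or neither of S and T, otherwise S U or T U.
    all⇒ST : Sparse (U ∷ U ∷ M) → Sparse (S ∷ U ∷ M) → Sparse (T ∷ U ∷ M) → Sparse (S ∷ T ∷ M)
    all⇒ST uu su tu V with S ⊑? V | T ⊑? V
    ... | yes s | yes t = subst (_≤ ∣ V ∣ ∸ 2) (trans (count-yes V (U ∷ M) (∪-lub s t)) (trans (cong suc (trans (count-yes V M (∪-lub s t)) (sym (count-yes V M t)))) (sym (count-yes V (T ∷ M) s)))) (uu V)
    ... | yes s | no ¬t = subst (_≤ ∣ V ∣ ∸ 2) (trans (count-yes V (U ∷ M) s) (trans (cong suc (trans (count-no V M (λ r → ¬t (⊑-trans T⊑U r))) (sym (count-no V M ¬t)))) (sym (count-yes V (T ∷ M) s)))) (su V)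
    ... | no ¬s | yes t = subst (_≤ ∣ V ∣ ∸ 2) (trans (count-yes V (U ∷ M) t) (trans (cong suc (count-no V M (λ r → ¬s (⊑-trans S⊑U r)))) (trans (sym (count-yes V M t)) (sym (count-no V (T ∷ M) ¬s))))) (tu V)
    ... | no ¬s | no ¬t = subst (_≤ ∣ V ∣ ∸ 2) (trans (count-no V (U ∷ M) ¬u) (trans (count-no V M ¬u) (trans (sym (count-no V M ¬t)) (sym (count-no V (T ∷ M) ¬s))))) (uu V)
      where ¬u = λ r → ¬s (⊑-trans S⊑U r)

    -- A violating V must contain A and not U, since otherwise it sees the same number of letters in
    -- U U, which is sparse. It then sees exactly one letter besides those of M, which bounds its
    -- size.
    witness : ∀ {A} → A ⊑ U → Sparse (U ∷ U ∷ M) → ¬ Sparse (A ∷ U ∷ M) → ∃ λ V → A ⊑ V × ∣ V ∣ ≤ suc (suc (count⊑ V M))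
    witness {A} A⊑U uu ¬au with anySubset? (λ V → ¬? (count⊑ V (A ∷ U ∷ M) ℕ.≤? ∣ V ∣ ∸ 2))
    ... | no ¬∃ = ⊥-elim (¬au λ V → decidable-stable (_ ℕ.≤? _) λ ¬p → ¬∃ (V , ¬p))
    ... | yes (V , ¬p) with A ⊑? V | U ⊑? V
    ...   | yes A⊑ | no U⋢ = V , A⊑ , subst (λ m → ∣ V ∣ ≤ suc m) (trans (count-yes V (U ∷ M) A⊑) (cong suc (count-no V M U⋢))) (∸2-< ¬p)
    ...   | yes A⊑ | yes U⊑ = ⊥-elim (¬p (subst (_≤ ∣ V ∣ ∸ 2) (trans (count-yes V (U ∷ M) U⊑) (sym (count-yes V (U ∷ M) A⊑))) (uu V)))
    ...   | no A⋢ | yes U⊑ = ⊥-elim (A⋢ (⊑-trans A⊑U U⊑))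
    ...   | no A⋢ | no U⋢ = ⊥-elim (¬p (subst (_≤ ∣ V ∣ ∸ 2) (trans (count-no V (U ∷ M) U⋢) (sym (count-no V (U ∷ M) A⋢))) (uu V)))

    UU⇒SU⊎TU : Sparse (U ∷ U ∷ M) → ¬ Sparse (S ∷ U ∷ M) → ¬ Sparse (T ∷ U ∷ M) → ⊥
    UU⇒SU⊎TU uu ¬su ¬tu with witness S⊑U uu ¬su | witness T⊑U uu ¬tu
    ... | (V , S⊑V , v≤) | (W , T⊑W , w≤) =
      tight-absurd (∣∪∣+∣∩∣ V W) (supermodular V W M) v≤ w≤
        (2+≤∸2 (subst (_≤ ∣ V ∪ W ∣ ∸ 2) (trans (count-yes (V ∪ W) (U ∷ M) U⊑) (cong suc (count-yes (V ∪ W) M U⊑))) (uu (V ∪ W))))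
        (≤∸2⇒< (ℕₚ.≤-trans (ℕₚ.≤-trans (count-≤-∷ (V ∩ W) U M) (count-≤-∷ (V ∩ W) U (U ∷ M))) (uu (V ∩ W)))
               (1≤∣∣ (x∈p∩q⁺ (S⊑V _ (proj₁ (proj₂ S∩T)) , T⊑W _ (proj₂ (proj₂ S∩T))))))
      where
      U⊑ : U ⊑ V ∪ W
      U⊑ = ∪-lub (⊑-trans S⊑V (∪⁺ˡ V W)) (⊑-trans T⊑W (∪⁺ʳ V W))

    -- By the implications above, the four products are all sparse, or none is, or exactly U U and
    -- one of S U, T U are; both sums agree in each case. P is the condition on the length, common
    -- to the four.
    exchange : ∀ {P : Set} (st : Dec (Sparse (S ∷ T ∷ M))) (uu : Dec (Sparse (U ∷ U ∷ M)))
               (su : Dec (Sparse (S ∷ U ∷ M))) (tu : Dec (Sparse (T ∷ U ∷ M))) (p : Dec P) →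
               indicator (st ×-dec p) + indicator (uu ×-dec p) ≡ indicator (su ×-dec p) + indicator (tu ×-dec p)
    exchange (yes _)  (yes _)  (yes _)  (yes _)  (yes _) = refl
    exchange (no _)   (no _)   (no _)   (no _)   (yes _) = refl
    exchange (no _)   (yes _)  (yes _)  (no _)   (yes _) = refl
    exchange (no _)   (yes _)  (no _)   (yes _)  (yes _) = refl
    exchange (yes st) (no ¬uu) _        _        (yes _) = ⊥-elim (¬uu (SU⇒UU (ST⇒SU st)))
    exchange (yes st) (yes _)  (no ¬su) _        (yes _) = ⊥-elim (¬su (ST⇒SU st))
    exchange (yes st) (yes _)  (yes _)  (no ¬tu) (yes _) = ⊥-elim (¬tu (ST⇒TU st))
    exchange (no _)   (no ¬uu) (yes su) _        (yes _) = ⊥-elim (¬uu (SU⇒UU su))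
    exchange (no _)   (no ¬uu) (no _)   (yes tu) (yes _) = ⊥-elim (¬uu (TU⇒UU tu))
    exchange (no ¬st) (yes uu) (yes su) (yes tu) (yes _) = ⊥-elim (¬st (all⇒ST uu su tu))
    exchange (no _)   (yes uu) (no ¬su) (no ¬tu) (yes _) = ⊥-elim (UU⇒SU⊎TU uu ¬su ¬tu)
    exchange st uu su tu (no ¬p)
      rewrite indicator-no (¬p ∘ proj₂) (st ×-dec no ¬p) | indicator-no (¬p ∘ proj₂) (uu ×-dec no ¬p)
            | indicator-no (¬p ∘ proj₂) (su ×-dec no ¬p) | indicator-no (¬p ∘ proj₂) (tu ×-dec no ¬p) = refl

  top-valid : ∀ j → Valid (top {n} j)
  top-valid j = record
    { perm = λ {M} {N} p → indicator-cong
        (λ (sp , l) → sparse-mono {M = M} (λ V → ℕₚ.≤-reflexive (sym (count-↭ V p))) sp , trans (sym (Permₚ.↭-length p)) l)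
        (λ (sp , l) → sparse-mono {M = N} (λ V → ℕₚ.≤-reflexive (count-↭ V p)) sp , trans (Permₚ.↭-length p) l)
        (sparse? M ×-dec (length M ℕ.≟ j)) (sparse? N ×-dec (length N ℕ.≟ j))
    ; quad = λ S T M m → SparseExchange.exchange S T M m (sparse? _) (sparse? _) (sparse? _) (sparse? _) (suc (suc (length M)) ℕ.≟ j)
    ; pair = λ a b M _ → indicator-no (λ (sp , _) → absurd a b M sp) (sparse? (⁅ a ⁆ ∪ ⁅ b ⁆ ∷ M) ×-dec (suc (length M) ℕ.≟ j))
    }
    where
    absurd : ∀ a b M → Sparse (⁅ a ⁆ ∪ ⁅ b ⁆ ∷ M) → ⊥
    absurd a b M sp with subst (_≤ ∣ ⁅ a ⁆ ∪ ⁅ b ⁆ ∣ ∸ 2) (count-yes (⁅ a ⁆ ∪ ⁅ b ⁆) M (λ _ → id)) (sp (⁅ a ⁆ ∪ ⁅ b ⁆))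
    ... | le = ℕₚ.1+n≰n (ℕₚ.≤-trans (s≤s (z≤n {count⊑ (⁅ a ⁆ ∪ ⁅ b ⁆) M})) (ℕₚ.≤-trans le
                 (ℕₚ.m≤n+o⇒m∸n≤o _ 2 (subst (∣ ⁅ a ⁆ ∪ ⁅ b ⁆ ∣ ≤_) (trans (cong₂ ℕ._+_ (∣⁅⁆∣≡1 a) (∣⁅⁆∣≡1 b)) refl) (∣∪∣≤ ⁅ a ⁆ ⁅ b ⁆)))))

  module _ (F G : Functional {n}) (Q : Subset n) (q : Fin n) where

    ins : Word → Word
    ins = filter (_⊑? Q)

    outs : Word → Word
    outs M = List.map (contract Q q) (filter (λ T → ¬? (T ⊑? Q)) M)

    ⊗-in : ∀ {T} M → T ⊑ Q → (ins (T ∷ M) ≡ T ∷ ins M) × (outs (T ∷ M) ≡ outs M)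
    ⊗-in M T⊑ = Listₚ.filter-accept (_⊑? Q) {xs = M} T⊑ , cong (List.map (contract Q q)) (Listₚ.filter-reject (λ T → ¬? (T ⊑? Q)) {xs = M} (λ T⋢ → T⋢ T⊑))

    ⊗-out : ∀ {T} M → ¬ T ⊑ Q → (ins (T ∷ M) ≡ ins M) × (outs (T ∷ M) ≡ contract Q q T ∷ outs M)
    ⊗-out M T⋢ = Listₚ.filter-reject (_⊑? Q) {xs = M} T⋢ , cong (List.map (contract Q q)) (Listₚ.filter-accept (λ T → ¬? (T ⊑? Q)) {xs = M} T⋢)

    ⊗-perm : (∀ {M N} → M ↭ N → F M ≡ F N) → (∀ {M N} → M ↭ N → G M ≡ G N) →
             ∀ {M N} → M ↭ N → (F ⊗[ Q , q ] G) M ≡ (F ⊗[ Q , q ] G) N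
    ⊗-perm pF pG p = cong₂ _*_ (pF (Permₚ.filter-↭ (_⊑? Q) p)) (pG (Permₚ.map⁺ (contract Q q) (Permₚ.filter-↭ (λ T → ¬? (T ⊑? Q)) p)))

  -- For S inside Q and T not, T and S ∪ T therefore become the same letter on the quotient, and the
  -- quadratic relation holds because its terms are equal in pairs.
  contract-inside : ∀ {Q S T : Subset n} q → S ⊑ Q → Meets S T → contract Q q (S ∪ T) ≡ contract Q q T
  contract-inside {Q} {S} {T} q S⊑ (x , x∈S , x∈T) =
    trans (contract-∪ Q q S T) (∪-absorb λ y y∈ → [ (λ (y∈S , y∉Q) → ⊥-elim (y∉Q (S⊑ y y∈S)))
                                                  , (λ (y≡q , _) → ∈-contract⁺ Q q T (inj₂ (y≡q , x , x∈T , S⊑ x x∈S))) ]′ (∈-contract⁻ Q q S y∈))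

  contract-meets : ∀ {Q S T : Subset n} q → Meets S T → Meets (contract Q q S) (contract Q q T)
  contract-meets {Q} {S} {T} q (x , x∈S , x∈T) with x ∈? Q
  ... | yes x∈Q = q , ∈-contract⁺ Q q S (inj₂ (refl , x , x∈S , x∈Q)) , ∈-contract⁺ Q q T (inj₂ (refl , x , x∈T , x∈Q))
  ... | no x∉Q = x , ∈-contract⁺ Q q S (inj₁ (x∈S , x∉Q)) , ∈-contract⁺ Q q T (inj₁ (x∈T , x∉Q))

  contract-pair : ∀ {Q : Subset n} {a b} q → a ∈ Q → b ∉ Q → contract Q q (⁅ a ⁆ ∪ ⁅ b ⁆) ≡ ⁅ q ⁆ ∪ ⁅ b ⁆
  contract-pair {Q} {a} {b} q a∈Q b∉Q = ⊑-antisym to (pair⊑ q∈ b∈)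
    where
    q∈ = ∈-contract⁺ Q q (⁅ a ⁆ ∪ ⁅ b ⁆) (inj₂ (refl , a , ∪⁺ˡ ⁅ a ⁆ ⁅ b ⁆ a (x∈⁅x⁆ a) , a∈Q))
    b∈ = ∈-contract⁺ Q q (⁅ a ⁆ ∪ ⁅ b ⁆) (inj₁ (∪⁺ʳ ⁅ a ⁆ ⁅ b ⁆ b (x∈⁅x⁆ b) , b∉Q))
    to : contract Q q (⁅ a ⁆ ∪ ⁅ b ⁆) ⊑ ⁅ q ⁆ ∪ ⁅ b ⁆
    to x x∈ with ∈-contract⁻ Q q (⁅ a ⁆ ∪ ⁅ b ⁆) x∈
    ... | inj₂ (refl , _) = ∪⁺ˡ ⁅ q ⁆ ⁅ b ⁆ q (x∈⁅x⁆ q)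
    ... | inj₁ (x∈ab , x∉Q) with x∈p∪q⁻ ⁅ a ⁆ ⁅ b ⁆ x∈ab
    ...   | inj₁ x∈a = ⊥-elim (x∉Q (subst (_∈ Q) (sym (x∈⁅y⁆⇒x≡y a x∈a)) a∈Q))
    ...   | inj₂ x∈b = ∪⁺ʳ ⁅ q ⁆ ⁅ b ⁆ x x∈b

  -- If S and T are both inside Q, or both not, the quadratic relation is that of one factor. An
  -- edge {a, b} with only a in Q becomes {q, b}; since q lies in Q this is again an edge with two
  -- ends, on which G vanishes.
  ⊗-valid : ∀ {F G Q q} → q ∈ Q → Valid F → Valid G → Valid (F ⊗[ Q , q ] G)
  ⊗-valid {F} {G} {Q} {q} q∈Q vF vG = record { perm = ⊗-perm F G Q q F.perm G.perm ; quad = qd ; pair = pr }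
    where
    module F = Valid vF
    module G = Valid vG
    open ≡-Reasoning
    H = F ⊗[ Q , q ] G
    c = contract Q q
    i = ins F G Q q
    o = outs F G Q q
    in₁ : ∀ {T} M → T ⊑ Q → H (T ∷ M) ≡ F (T ∷ i M) * G (o M)
    in₁ M t = cong₂ (λ A B → F A * G B) (proj₁ (⊗-in F G Q q M t)) (proj₂ (⊗-in F G Q q M t))
    out₁ : ∀ {T} M → ¬ T ⊑ Q → H (T ∷ M) ≡ F (i M) * G (c T ∷ o M)
    out₁ M t = cong₂ (λ A B → F A * G B) (proj₁ (⊗-out F G Q q M t)) (proj₂ (⊗-out F G Q q M t))
    in-in : ∀ {S T} M → S ⊑ Q → T ⊑ Q → H (S ∷ T ∷ M) ≡ F (S ∷ T ∷ i M) * G (o M)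
    in-in {S} M s t = trans (in₁ _ s) (cong₂ (λ A B → F (S ∷ A) * G B) (proj₁ (⊗-in F G Q q M t)) (proj₂ (⊗-in F G Q q M t)))
    in-out : ∀ {S T} M → S ⊑ Q → ¬ T ⊑ Q → H (S ∷ T ∷ M) ≡ F (S ∷ i M) * G (c T ∷ o M)
    in-out {S} M s t = trans (in₁ _ s) (cong₂ (λ A B → F (S ∷ A) * G B) (proj₁ (⊗-out F G Q q M t)) (proj₂ (⊗-out F G Q q M t)))
    out-out : ∀ {S T} M → ¬ S ⊑ Q → ¬ T ⊑ Q → H (S ∷ T ∷ M) ≡ F (i M) * G (c S ∷ c T ∷ o M)
    out-out {S} M s t = trans (out₁ _ s) (cong₂ (λ A B → F A * G (c S ∷ B)) (proj₁ (⊗-out F G Q q M t)) (proj₂ (⊗-out F G Q q M t)))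
    out-in : ∀ {S T} M → ¬ S ⊑ Q → T ⊑ Q → H (S ∷ T ∷ M) ≡ F (T ∷ i M) * G (c S ∷ o M)
    out-in {S} M s t = trans (out₁ _ s) (cong₂ (λ A B → F A * G (c S ∷ B)) (proj₁ (⊗-in F G Q q M t)) (proj₂ (⊗-in F G Q q M t)))

    ∪⋢ˡ : ∀ {S T} → ¬ S ⊑ Q → ¬ S ∪ T ⊑ Q
    ∪⋢ˡ {S} {T} s r = s (⊑-trans (∪⁺ˡ S T) r)
    ∪⋢ʳ : ∀ {S T} → ¬ T ⊑ Q → ¬ S ∪ T ⊑ Q
    ∪⋢ʳ {S} {T} t r = t (⊑-trans (∪⁺ʳ S T) r)

    qd′ : ∀ S T M → Meets S T → Dec (S ⊑ Q) → Dec (T ⊑ Q) → H (S ∷ T ∷ M) + H (S ∪ T ∷ S ∪ T ∷ M) ≡ H (S ∷ S ∪ T ∷ M) + H (T ∷ S ∪ T ∷ M)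
    qd : ∀ S T M → Meets S T → H (S ∷ T ∷ M) + H (S ∪ T ∷ S ∪ T ∷ M) ≡ H (S ∷ S ∪ T ∷ M) + H (T ∷ S ∪ T ∷ M)
    qd S T M m = qd′ S T M m (S ⊑? Q) (T ⊑? Q)
    qd′ S T M m (yes s) (yes t) = begin
      H (S ∷ T ∷ M) + H (S ∪ T ∷ S ∪ T ∷ M)  ≡⟨ cong₂ _+_ (in-in M s t) (in-in M u u) ⟩
      F (S ∷ T ∷ i M) * G (o M) + F (S ∪ T ∷ S ∪ T ∷ i M) * G (o M)  ≡⟨ sym (ℚₚ.*-distribʳ-+ (G (o M)) (F (S ∷ T ∷ i M)) (F (S ∪ T ∷ S ∪ T ∷ i M))) ⟩
      (F (S ∷ T ∷ i M) + F (S ∪ T ∷ S ∪ T ∷ i M)) * G (o M)  ≡⟨ cong (_* G (o M)) (F.quad S T (i M) m) ⟩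
      (F (S ∷ S ∪ T ∷ i M) + F (T ∷ S ∪ T ∷ i M)) * G (o M)  ≡⟨ ℚₚ.*-distribʳ-+ (G (o M)) (F (S ∷ S ∪ T ∷ i M)) (F (T ∷ S ∪ T ∷ i M)) ⟩
      F (S ∷ S ∪ T ∷ i M) * G (o M) + F (T ∷ S ∪ T ∷ i M) * G (o M)  ≡⟨ sym (cong₂ _+_ (in-in M s u) (in-in M t u)) ⟩
      H (S ∷ S ∪ T ∷ M) + H (T ∷ S ∪ T ∷ M) ∎
      where u = ∪-lub s t
    qd′ S T M m (yes s) (no t) rewrite in-out M s t | out-out {S ∪ T} {S ∪ T} M (∪⋢ʳ {S} t) (∪⋢ʳ {S} t) | in-out {S} {S ∪ T} M s (∪⋢ʳ {S} t) | out-out {T} {S ∪ T} M t (∪⋢ʳ {S} t)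
                             | contract-inside q s m = refl
    qd′ S T M m (no s) (yes t) rewrite out-in M s t | out-out {S ∪ T} {S ∪ T} M (∪⋢ˡ {S} {T} s) (∪⋢ˡ {S} {T} s) | in-out {T} {S ∪ T} M t (∪⋢ˡ {S} {T} s) | out-out {S} {S ∪ T} M s (∪⋢ˡ {S} {T} s)
                             | trans (cong c (∪-comm S T)) (contract-inside q t (proj₁ m , proj₂ (proj₂ m) , proj₁ (proj₂ m)))
                             = ℚₚ.+-comm (F (T ∷ i M) * G (c S ∷ o M)) (F (i M) * G (c S ∷ c S ∷ o M))
    qd′ S T M m (no s) (no t) = begin
      H (S ∷ T ∷ M) + H (S ∪ T ∷ S ∪ T ∷ M)  ≡⟨ cong₂ _+_ (out-out M s t) (trans (out-out M u u) (cong (λ V → F (i M) * G (V ∷ V ∷ o M)) cU)) ⟩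
      F (i M) * G (c S ∷ c T ∷ o M) + F (i M) * G (c S ∪ c T ∷ c S ∪ c T ∷ o M)  ≡⟨ sym (ℚₚ.*-distribˡ-+ (F (i M)) (G (c S ∷ c T ∷ o M)) (G (c S ∪ c T ∷ c S ∪ c T ∷ o M))) ⟩
      F (i M) * (G (c S ∷ c T ∷ o M) + G (c S ∪ c T ∷ c S ∪ c T ∷ o M))  ≡⟨ cong (F (i M) *_) (G.quad (c S) (c T) (o M) (contract-meets q m)) ⟩
      F (i M) * (G (c S ∷ c S ∪ c T ∷ o M) + G (c T ∷ c S ∪ c T ∷ o M))  ≡⟨ ℚₚ.*-distribˡ-+ (F (i M)) (G (c S ∷ c S ∪ c T ∷ o M)) (G (c T ∷ c S ∪ c T ∷ o M)) ⟩
      F (i M) * G (c S ∷ c S ∪ c T ∷ o M) + F (i M) * G (c T ∷ c S ∪ c T ∷ o M)  ≡⟨ sym (cong₂ _+_ (trans (out-out M s u) (cong (λ V → F (i M) * G (c S ∷ V ∷ o M)) cU)) (trans (out-out M t u) (cong (λ V → F (i M) * G (c T ∷ V ∷ o M)) cU))) ⟩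
      H (S ∷ S ∪ T ∷ M) + H (T ∷ S ∪ T ∷ M) ∎
      where u = λ r → s (⊑-trans (∪⁺ˡ S T) r)
            cU = contract-∪ Q q S T

    pr : ∀ a b M → a ≢ b → H (⁅ a ⁆ ∪ ⁅ b ⁆ ∷ M) ≡ 0ℚ
    pr a b M a≢b with a ∈? Q | b ∈? Q
    ... | yes a∈ | yes b∈ = trans (in₁ M (pair⊑ a∈ b∈)) (trans (cong (_* G (o M)) (F.pair a b (i M) a≢b)) (ℚₚ.*-zeroˡ (G (o M))))
    ... | yes a∈ | no b∉ = trans (out₁ M (λ r → b∉ (r b (∪⁺ʳ ⁅ a ⁆ ⁅ b ⁆ b (x∈⁅x⁆ b)))))
        (trans (cong (λ V → F (i M) * G (V ∷ o M)) (contract-pair q a∈ b∉))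
          (trans (cong (F (i M) *_) (G.pair q b (o M) λ { refl → b∉ q∈Q })) (ℚₚ.*-zeroʳ (F (i M)))))
    ... | no a∉ | yes b∈ = trans (out₁ M (λ r → a∉ (r a (∪⁺ˡ ⁅ a ⁆ ⁅ b ⁆ a (x∈⁅x⁆ a)))))
        (trans (cong (λ V → F (i M) * G (V ∷ o M)) (trans (cong c (∪-comm ⁅ a ⁆ ⁅ b ⁆)) (contract-pair q b∈ a∉)))
          (trans (cong (F (i M) *_) (G.pair q a (o M) λ { refl → a∉ q∈Q })) (ℚₚ.*-zeroʳ (F (i M)))))
    ... | no a∉ | no b∉ = trans (out₁ M (λ r → a∉ (r a (∪⁺ˡ ⁅ a ⁆ ⁅ b ⁆ a (x∈⁅x⁆ a)))))
        (trans (cong (λ V → F (i M) * G (V ∷ o M)) (contract-disjoint Q q ¬m))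
          (trans (cong (F (i M) *_) (G.pair a b (o M) a≢b)) (ℚₚ.*-zeroʳ (F (i M)))))
      where
      ¬m : ¬ Meets (⁅ a ⁆ ∪ ⁅ b ⁆) Q
      ¬m (x , x∈ , x∈Q) = [ (λ z → a∉ (subst (_∈ Q) (x∈⁅y⁆⇒x≡y a z) x∈Q)) , (λ z → b∉ (subst (_∈ Q) (x∈⁅y⁆⇒x≡y b z) x∈Q)) ]′ (x∈p∪q⁻ ⁅ a ⁆ ⁅ b ⁆ x∈)

  tensor⁻ : ∀ {g : Item {n} → Item → Item} {L₁ L₂ p} → p ∈ₗ tensor g L₁ L₂ → ∃ λ p₁ → ∃ λ p₂ → p₁ ∈ₗ L₁ × p₂ ∈ₗ L₂ × p ≡ g p₁ p₂
  tensor⁻ {L₁ = L₁} p∈ with find (∈ₗ.∈-concatMap⁻ _ {xs = L₁} p∈)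
  ... | (p₁ , p₁∈ , r) with ∈ₗ.∈-map⁻ _ r
  ...   | (p₂ , p₂∈ , e) = p₁ , p₂ , p₁∈ , p₂∈ , e

  module _ {k : ℕ} {a b : Fin n} {xs : List (Fin n)} where

    basis-grafts : List Item
    basis-grafts = concatMap (λ (S , R) → tensor (graft a S R) (basis k S) (basis k (a ∷ R))) (bigSplits (b ∷ xs))

    data BasisCase (p : Item) : Set where
      lifted  : ∀ {p₀} → p₀ ∈ₗ basis k (b ∷ xs) → p ≡ lift b (b ∷ xs) p₀ → BasisCase p
      grafted : ∀ {S R p₁ p₂} → (S , R) ∈ₗ bigSplits (b ∷ xs) → p₁ ∈ₗ basis k S → p₂ ∈ₗ basis k (a ∷ R) →
                p ≡ graft a S R p₁ p₂ → BasisCase p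

    basisCase : ∀ {p} → p ∈ₗ basis (suc k) (a ∷ b ∷ xs) → BasisCase p
    basisCase p∈ with ∈ₗ.∈-++⁻ basis-grafts p∈
    ... | inj₂ q with ∈ₗ.∈-map⁻ _ q
    ...   | (_ , r , e) = lifted r e
    basisCase p∈ | inj₁ q with find (∈ₗ.∈-concatMap⁻ _ {xs = bigSplits (b ∷ xs)} q)
    ... | ((S , R) , SR∈ , r) with tensor⁻ {L₁ = basis k S} r
    ...   | (p₁ , p₂ , p₁∈ , p₂∈ , e) = grafted SR∈ p₁∈ p₂∈ e

  basis-valid : ∀ k (xs : List (Fin n)) {p} → p ∈ₗ basis k xs → ∀ J → Valid (proj₂ p J)
  basis-valid (suc k) (a ∷ []) (here refl) J = top-valid (length J)
  basis-valid (suc k) (a ∷ b ∷ xs) p∈ J with basisCase {k} {a} {b} {xs} p∈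
  ... | lifted p₀∈ refl = ⊗-valid (⟦∷⟧-here b xs) (basis-valid k (b ∷ xs) p₀∈ []) (top-valid (length J))
  ... | grafted {S} {[]} SR∈ p₁∈ p₂∈ refl = basis-valid k S p₁∈ (J ++ List.[ a ])
  ... | grafted {S} {r ∷ R} SR∈ p₁∈ p₂∈ refl =
    ⊗-valid (∪⁺ˡ ⁅ a ⁆ ⟦ S ⟧ a (x∈⁅x⁆ a)) (basis-valid k S p₁∈ List.[ a ]) (basis-valid k (a ∷ r ∷ R) p₂∈ J)

-- Push-forward along the forgetful map

nonempty : ∀ {A : Set} (xs : List A) → xs ≢ [] → 1 ≤ length xs
nonempty []      ne = ⊥-elim (ne refl)
nonempty (_ ∷ _) _  = s≤s z≤n

module _ {n : ℕ} where

  ∣⟦⟧∣≤ : (xs : List (Fin n)) → ∣ ⟦ xs ⟧ ∣ ≤ length xs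
  ∣⟦⟧∣≤ [] = subst (∣ ∅ ∣ ≤_) (Subsetₚ.∣⊥∣≡0 n) (⊑⇒∣∣≤ {V = ∅} {W = ⊥ₛ} λ x x∈ → case ∈-⟦⟧⁻ [] x∈ of λ ())
    where
    ∅ : Subset n
    ∅ = ⟦ [] ⟧
  ∣⟦⟧∣≤ (a ∷ xs) = ℕₚ.≤-trans (⊑⇒∣∣≤ {W = ⁅ a ⁆ ∪ ⟦ xs ⟧} (λ x x∈ → [ (λ { refl → ∪⁺ˡ ⁅ a ⁆ ⟦ xs ⟧ a (x∈⁅x⁆ a) }) , ∪⁺ʳ ⁅ a ⁆ ⟦ xs ⟧ x ]′ (⟦∷⟧⁻ a xs x∈)))
    (ℕₚ.≤-trans (∣∪∣≤ ⁅ a ⁆ ⟦ xs ⟧) (subst (λ m → m ℕ.+ ∣ ⟦ xs ⟧ ∣ ≤ suc (length xs)) (sym (∣⁅⁆∣≡1 a)) (s≤s (∣⟦⟧∣≤ xs))))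

  ∣⟦⟧∣≥ : (xs : List (Fin n)) → Unique xs → length xs ≤ ∣ ⟦ xs ⟧ ∣
  ∣⟦⟧∣≥ [] _ = z≤n
  ∣⟦⟧∣≥ (a ∷ xs) u@(_ ∷ u′) = ℕₚ.≤-trans (s≤s (∣⟦⟧∣≥ xs u′))
    (p⊂q⇒∣p∣<∣q∣ ((λ {x} → ⟦∷⟧-there a xs x) , a , ⟦∷⟧-here a xs , a∉⟦⟧ u))

  -- The top degree on at most j + 2 points is j: sparsity at V itself fails for j + 1 letters.
  top-zero : ∀ {V : Subset n} {j M} → All (_⊑ V) M → ∣ V ∣ ≤ 2 ℕ.+ j → top (suc j) M ≡ 0ℚ
  top-zero {V} {j} {M} all V≤ = indicator-no
    (λ (sp , l) → ℕₚ.1+n≰n (subst (_≤ j) (trans (count-all V all) l) (ℕₚ.≤-trans (sp V) (ℕₚ.m≤n+o⇒m∸n≤o _ 2 V≤))))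
    (sparse? M ×-dec (length M ℕ.≟ suc j))

  -- A set V that sees the new letter contains C, so it has at least j + 3 points and may contain
  -- all j + 1 letters.
  top-full : ∀ {C : Subset n} {j} → 3 ℕ.+ j ≤ ∣ C ∣ → ∀ M → top (suc j) (C ∷ M) ≡ top j M
  top-full {C} {j} C≥ M = indicator-cong
    (λ (sp , l) → sparse-mono {M = C ∷ M} (λ V → count-≤-∷ V C M) sp , ℕₚ.suc-injective l)
    (λ (sp , l) → extend sp l , cong suc l)
    (sparse? (C ∷ M) ×-dec (suc (length M) ℕ.≟ suc j)) (sparse? M ×-dec (length M ℕ.≟ j))
    where
    extend : Sparse M → length M ≡ j → Sparse (C ∷ M)
    extend sp l V with C ⊑? V
    ... | no C⋢ = subst (_≤ ∣ V ∣ ∸ 2) (sym (count-no V M C⋢)) (sp V)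
    ... | yes C⊑ = subst (_≤ ∣ V ∣ ∸ 2) (sym (count-yes V M C⊑))
            (ℕₚ.≤-trans (s≤s (subst (count⊑ V M ≤_) l (count-≤-length V M))) (ℕₚ.∸-monoˡ-≤ 2 (ℕₚ.≤-trans C≥ (⊑⇒∣∣≤ C⊑))))

  -- What identifies Φ (⋆ ∷ J) as Φ J after push-forward along the map forgetting ⋆. By the
  -- projection formula a pulled-back class pushes forward to zero, and h of the whole ground set,
  -- of fibre degree one up to sign, pushes forward to a constant, normalised to one.
  record Lifts (Φ : List (Fin n) → Functional) (xs : List (Fin n)) (⋆ : Fin n) (J : List (Fin n)) : Set where
    field
      avoid : ∀ M → All (_⊑ ⟦ xs ⟧ ∪ ⟦ J ⟧) M → Φ (⋆ ∷ J) M ≡ 0ℚ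
      full  : ∀ M → Φ (⋆ ∷ J) (⁅ ⋆ ⁆ ∪ (⟦ xs ⟧ ∪ ⟦ J ⟧) ∷ M) ≡ Φ J M

  outs-⊑ : ∀ {F G : Functional} {Q E E′ : Subset n} {q} → (∀ {T} → T ⊑ E → contract Q q T ⊑ E′) →
           ∀ M → All (_⊑ E) M → All (_⊑ E′) (outs F G Q q M)
  outs-⊑ {Q = Q} f M all = Allₚ.map⁺ (All.map f (Allₚ.filter⁺ (λ T → ¬? (T ⊑? Q)) all))

  -- For empty R this is a change of bookkeeping: X ∪ J is S ∪ (J ∪ a). Otherwise ⋆ lies outside a ∪
  -- S, and contraction takes the whole ground set to the whole ground set of the quotient, so both
  -- properties come from the outer factor.
  graft-lifts : ∀ {a b xs S R J ⋆ Φ₁ Φ₂} → Split a (b ∷ xs) S R →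
                Unique (⋆ ∷ J) → (∀ {x} → x ∈ₗ a ∷ b ∷ xs → x ∉ₗ ⋆ ∷ J) → Unique (a ∷ b ∷ xs) →
                (R ≡ [] → Lifts Φ₁ S ⋆ (J ++ List.[ a ])) → (R ≢ [] → Lifts Φ₂ (a ∷ R) ⋆ J) →
                Lifts (graftF {n} a S R Φ₁ Φ₂) (a ∷ b ∷ xs) ⋆ J
  graft-lifts {a} {b} {xs} {S} {[]} {J} {⋆} {Φ₁} sp _ _ _ ih _ = record
    { avoid = λ M all → ih′.avoid M (subst (λ V → All (_⊑ V) M) E≡ all)
    ; full = λ M → trans (cong (λ V → Φ₁ (⋆ ∷ (J ++ List.[ a ])) (⁅ ⋆ ⁆ ∪ V ∷ M)) E≡) (ih′.full M)
    }
    where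
    open Split sp
    module ih′ = Lifts (ih refl)
    E≡ : ⟦ a ∷ b ∷ xs ⟧ ∪ ⟦ J ⟧ ≡ ⟦ S ⟧ ∪ ⟦ J ++ List.[ a ] ⟧
    E≡ = ⊑-antisym
      (∪-lub (λ x x∈ → [ (λ { refl → ∪⁺ʳ ⟦ S ⟧ _ a (∈-⟦⟧⁺ (J ++ List.[ a ]) (∈ₗ.∈-++⁺ʳ J (here refl))) })
                       , (λ z → [ ∪⁺ˡ ⟦ S ⟧ _ x , (λ x∈[] → case ∈-⟦⟧⁻ [] x∈[] of λ ()) ]′ (cover x z)) ]′ (⟦∷⟧⁻ a (b ∷ xs) x∈))
             (λ x x∈ → ∪⁺ʳ ⟦ S ⟧ _ x (∈-⟦⟧⁺ (J ++ List.[ a ]) (∈ₗ.∈-++⁺ˡ (∈-⟦⟧⁻ J x∈)))))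
      (∪-lub (λ x x∈ → ∪⁺ˡ _ ⟦ J ⟧ x (⟦∷⟧-there a (b ∷ xs) x (S⊑ x x∈)))
             (λ x x∈ → [ (λ z → ∪⁺ʳ ⟦ a ∷ b ∷ xs ⟧ ⟦ J ⟧ x (∈-⟦⟧⁺ J z)) , (λ { (here refl) → ∪⁺ˡ _ ⟦ J ⟧ a (⟦∷⟧-here a (b ∷ xs)) }) ]′
                         (∈ₗ.∈-++⁻ J (∈-⟦⟧⁻ (J ++ List.[ a ]) x∈))))
  graft-lifts {a} {b} {xs} {S} {r ∷ R} {J} {⋆} {Φ₁} {Φ₂} sp u⋆ dis u _ ih = record
    { avoid = λ M all → trans (cong (Φ₁ List.[ a ] (ins (Φ₁ List.[ a ]) (Φ₂ (⋆ ∷ J)) Q a M) *_) (ih′.avoid _ (outs-⊑ {Φ₁ List.[ a ]} {Φ₂ (⋆ ∷ J)} to M all))) (ℚₚ.*-zeroʳ (Φ₁ List.[ a ] (ins (Φ₁ List.[ a ]) (Φ₂ (⋆ ∷ J)) Q a M)))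
    ; full = λ M → let (e₁ , e₂) = ⊗-out (Φ₁ List.[ a ]) (Φ₂ (⋆ ∷ J)) Q a M full⋢ in
        trans (cong₂ (λ A B → Φ₁ List.[ a ] A * Φ₂ (⋆ ∷ J) B) e₁ (trans e₂ (cong (_∷ _) full≡)))
              (cong (Φ₁ List.[ a ] (ins (Φ₁ List.[ a ]) (Φ₂ (⋆ ∷ J)) Q a M) *_) (ih′.full _))
    }
    where
    open Split sp
    nonempty-R : r ∷ R ≢ []
    nonempty-R ()
    module ih′ = Lifts (ih nonempty-R)
    Q = ⁅ a ⁆ ∪ ⟦ S ⟧
    E = ⟦ a ∷ b ∷ xs ⟧ ∪ ⟦ J ⟧
    E′ = ⟦ a ∷ r ∷ R ⟧ ∪ ⟦ J ⟧
    Q⊑ : Q ⊑ ⟦ a ∷ b ∷ xs ⟧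
    Q⊑ = star⊑ a S⊑
    a∈Q : a ∈ Q
    a∈Q = ∪⁺ˡ ⁅ a ⁆ ⟦ S ⟧ a (x∈⁅x⁆ a)
    away : ∀ x → x ∈ ⟦ ⋆ ∷ J ⟧ → x ∉ Q
    away x x∈ x∈Q = dis (∈-⟦⟧⁻ (a ∷ b ∷ xs) (Q⊑ x x∈Q)) (∈-⟦⟧⁻ (⋆ ∷ J) x∈)
    to : ∀ {T} → T ⊑ E → contract Q a T ⊑ E′
    to {T} T⊑ x x∈ with ∈-contract⁻ Q a T x∈
    ... | inj₂ (refl , _) = ∪⁺ˡ _ ⟦ J ⟧ a (⟦∷⟧-here a (r ∷ R))
    ... | inj₁ (x∈T , x∉Q) with x∈p∪q⁻ ⟦ a ∷ b ∷ xs ⟧ ⟦ J ⟧ (T⊑ x x∈T)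
    ...   | inj₂ x∈J = ∪⁺ʳ ⟦ a ∷ r ∷ R ⟧ ⟦ J ⟧ x x∈J
    ...   | inj₁ x∈X with ⟦∷⟧⁻ a (b ∷ xs) x∈X
    ...     | inj₁ refl = ⊥-elim (x∉Q a∈Q)
    ...     | inj₂ x∈X′ with cover x x∈X′
    ...       | inj₁ x∈S = ⊥-elim (x∉Q (∪⁺ʳ ⁅ a ⁆ ⟦ S ⟧ x x∈S))
    ...       | inj₂ x∈R = ∪⁺ˡ _ ⟦ J ⟧ x (⟦∷⟧-there a (r ∷ R) x x∈R)
    full⋢ : ¬ ⁅ ⋆ ⁆ ∪ E ⊑ Q
    full⋢ ⊑Q = away ⋆ (⟦∷⟧-here ⋆ J) (⊑Q ⋆ (∪⁺ˡ ⁅ ⋆ ⁆ E ⋆ (x∈⁅x⁆ ⋆)))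
    keep : ∀ {x} → x ∈ ⁅ ⋆ ⁆ ∪ E → x ∉ Q → x ∈ contract Q a (⁅ ⋆ ⁆ ∪ E)
    keep x∈ x∉ = ∈-contract⁺ Q a (⁅ ⋆ ⁆ ∪ E) (inj₁ (x∈ , x∉))
    full≡ : contract Q a (⁅ ⋆ ⁆ ∪ E) ≡ ⁅ ⋆ ⁆ ∪ E′
    full≡ = ⊑-antisym
      (λ x x∈ → [ (λ (x∈E , x∉Q) → [ ∪⁺ˡ ⁅ ⋆ ⁆ E′ x , (λ z → ∪⁺ʳ ⁅ ⋆ ⁆ E′ x (to (λ _ → id) x (∈-contract⁺ Q a E (inj₁ (z , x∉Q))))) ]′ (x∈p∪q⁻ ⁅ ⋆ ⁆ E x∈E))
                , (λ { (refl , _) → ∪⁺ʳ ⁅ ⋆ ⁆ E′ a (∪⁺ˡ _ ⟦ J ⟧ a (⟦∷⟧-here a (r ∷ R))) }) ]′ (∈-contract⁻ Q a (⁅ ⋆ ⁆ ∪ E) x∈))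
      (∪-lub (⁅⁆⊑ (keep (∪⁺ˡ ⁅ ⋆ ⁆ E ⋆ (x∈⁅x⁆ ⋆)) (away ⋆ (⟦∷⟧-here ⋆ J))))
        (∪-lub (λ x x∈ → [ (λ { refl → ∈-contract⁺ Q a (⁅ ⋆ ⁆ ∪ E) (inj₂ (refl , a , ∪⁺ʳ ⁅ ⋆ ⁆ E a (∪⁺ˡ _ ⟦ J ⟧ a (⟦∷⟧-here a (b ∷ xs))) , a∈Q)) })
                         , (λ x∈R → keep (∪⁺ʳ ⁅ ⋆ ⁆ E x (∪⁺ˡ _ ⟦ J ⟧ x (⟦∷⟧-there a (b ∷ xs) x (R⊑ x x∈R)))) (R∉Q x x∈R)) ]′ (⟦∷⟧⁻ a (r ∷ R) x∈))
               (λ x x∈ → keep (∪⁺ʳ ⁅ ⋆ ⁆ E x (∪⁺ʳ ⟦ a ∷ b ∷ xs ⟧ ⟦ J ⟧ x x∈)) (away x (⟦∷⟧-there ⋆ J x x∈)))))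
      where
      R∉Q : ∀ x → x ∈ ⟦ r ∷ R ⟧ → x ∉ Q
      R∉Q x x∈R x∈Q = [ (λ z → a∉⟦⟧ u (subst (_∈ ⟦ b ∷ xs ⟧) (x∈⁅y⁆⇒x≡y a z) (R⊑ x x∈R))) , (λ z → disj x z x∈R) ]′ (x∈p∪q⁻ ⁅ a ⁆ ⟦ S ⟧ x∈Q)

  -- Without ⋆ the quotient has only the points b, a and J, too few for degree |J| + 1; with ⋆ the
  -- contracted full set has |J| + 3 points, as `top-full` requires.
  lift-lifts : ∀ {a b xs J ⋆ p} → Unique (⋆ ∷ J) → (∀ {x} → x ∈ₗ a ∷ b ∷ xs → x ∉ₗ ⋆ ∷ J) → Unique (a ∷ b ∷ xs) →
               Lifts (proj₂ (lift {n} b (b ∷ xs) p)) (a ∷ b ∷ xs) ⋆ J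
  lift-lifts {a} {b} {xs} {J} {⋆} {w , Φ} u⋆@(⋆∉ ∷ uJ) dis u@((a≢b ∷ _) ∷ _) = record
    { avoid = λ M all → trans (cong (Φ [] (ins (Φ []) (top (suc j)) Q b M) *_)
          (top-zero (outs-⊑ {Φ []} {top (suc j)} to M all) (∣⟦⟧∣≤ (b ∷ a ∷ J)))) (ℚₚ.*-zeroʳ (Φ [] (ins (Φ []) (top (suc j)) Q b M)))
    ; full = λ M → let (e₁ , e₂) = ⊗-out (Φ []) (top (suc j)) Q b M full⋢ in
        trans (cong₂ (λ A B → Φ [] A * top (suc j) B) e₁ e₂)
              (cong (Φ [] (ins (Φ []) (top (suc j)) Q b M) *_) (top-full (ℕₚ.≤-trans (∣⟦⟧∣≥ (b ∷ a ∷ ⋆ ∷ J) uV) (⊑⇒∣∣≤ V⊑)) _))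
    }
    where
    j = length J
    Q = ⟦ b ∷ xs ⟧
    E = ⟦ a ∷ b ∷ xs ⟧ ∪ ⟦ J ⟧
    C = contract Q b (⁅ ⋆ ⁆ ∪ E)
    a∉Q : a ∉ Q
    a∉Q = a∉⟦⟧ u
    away : ∀ x → x ∈ ⟦ ⋆ ∷ J ⟧ → x ∉ Q
    away x x∈ x∈Q = dis (there (∈-⟦⟧⁻ (b ∷ xs) x∈Q)) (∈-⟦⟧⁻ (⋆ ∷ J) x∈)
    full⋢ : ¬ ⁅ ⋆ ⁆ ∪ E ⊑ Q
    full⋢ ⊑Q = away ⋆ (⟦∷⟧-here ⋆ J) (⊑Q ⋆ (∪⁺ˡ ⁅ ⋆ ⁆ E ⋆ (x∈⁅x⁆ ⋆)))
    to : ∀ {T} → T ⊑ E → contract Q b T ⊑ ⟦ b ∷ a ∷ J ⟧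
    to {T} T⊑ x x∈ with ∈-contract⁻ Q b T x∈
    ... | inj₂ (refl , _) = ⟦∷⟧-here b (a ∷ J)
    ... | inj₁ (x∈T , x∉Q) with x∈p∪q⁻ ⟦ a ∷ b ∷ xs ⟧ ⟦ J ⟧ (T⊑ x x∈T)
    ...   | inj₂ x∈J = ⟦∷⟧-there b (a ∷ J) x (⟦∷⟧-there a J x x∈J)
    ...   | inj₁ x∈X with ⟦∷⟧⁻ a (b ∷ xs) x∈X
    ...     | inj₁ refl = ⟦∷⟧-there b (a ∷ J) a (⟦∷⟧-here a J)
    ...     | inj₂ x∈Q = ⊥-elim (x∉Q x∈Q)
    keep : ∀ {x} → x ∈ ⁅ ⋆ ⁆ ∪ E → x ∉ Q → x ∈ C
    keep x∈ x∉ = ∈-contract⁺ Q b (⁅ ⋆ ⁆ ∪ E) (inj₁ (x∈ , x∉))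
    a∈E : a ∈ ⁅ ⋆ ⁆ ∪ E
    a∈E = ∪⁺ʳ ⁅ ⋆ ⁆ E a (∪⁺ˡ _ ⟦ J ⟧ a (⟦∷⟧-here a (b ∷ xs)))
    b∈E : b ∈ ⁅ ⋆ ⁆ ∪ E
    b∈E = ∪⁺ʳ ⁅ ⋆ ⁆ E b (∪⁺ˡ _ ⟦ J ⟧ b (⟦∷⟧-there a (b ∷ xs) b (⟦∷⟧-here b xs)))
    V⊑ : ⟦ b ∷ a ∷ ⋆ ∷ J ⟧ ⊑ C
    V⊑ x x∈ with ∈-⟦⟧⁻ (b ∷ a ∷ ⋆ ∷ J) x∈
    ... | here refl = ∈-contract⁺ Q b (⁅ ⋆ ⁆ ∪ E) (inj₂ (refl , b , b∈E , ⟦∷⟧-here b xs))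
    ... | there (here refl) = keep a∈E a∉Q
    ... | there (there (here refl)) = keep (∪⁺ˡ ⁅ ⋆ ⁆ E ⋆ (x∈⁅x⁆ ⋆)) (away ⋆ (⟦∷⟧-here ⋆ J))
    ... | there (there (there x∈J)) = keep (∪⁺ʳ ⁅ ⋆ ⁆ E x (∪⁺ʳ ⟦ a ∷ b ∷ xs ⟧ ⟦ J ⟧ x (∈-⟦⟧⁺ J x∈J))) (away x (∈-⟦⟧⁺ (⋆ ∷ J) (there x∈J)))
    uV : Unique (b ∷ a ∷ ⋆ ∷ J)
    uV = ((λ b≡a → a≢b (sym b≡a)) ∷ All.tabulate (λ { x∈ refl → dis (there (here refl)) x∈ })) ∷ All.tabulate (λ { x∈ refl → dis (here refl) x∈ }) ∷ u⋆

  -- A single point x is excluded because `full` fails there: `top 1` is zero on the edge {⋆, x},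
  -- whereas `top 0 []` is one.
  basis-lifts : ∀ k (xs : List (Fin n)) {p} → p ∈ₗ basis k xs → 2 ≤ length xs → Unique xs →
                ∀ ⋆ J → Unique (⋆ ∷ J) → (∀ {x} → x ∈ₗ xs → x ∉ₗ ⋆ ∷ J) → Lifts (proj₂ p) xs ⋆ J
  basis-lifts (suc k) (a ∷ []) _ (s≤s ())
  basis-lifts (suc k) (a ∷ b ∷ xs) p∈ _ u ⋆ J u⋆ dis with basisCase {k = k} {a} {b} {xs} p∈
  ... | lifted {p₀} _ refl = lift-lifts {p = p₀} u⋆ dis u
  ... | grafted {S} {R} {p₁} {p₂} SR∈ p₁∈ p₂∈ refl = graft-lifts sp u⋆ dis u
      (λ { refl → basis-lifts k S p₁∈ len2 uS ⋆ (J ++ List.[ a ])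
                   (Uniqueₚ.++⁺ u⋆ ([] ∷ []) (λ { (x∈ , here refl) → dis (here refl) x∈ }))
                   (λ {x} x∈S x∈⋆J → [ dis (in-xs x∈S) , (λ { (here refl) → a∉⟦⟧ u (S⊑ a (∈-⟦⟧⁺ S x∈S)) }) ]′ (∈ₗ.∈-++⁻ (⋆ ∷ J) x∈⋆J)) })
      (λ R≢[] → basis-lifts k (a ∷ R) p₂∈ (s≤s (nonempty R R≢[])) uR ⋆ J u⋆ (λ { (here refl) → dis (here refl) ; (there x∈R) → dis (there (∈-⟦⟧⁻ (b ∷ xs) (R⊑ _ (∈-⟦⟧⁺ R x∈R)))) }))
    where
    sp = split a (b ∷ xs) u SR∈
    open Split sp
    in-xs : ∀ {x} → x ∈ₗ S → x ∈ₗ a ∷ b ∷ xs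
    in-xs x∈S = there (∈-⟦⟧⁻ (b ∷ xs) (S⊑ _ (∈-⟦⟧⁺ S x∈S)))

-- Independence of the basis

module _ {n : ℕ} where

  -- Coefficients are indexed by position through a function on ℕ, so that passing to a block of a
  -- concatenation is a shift of the argument.
  combine : (ℕ → ℚ) → (Item {n} → ℚ) → List Item → ℚ
  combine c g []      = 0ℚ
  combine c g (p ∷ L) = c 0 * g p + combine (c ∘ suc) g L

  pairing : Item {n} → Item → ℚ
  pairing o p = proj₂ o [] (proj₁ p)

  Independent : List (Item {n}) → Set
  Independent L = ∀ c → (∀ {o} → o ∈ₗ L → combine c (pairing o) L ≡ 0ℚ) → ∀ i → i < length L → c i ≡ 0ℚ

  combine-cong : ∀ {c d g h} L → (∀ i → c i ≡ d i) → (∀ {p} → p ∈ₗ L → g p ≡ h p) → combine c g L ≡ combine d h L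
  combine-cong [] _ _ = refl
  combine-cong (p ∷ L) e f = cong₂ _+_ (cong₂ _*_ (e 0) (f (here refl))) (combine-cong L (e ∘ suc) (f ∘ there))

  combine-++ : ∀ c g L₁ L₂ → combine c g (L₁ ++ L₂) ≡ combine c g L₁ + combine (λ i → c (length L₁ ℕ.+ i)) g L₂
  combine-++ c g [] L₂ = sym (ℚₚ.+-identityˡ _)
  combine-++ c g (p ∷ L₁) L₂ = trans (cong (c 0 * g p +_) (combine-++ (c ∘ suc) g L₁ L₂))
    (sym (ℚₚ.+-assoc (c 0 * g p) (combine (c ∘ suc) g L₁) _))

  combine-zero : ∀ c g L → (∀ {p} → p ∈ₗ L → g p ≡ 0ℚ) → combine c g L ≡ 0ℚ
  combine-zero c g [] _ = refl
  combine-zero c g (p ∷ L) z = trans (cong₂ _+_ (trans (cong (c 0 *_) (z (here refl))) (ℚₚ.*-zeroʳ (c 0))) (combine-zero (c ∘ suc) g L (z ∘ there))) refl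

  combine-zeroᶜ : ∀ c g L → (∀ i → i < length L → c i ≡ 0ℚ) → combine c g L ≡ 0ℚ
  combine-zeroᶜ c g [] _ = refl
  combine-zeroᶜ c g (p ∷ L) z = trans (cong₂ _+_ (trans (cong (_* g p) (z 0 (s≤s z≤n))) (ℚₚ.*-zeroˡ (g p))) (combine-zeroᶜ (c ∘ suc) g L (λ i i< → z (suc i) (s≤s i<)))) refl

  combine-map : ∀ c g (f : Item → Item) L → combine c g (List.map f L) ≡ combine c (g ∘ f) L
  combine-map c g f [] = refl
  combine-map c g f (p ∷ L) = cong (c 0 * g (f p) +_) (combine-map (c ∘ suc) g f L)

  combine-scale : ∀ c t g L → combine c (λ p → t * g p) L ≡ t * combine c g L
  combine-scale c t g [] = sym (ℚₚ.*-zeroʳ t)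
  combine-scale c t g (p ∷ L) = trans (cong₂ _+_ (swap-* (c 0) t (g p)) (combine-scale (c ∘ suc) t g L)) (sym (ℚₚ.*-distribˡ-+ t (c 0 * g p) _))
    where
    swap-* : ∀ x y z → x * (y * z) ≡ y * (x * z)
    swap-* x y z = trans (sym (ℚₚ.*-assoc x y z)) (trans (cong (_* z) (ℚₚ.*-comm x y)) (ℚₚ.*-assoc y x z))

  -- Block triangularity: the forms of L₁ do not see the words of L₂, so the coefficients on L₁
  -- vanish first, and then the forms of L₂ determine the rest.
  independent-++ : ∀ {L₁ L₂} → Independent L₁ → Independent L₂ →
                   (∀ {o p} → o ∈ₗ L₁ → p ∈ₗ L₂ → pairing o p ≡ 0ℚ) → Independent (L₁ ++ L₂)
  independent-++ {L₁} {L₂} ind₁ ind₂ cross c z = result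
    where
    c₁ : ∀ i → i < length L₁ → c i ≡ 0ℚ
    c₁ = ind₁ c λ {o} o∈ → trans (sym (trans (cong (combine c (pairing o) L₁ +_) (combine-zero _ (pairing o) L₂ (cross o∈))) (ℚₚ.+-identityʳ _)))
                                (trans (sym (combine-++ c (pairing o) L₁ L₂)) (z (∈ₗ.∈-++⁺ˡ o∈)))
    c₂ : ∀ i → i < length L₂ → c (length L₁ ℕ.+ i) ≡ 0ℚ
    c₂ = ind₂ (λ i → c (length L₁ ℕ.+ i)) λ {o} o∈ →
      trans (sym (trans (cong (_+ combine _ (pairing o) L₂) (combine-zeroᶜ c (pairing o) L₁ c₁)) (ℚₚ.+-identityˡ _)))
            (trans (sym (combine-++ c (pairing o) L₁ L₂)) (z (∈ₗ.∈-++⁺ʳ L₁ o∈)))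
    result : ∀ i → i < length (L₁ ++ L₂) → c i ≡ 0ℚ
    result i i< with i ℕ.<? length L₁
    ... | yes i<₁ = c₁ i i<₁
    ... | no ¬i< = subst (λ m → c m ≡ 0ℚ) (ℕₚ.m+[n∸m]≡n (ℕₚ.≮⇒≥ ¬i<))
          (c₂ (i ∸ length L₁) (ℕₚ.+-cancelˡ-< (length L₁) _ _ (subst₂ _<_ (sym (ℕₚ.m+[n∸m]≡n (ℕₚ.≮⇒≥ ¬i<))) (Listₚ.length-++ L₁) i<)))

  independent-[] : Independent []
  independent-[] c _ i ()

  independent-map : ∀ {L} (f : Item → Item) → Independent L → (∀ {o p} → o ∈ₗ L → p ∈ₗ L → pairing (f o) (f p) ≡ pairing o p) →
                    Independent (List.map f L)
  independent-map {L} f ind e c z i i< = ind c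
    (λ {o} o∈ → trans (combine-cong L (λ _ → refl) (λ p∈ → sym (e o∈ p∈)))
                (trans (sym (combine-map c (pairing (f o)) f L)) (z (∈ₗ.∈-map⁺ f o∈)))) i (subst (i <_) (Listₚ.length-map f L) i<)

  independent-concatMap : ∀ {A : Set} {f : A → List Item} {R : A → A → Set} {ss} → AllPairs R ss →
    (∀ {s} → s ∈ₗ ss → Independent (f s)) →
    (∀ {s t} → s ∈ₗ ss → t ∈ₗ ss → R s t → ∀ {o p} → o ∈ₗ f s → p ∈ₗ f t → pairing o p ≡ 0ℚ) → Independent (concatMap f ss)
  independent-concatMap [] _ _ = independent-[]
  independent-concatMap {f = f} {ss = s ∷ ss} (rs ∷ ap) ind cross =
    independent-++ (ind (here refl)) (independent-concatMap ap (ind ∘ there) (λ s∈ t∈ → cross (there s∈) (there t∈)))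
      λ o∈ p∈ → let (t , t∈ , p∈t) = find (∈ₗ.∈-concatMap⁻ f {xs = ss} p∈) in cross (here refl) (there t∈) (All.lookup rs t∈) o∈ p∈t

  combine-tensor : ∀ {g : Item → Item → Item} {o₁ o₂ o} L₁ L₂ c →
    (∀ {p₁ p₂} → p₁ ∈ₗ L₁ → p₂ ∈ₗ L₂ → pairing o (g p₁ p₂) ≡ pairing o₁ p₁ * pairing o₂ p₂) →
    combine c (pairing o) (tensor g L₁ L₂) ≡ combine (λ i → combine (λ j → c (i ℕ.* length L₂ ℕ.+ j)) (pairing o₂) L₂) (pairing o₁) L₁
  combine-tensor [] L₂ c e = refl
  combine-tensor {g} {o₁} {o₂} {o} (p ∷ L₁) L₂ c e =
    trans (combine-++ c (pairing o) (List.map (g p) L₂) (tensor g L₁ L₂))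
      (cong₂ _+_
        (trans (combine-map c (pairing o) (g p) L₂) (trans (combine-cong L₂ (λ _ → refl) (e (here refl)))
          (trans (combine-scale c (pairing o₁ p) (pairing o₂) L₂) (ℚₚ.*-comm (pairing o₁ p) _))))
        (trans (combine-tensor {g} {o₁} {o₂} {o} L₁ L₂ (λ i → c (length (List.map (g p) L₂) ℕ.+ i)) (e ∘ there))
          (combine-cong L₁ (λ i → combine-cong L₂ (λ j → cong c (trans (cong (ℕ._+ (i ℕ.* length L₂ ℕ.+ j)) (Listₚ.length-map (g p) L₂))
             (sym (ℕₚ.+-assoc (length L₂) (i ℕ.* length L₂) j)))) (λ _ → refl)) (λ _ → refl))))

  tensor-index : ∀ {g : Item {n} → Item → Item} L₁ L₂ (c : ℕ → ℚ) →
    (∀ i → i < length L₁ → ∀ j → j < length L₂ → c (i ℕ.* length L₂ ℕ.+ j) ≡ 0ℚ) → ∀ k → k < length (tensor g L₁ L₂) → c k ≡ 0ℚ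
  tensor-index {g} (p ∷ L₁) L₂ c z k k< with k ℕ.<? length L₂
  ... | yes k<₂ = z 0 (s≤s z≤n) k k<₂
  ... | no ¬k< = subst (λ m → c m ≡ 0ℚ) (ℕₚ.m+[n∸m]≡n (ℕₚ.≮⇒≥ ¬k<))
        (tensor-index {g} L₁ L₂ (λ i → c (length L₂ ℕ.+ i))
          (λ i i< j j< → subst (λ m → c m ≡ 0ℚ) (ℕₚ.+-assoc (length L₂) (i ℕ.* length L₂) j) (z (suc i) (s≤s i<) j j<))
          (k ∸ length L₂)
          (ℕₚ.+-cancelˡ-< (length L₂) _ _ (subst₂ _<_ (sym (ℕₚ.m+[n∸m]≡n (ℕₚ.≮⇒≥ ¬k<)))
             (trans (Listₚ.length-++ (List.map (g p) L₂)) (cong (ℕ._+ length (tensor g L₁ L₂)) (Listₚ.length-map (g p) L₂))) k<)))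

  -- The pairing matrix is a Kronecker product. For a fixed form o₂, the partial combinations over
  -- L₂ are coefficients on L₁, hence zero; then each of them is a relation on L₂.
  independent-tensor : ∀ {g : Item → Item → Item} {L₁ L₂} → Independent L₁ → Independent L₂ →
    (∀ {o₁ o₂ p₁ p₂} → o₁ ∈ₗ L₁ → o₂ ∈ₗ L₂ → p₁ ∈ₗ L₁ → p₂ ∈ₗ L₂ → pairing (g o₁ o₂) (g p₁ p₂) ≡ pairing o₁ p₁ * pairing o₂ p₂) →
    Independent (tensor g L₁ L₂)
  independent-tensor {g} {L₁} {L₂} ind₁ ind₂ e c z = tensor-index {g} L₁ L₂ c
    (λ i i< → ind₂ (λ j → c (i ℕ.* length L₂ ℕ.+ j)) (λ {o₂} o₂∈ →
      ind₁ (λ i → combine (λ j → c (i ℕ.* length L₂ ℕ.+ j)) (pairing o₂) L₂)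
        (λ {o₁} o₁∈ → trans (sym (combine-tensor {g} {o₁} {o₂} {g o₁ o₂} L₁ L₂ c (e o₁∈ o₂∈)))
           (z (∈ₗ.∈-concatMap⁺ (λ p → List.map (g p) L₂) (Any.map (λ { refl → ∈ₗ.∈-map⁺ (g o₁) o₂∈ }) o₁∈)))) i i<))

-- A set listed later is never contained in an earlier one, so that pairings of grafted items are block triangular.
splits-order : ∀ {n} (xs : List (Fin n)) → Unique xs → AllPairs (λ (S , _) (T , _) → ¬ ⟦ T ⟧ ⊑ ⟦ S ⟧) (splits xs)
splits-order [] _ = [] ∷ []
splits-order (x ∷ xs) u@(_ ∷ u′) = AllPairsₚ.++⁺
  (AllPairsₚ.map⁺ (splits-order xs u′))
  (AllPairsₚ.map⁺ (AllPairs.map (λ {(S , _)} {(T , _)} T⋢S → extend T⋢S) (strengthen (splits xs) (λ p → p) (splits-order xs u′))))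
  (Allₚ.map⁺ (All.tabulate (λ {(S , _)} S∈ → Allₚ.map⁺ (All.tabulate (λ {(T , _)} T∈ ⊑S →
      a∉⟦⟧ u (∈-⟦⟧⁺ xs (proj₁ (proj₂ (splits-union xs S∈)) (∈-⟦⟧⁻ S (⊑S x (⟦∷⟧-here x T))))))))))
  where
  strengthen : ∀ ss → (∀ {s} → s ∈ₗ ss → s ∈ₗ splits xs) → AllPairs (λ (S , _) (T , _) → ¬ ⟦ T ⟧ ⊑ ⟦ S ⟧) ss →
               AllPairs (λ (S , _) (T , _) → ¬ ⟦ T ⟧ ⊑ ⟦ S ⟧ × x ∉ ⟦ T ⟧) ss
  strengthen [] _ [] = []
  strengthen (s ∷ ss) f (r ∷ ap) = All.tabulate (λ {(T , _)} t∈ → All.lookup r t∈ , λ x∈T →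
      a∉⟦⟧ u (∈-⟦⟧⁺ xs (proj₁ (proj₂ (splits-union xs (f (there t∈)))) (∈-⟦⟧⁻ T x∈T)))) ∷ strengthen ss (f ∘ there) ap
  extend : ∀ {S T} → ¬ ⟦ T ⟧ ⊑ ⟦ S ⟧ × x ∉ ⟦ T ⟧ → ¬ ⟦ x ∷ T ⟧ ⊑ ⟦ x ∷ S ⟧
  extend {S} {T} (T⋢S , x∉T) ⊑S = T⋢S λ y y∈ → [ (λ { refl → ⊥-elim (x∉T y∈) }) , id ]′ (⟦∷⟧⁻ x S (⊑S y (⟦∷⟧-there x T y y∈)))

indicator-yes : ∀ {P : Set} → P → (P? : Dec P) → indicator P? ≡ 1ℚ
indicator-yes p (yes _) = refl
indicator-yes p (no ¬p) = ⊥-elim (¬p p)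

map-all : ∀ {A : Set} {f : A → A} {xs : List A} → All (λ x → f x ≡ x) xs → List.map f xs ≡ xs
map-all []       = refl
map-all (e ∷ es) = cong₂ _∷_ e (map-all es)

module _ {n : ℕ} where

  top-[] : top {n} 0 [] ≡ 1ℚ
  top-[] = indicator-yes ((λ V → subst (_≤ ∣ V ∣ ∸ 2) (sym (count-[] V)) z≤n) , refl) (sparse? [] ×-dec (0 ℕ.≟ 0))

  ⊗-split : ∀ (F G : Functional {n}) Q q M₁ M₂ → All (_⊑ Q) M₁ → All (λ T → ¬ T ⊑ Q) M₂ →
            (F ⊗[ Q , q ] G) (M₁ ++ M₂) ≡ F M₁ * G (List.map (contract Q q) M₂)
  ⊗-split F G Q q M₁ M₂ a₁ a₂ = cong₂ (λ A B → F A * G (List.map (contract Q q) B))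
    (trans (Listₚ.filter-++ (_⊑? Q) M₁ M₂)
      (trans (cong₂ _++_ (Listₚ.filter-all (_⊑? Q) a₁) (Listₚ.filter-none (_⊑? Q) a₂)) (Listₚ.++-identityʳ M₁)))
    (trans (Listₚ.filter-++ (λ T → ¬? (T ⊑? Q)) M₁ M₂)
      (cong₂ _++_ (Listₚ.filter-none (λ T → ¬? (T ⊑? Q)) (All.map (λ p ¬p → ¬p p) a₁)) (Listₚ.filter-all (λ T → ¬? (T ⊑? Q)) a₂)))

  contract-blowUp : ∀ {a b : Fin n} {xs S R} → Split a (b ∷ xs) S R → Unique (a ∷ b ∷ xs) → ∀ {T} → T ⊑ ⟦ a ∷ R ⟧ × Big T →
    ¬ blowUp a ⟦ S ⟧ T ⊑ ⁅ a ⁆ ∪ ⟦ S ⟧ × contract (⁅ a ⁆ ∪ ⟦ S ⟧) a (blowUp a ⟦ S ⟧ T) ≡ T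
  contract-blowUp {a} {b} {xs} {S} {R} sp u {T} (T⊑ , bT) = (λ ⊑Q → out bT ⊑Q) , ⊑-antisym to from
    where
    open Split sp
    Q = ⁅ a ⁆ ∪ ⟦ S ⟧
    bl = blowUp a ⟦ S ⟧ T
    R∉Q : ∀ {x} → x ∈ ⟦ R ⟧ → x ∉ Q
    R∉Q {x} x∈R x∈Q = [ (λ z → a∉⟦⟧ u (subst (_∈ ⟦ b ∷ xs ⟧) (x∈⁅y⁆⇒x≡y a z) (R⊑ x x∈R))) , (λ z → disj x z x∈R) ]′ (x∈p∪q⁻ ⁅ a ⁆ ⟦ S ⟧ x∈Q)
    other : ∀ {x} → x ∈ T → x ≢ a → x ∈ ⟦ R ⟧
    other {x} x∈T x≢a = [ (λ x≡a → ⊥-elim (x≢a x≡a)) , id ]′ (⟦∷⟧⁻ a R (T⊑ x x∈T))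
    out : Big T → ¬ bl ⊑ Q
    out (c , d , c∈ , d∈ , c≢d) ⊑Q with c Fin.≟ a
    ... | no c≢a = R∉Q (other c∈ c≢a) (⊑Q c (∈-blowUp⁺ a ⟦ S ⟧ T (inj₁ (c∈ , c≢a))))
    ... | yes refl = R∉Q (other d∈ (c≢d ∘ sym)) (⊑Q d (∈-blowUp⁺ a ⟦ S ⟧ T (inj₁ (d∈ , c≢d ∘ sym))))
    a∉bl-only : ∀ {y} → y ∈ bl → y ∈ Q → a ∈ T
    a∉bl-only {y} y∈ y∈Q with ∈-blowUp⁻ a ⟦ S ⟧ T y∈
    ... | inj₁ (y∈T , y≢a) = ⊥-elim (R∉Q (other y∈T y≢a) y∈Q)
    ... | inj₂ (a∈T , _) = a∈T
    to : contract Q a bl ⊑ T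
    to x x∈ with ∈-contract⁻ Q a bl x∈
    ... | inj₂ (refl , y , y∈ , y∈Q) = a∉bl-only y∈ y∈Q
    ... | inj₁ (x∈bl , x∉Q) with ∈-blowUp⁻ a ⟦ S ⟧ T x∈bl
    ...   | inj₁ (x∈T , _) = x∈T
    ...   | inj₂ (_ , x∈S) = ⊥-elim (x∉Q (∪⁺ʳ ⁅ a ⁆ ⟦ S ⟧ x x∈S))
    from : T ⊑ contract Q a bl
    from x x∈T with x Fin.≟ a
    ... | no x≢a = ∈-contract⁺ Q a bl (inj₁ (∈-blowUp⁺ a ⟦ S ⟧ T (inj₁ (x∈T , x≢a)) , R∉Q (other x∈T x≢a)))
    ... | yes refl = ∈-contract⁺ Q a bl (inj₂ (refl , proj₁ bigS , S⊑blowUp a ⟦ S ⟧ x∈T _ (proj₁ (proj₂ (proj₂ bigS))) , ∪⁺ʳ ⁅ a ⁆ ⟦ S ⟧ _ (proj₁ (proj₂ (proj₂ bigS)))))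

  module _ {k : ℕ} {a b : Fin n} {xs : List (Fin n)} (u : Unique (a ∷ b ∷ xs)) where

    private
      X′ : Subset n
      X′ = ⟦ b ∷ xs ⟧

      a∉X′ : a ∉ X′
      a∉X′ = a∉⟦⟧ u

    S-lifts : ∀ {S R} → Split a (b ∷ xs) S R → ∀ {p} → p ∈ₗ basis k S → Lifts (proj₂ p) S a []
    S-lifts {S} sp p∈ = basis-lifts k S p∈ len2 uS a [] ([] ∷ [])
      (λ { x∈ (here refl) → a∉X′ (S⊑ a (∈-⟦⟧⁺ S x∈)) })
      where open Split sp

    ⟦⟧∪[] : ∀ (S : List (Fin n)) → ⟦ S ⟧ ∪ ⟦ [] ⟧ ≡ ⟦ S ⟧
    ⟦⟧∪[] S = ⊑-antisym (∪-lub (λ _ → id) (λ x x∈ → case ∈-⟦⟧⁻ [] x∈ of λ ())) (∪⁺ˡ ⟦ S ⟧ ⟦ [] ⟧)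

    -- The inner form has a added to S, so `Lifts.full` strips the letter a ∪ S, and on the outer
    -- letters contraction undoes the blow-up. For empty R the outer factor is `top 0 []`, which is
    -- one.
    graft-pairing : ∀ {S R} → Split a (b ∷ xs) S R → ∀ {o₁ o₂ p₁ p₂} →
      o₁ ∈ₗ basis k S → o₂ ∈ₗ basis k (a ∷ R) → p₁ ∈ₗ basis k S → p₂ ∈ₗ basis k (a ∷ R) →
      pairing (graft a S R o₁ o₂) (graft a S R p₁ p₂) ≡ pairing o₁ p₁ * pairing o₂ p₂
    graft-pairing {S} {[]} sp {o₁} {o₂} {p₁} {p₂} o₁∈ o₂∈ p₁∈ p₂∈ = single k o₂∈ p₂∈
      where
      open Split sp
      E = λ M → proj₂ o₁ List.[ a ] M
      value : E (⁅ a ⁆ ∪ ⟦ S ⟧ ∷ proj₁ p₁) ≡ pairing o₁ p₁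
      value = trans (cong (λ V → E (⁅ a ⁆ ∪ V ∷ proj₁ p₁)) (sym (⟦⟧∪[] S))) (Lifts.full (S-lifts sp o₁∈) (proj₁ p₁))
      single : ∀ k → o₂ ∈ₗ basis k (a ∷ []) → p₂ ∈ₗ basis k (a ∷ []) →
               pairing (graft a S [] o₁ o₂) (graft a S [] p₁ p₂) ≡ pairing o₁ p₁ * pairing o₂ p₂
      single (suc k) (here refl) (here refl) =
        trans (cong (λ M → E (⁅ a ⁆ ∪ ⟦ S ⟧ ∷ M)) (Listₚ.++-identityʳ (proj₁ p₁)))
          (trans value (sym (trans (cong (pairing o₁ p₁ *_) top-[]) (ℚₚ.*-identityʳ _))))
    graft-pairing {S} {r ∷ R} sp {o₁} {o₂} {p₁} {p₂} o₁∈ o₂∈ p₁∈ p₂∈ =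
      trans (⊗-split (proj₂ o₁ List.[ a ]) (proj₂ o₂ []) Q a (Q ∷ proj₁ p₁) (List.map (blowUp a ⟦ S ⟧) (proj₁ p₂))
              ((λ _ → id) ∷ All.map (λ (T⊑ , _) → ⊑-trans T⊑ (∪⁺ʳ ⁅ a ⁆ ⟦ S ⟧)) (basis-on k S uS p₁∈))
              (Allₚ.map⁺ (All.map (λ t → proj₁ (contract-blowUp sp u t)) on₂)))
        (cong₂ _*_
          (trans (cong (λ V → proj₂ o₁ List.[ a ] (⁅ a ⁆ ∪ V ∷ proj₁ p₁)) (sym (⟦⟧∪[] S))) (Lifts.full (S-lifts sp o₁∈) (proj₁ p₁)))
          (cong (proj₂ o₂ []) (trans (sym (Listₚ.map-∘ (proj₁ p₂))) (map-all (All.map (λ t → proj₂ (contract-blowUp sp u t)) on₂)))))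
      where
      open Split sp
      Q = ⁅ a ⁆ ∪ ⟦ S ⟧
      on₂ = basis-on k (a ∷ r ∷ R) uR p₂∈

    -- A functional grafted along S only sees the sets inside a ∪ S, and vanishes if none of them contains a.
    graft-vanishes : ∀ {S R} → Split a (b ∷ xs) S R → ∀ {o₁ o₂} → o₁ ∈ₗ basis k S → ∀ M →
      (∀ T → T ∈ₗ M → T ⊑ ⁅ a ⁆ ∪ ⟦ S ⟧ → a ∉ T) → (R ≡ [] → All (_⊑ X′) M) → graftF a S R (proj₂ o₁) o₂ [] M ≡ 0ℚ
    graft-vanishes {S} {[]} sp {o₁} o₁∈ M f g = Lifts.avoid (S-lifts sp o₁∈) M
      (All.map (λ T⊑ x x∈ → ∪⁺ˡ ⟦ S ⟧ ⟦ [] ⟧ x ([ id , (λ z → case ∈-⟦⟧⁻ [] z of λ ()) ]′ (cover x (T⊑ x x∈)))) (g refl))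
      where open Split sp
    graft-vanishes {S} {r ∷ R} sp {o₁} {o₂} o₁∈ M f g =
      trans (cong (_* o₂ [] (outs (proj₂ o₁ List.[ a ]) (o₂ []) Q a M)) (Lifts.avoid (S-lifts sp o₁∈) (filter (_⊑? Q) M) (All.tabulate inside-S))) (ℚₚ.*-zeroˡ (o₂ [] (outs (proj₂ o₁ List.[ a ]) (o₂ []) Q a M)))
      where
      Q = ⁅ a ⁆ ∪ ⟦ S ⟧
      inside-S : ∀ {T} → T ∈ₗ filter (_⊑? Q) M → T ⊑ ⟦ S ⟧ ∪ ⟦ [] ⟧
      inside-S {T} T∈ x x∈ with ∈ₗ.∈-filter⁻ (_⊑? Q) {xs = M} T∈
      ... | (T∈M , T⊑) = [ (λ z → ⊥-elim (f T T∈M T⊑ (subst (_∈ T) (x∈⁅y⁆⇒x≡y a z) x∈))) , ∪⁺ˡ ⟦ S ⟧ ⟦ [] ⟧ x ]′ (x∈p∪q⁻ ⁅ a ⁆ ⟦ S ⟧ (T⊑ x x∈))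

    on-tail : ∀ {M} → On X′ M → ∀ T → T ∈ₗ M → a ∉ T
    on-tail on T T∈ a∈T = a∉X′ (proj₁ (All.lookup on T∈) a a∈T)

    -- The only letter of the second word through a is a ∪ S′, and it does not lie inside a ∪ S. For
    -- empty R the set S is everything, which contradicts the hypothesis.
    graft-graft : ∀ {S R S′ R′} → Split a (b ∷ xs) S R → Split a (b ∷ xs) S′ R′ → ¬ ⟦ S′ ⟧ ⊑ ⟦ S ⟧ →
      ∀ {o₁ o₂ p₁ p₂} → o₁ ∈ₗ basis k S → p₁ ∈ₗ basis k S′ → p₂ ∈ₗ basis k (a ∷ R′) →
      pairing (graft a S R o₁ o₂) (graft a S′ R′ p₁ p₂) ≡ 0ℚ
    graft-graft {S} {R} {S′} {R′} sp sp′ S′⋢S {o₁} {o₂} {p₁} {p₂} o₁∈ p₁∈ p₂∈ = graft-vanishes sp {o₁} {proj₂ o₂} o₁∈ _ f g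
      where
      module sp = Split sp
      module sp′ = Split sp′
      on : On X′ (proj₁ p₁ ++ List.map (blowUp a ⟦ S′ ⟧) (proj₁ p₂))
      on = Allₚ.++⁺ (On-mono sp′.S⊑ (basis-on k S′ sp′.uS p₁∈)) (blowUp-on sp′ (basis-on k (a ∷ R′) sp′.uR p₂∈))
      f : ∀ T → T ∈ₗ graftW a S′ (proj₁ p₁) (proj₁ p₂) → T ⊑ ⁅ a ⁆ ∪ ⟦ S ⟧ → a ∉ T
      f T (there T∈) _ = on-tail on T T∈
      f T (here refl) T⊑ _ = S′⋢S λ x x∈ → [ (λ z → ⊥-elim (a∉X′ (subst (_∈ X′) (x∈⁅y⁆⇒x≡y a z) (sp′.S⊑ x x∈)))) , id ]′
                                             (x∈p∪q⁻ ⁅ a ⁆ ⟦ S ⟧ (T⊑ x (∪⁺ʳ ⁅ a ⁆ ⟦ S′ ⟧ x x∈)))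
      g : R ≡ [] → All (_⊑ X′) (graftW a S′ (proj₁ p₁) (proj₁ p₂))
      g refl = ⊥-elim (S′⋢S λ x x∈ → [ id , (λ z → case ∈-⟦⟧⁻ [] z of λ ()) ]′ (sp.cover x (sp′.S⊑ x x∈)))

    graft-lift : ∀ {S R} → Split a (b ∷ xs) S R → ∀ {o₁ o₂ p} → o₁ ∈ₗ basis k S → p ∈ₗ basis k (b ∷ xs) →
      pairing (graft a S R o₁ o₂) (lift b (b ∷ xs) p) ≡ 0ℚ
    graft-lift sp {o₁} {o₂} o₁∈ p∈ = graft-vanishes sp {o₁} {proj₂ o₂} o₁∈ _ (λ T T∈ _ → on-tail on T T∈) (λ _ → All.map proj₁ on)
      where on = basis-on k (b ∷ xs) (AllPairs.tail u) p∈

    lift-pairing : ∀ {o p} → p ∈ₗ basis k (b ∷ xs) → pairing (lift b (b ∷ xs) o) (lift b (b ∷ xs) p) ≡ pairing o p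
    lift-pairing {o} {p} p∈ =
      trans (cong (pairing (lift b (b ∷ xs) o)) (cong (_, proj₂ p) (sym (Listₚ.++-identityʳ (proj₁ p)))))
        (trans (⊗-split (proj₂ o []) (top 0) X′ b (proj₁ p) [] (All.map proj₁ (basis-on k (b ∷ xs) (AllPairs.tail u) p∈)) [])
          (trans (cong (pairing o p *_) top-[]) (ℚₚ.*-identityʳ _)))

  basis-independent : ∀ k (xs : List (Fin n)) → Unique xs → Independent (basis k xs)
  basis-independent zero xs u = independent-[]
  basis-independent (suc k) [] u = independent-[]
  basis-independent (suc k) (a ∷ []) u c z zero _ =
    trans (sym (trans (ℚₚ.+-identityʳ (c 0 * top 0 [])) (trans (cong (c 0 *_) top-[]) (ℚₚ.*-identityʳ (c 0))))) (z (here refl))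
  basis-independent (suc k) (a ∷ []) u c z (suc i) (s≤s ())
  basis-independent (suc k) (a ∷ b ∷ xs) u@(_ ∷ u′) = independent-++
    (independent-concatMap {R = λ (S , _) (T , _) → ¬ ⟦ T ⟧ ⊑ ⟦ S ⟧}
      (AllPairsₚ.filter⁺ (λ (S , _) → 2 ℕ.≤? length S) (splits-order (b ∷ xs) u′))
      (λ {(S , R)} SR∈ → let sp = split a (b ∷ xs) u SR∈ in
        independent-tensor {g = graft a S R} (basis-independent k S (Split.uS sp)) (basis-independent k (a ∷ R) (Split.uR sp))
          (λ {o₁} {o₂} {p₁} {p₂} → graft-pairing {k} u sp {o₁} {o₂} {p₁} {p₂}))
      (λ {(S , R)} {(S′ , R′)} SR∈ SR′∈ S′⋢S o∈ p∈ →
        let (o₁ , o₂ , o₁∈ , o₂∈ , eo) = tensor⁻ {g = graft a S R} {L₁ = basis k S} o∈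
            (p₁ , p₂ , p₁∈ , p₂∈ , ep) = tensor⁻ {g = graft a S′ R′} {L₁ = basis k S′} p∈
        in trans (cong₂ pairing eo ep)
             (graft-graft {k} u (split a (b ∷ xs) u SR∈) (split a (b ∷ xs) u SR′∈) S′⋢S {o₁} {o₂} {p₁} {p₂} o₁∈ p₁∈ p₂∈)))
    (independent-map (lift b (b ∷ xs)) (basis-independent k (b ∷ xs) u′) (λ {o} {p} _ p∈ → lift-pairing {k} u {o} {p} p∈))
    (λ o∈ p∈ →
      let ((S , R) , SR∈ , o∈′) = find (∈ₗ.∈-concatMap⁻ _ {xs = bigSplits (b ∷ xs)} o∈)
          (o₁ , o₂ , o₁∈ , o₂∈ , eo) = tensor⁻ {g = graft a S R} {L₁ = basis k S} o∈′
          (p′ , p′∈ , ep) = ∈ₗ.∈-map⁻ _ p∈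
      in trans (cong₂ pairing eo ep) (graft-lift {k} u (split a (b ∷ xs) u SR∈) {o₁} {o₂} {p′} o₁∈ p′∈))

-- Linear algebra over ℚ


dot : ∀ {l} → Vec ℚ l → Vec ℚ l → ℚ
dot Vec.[] Vec.[] = 0ℚ
dot (x Vec.∷ xs) (r Vec.∷ rs) = x * r + dot xs rs

dot-zeroˡ : ∀ {l} (x r : Vec ℚ l) → (∀ j → Vec.lookup x j ≡ 0ℚ) → dot x r ≡ 0ℚ
dot-zeroˡ Vec.[] Vec.[] _ = refl
dot-zeroˡ (x Vec.∷ xs) (r Vec.∷ rs) z =
  trans (cong₂ _+_ (trans (cong (_* r) (z Fin.zero)) (ℚₚ.*-zeroˡ r)) (dot-zeroˡ xs rs (z ∘ Fin.suc))) refl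

eliminate : ∀ {l} → ℚ → Vec ℚ l → Vec ℚ l → Vec ℚ l
eliminate t = Vec.zipWith (λ p q → q - t * p)

dot-eliminate : ∀ {l} t (x ps qs : Vec ℚ l) → dot x (eliminate t ps qs) ≡ dot x qs - t * dot x ps
dot-eliminate t Vec.[] Vec.[] Vec.[] = solve 1 (λ t → con 0ℚ := con 0ℚ :- t :* con 0ℚ) refl t
  where open +-*-Solver
dot-eliminate t (x Vec.∷ xs) (p Vec.∷ ps) (q Vec.∷ qs) =
  trans (cong (x * (q - t * p) +_) (dot-eliminate t xs ps qs))
    (solve 6 (λ x q t p a b → x :* (q :- t :* p) :+ (a :- t :* b) := (x :* q :+ a) :- t :* (x :* p :+ b)) refl x q t p (dot xs qs) (dot xs ps))
  where open +-*-Solver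

-- The two functions of some say that rows is a permutation of (p ∷ ps) ∷ rest.
data Pivot {l : ℕ} (rows : List (Vec ℚ (suc l))) : Set₁ where
  none : All (λ r → Vec.head r ≡ 0ℚ) rows → Pivot rows
  some : ∀ p ps rest → p ≢ 0ℚ → length rows ≡ suc (length rest) →
         ((P : Vec ℚ (suc l) → Set) → P (p Vec.∷ ps) → All P rest → All P rows) →
         ((P : Vec ℚ (suc l) → Set) → All P rows → P (p Vec.∷ ps) × All P rest) → Pivot rows

pivot : ∀ {l} (rows : List (Vec ℚ (suc l))) → Pivot rows
pivot [] = none []
pivot ((p Vec.∷ ps) ∷ rows) with p ℚₚ.≟ 0ℚ
... | no p≢0 = some p ps rows p≢0 refl (λ P → _∷_) (λ P → λ { (h ∷ t) → h , t })
... | yes p≡0 with pivot rows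
...   | none z = none (p≡0 ∷ z)
...   | some q qs rest q≢0 len to from = some q qs ((p Vec.∷ ps) ∷ rest) q≢0 (cong suc len)
          (λ { P h (h′ ∷ t) → h′ ∷ to P h t }) (λ { P (h ∷ t) → let (a , b) = from P t in a , h ∷ b })

inverse : (p : ℚ) → p ≢ 0ℚ → ∃ λ q → p * q ≡ 1ℚ
inverse p p≢0 = ℚ.1/_ p {{ℚ.≢-nonZero p≢0}} , ℚₚ.*-inverseʳ p {{ℚ.≢-nonZero p≢0}}

cancel-zero : ∀ {p x} → p ≢ 0ℚ → p * x ≡ 0ℚ → x ≡ 0ℚ
cancel-zero {p} {x} p≢0 e with inverse p p≢0
... | (q , pq) = trans (sym (ℚₚ.*-identityˡ x)) (trans (cong (_* x) (trans (sym pq) (ℚₚ.*-comm p q)))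
                   (trans (ℚₚ.*-assoc q p x) (trans (cong (q *_) e) (ℚₚ.*-zeroʳ q))))

Kernel : ∀ {l} → List (Vec ℚ l) → Vec ℚ l → Set
Kernel rows x = All (λ r → dot x r ≡ 0ℚ) rows

-- Elimination of the first column. The bound l ≤ length rows is returned together with the trivial
-- kernel, so that the dimension counts below need no separate notion of rank of a matrix.
gauss : ∀ l (rows : List (Vec ℚ l)) →
  (∃ λ x → Kernel rows x × ∃ λ j → Vec.lookup x j ≢ 0ℚ) ⊎ ((∀ x → Kernel rows x → ∀ j → Vec.lookup x j ≡ 0ℚ) × l ≤ length rows)
gauss zero rows = inj₂ ((λ _ _ ()) , z≤n)
gauss (suc l) rows with pivot rows
... | none z = inj₁ (1ℚ Vec.∷ Vec.replicate l 0ℚ , All.map (λ {r} → e₁ r) z , Fin.zero , λ ())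
  where
  e₁ : ∀ r → Vec.head r ≡ 0ℚ → dot (1ℚ Vec.∷ Vec.replicate l 0ℚ) r ≡ 0ℚ
  e₁ (r Vec.∷ rs) r≡0 = trans (cong₂ _+_ (trans (cong (1ℚ *_) r≡0) (ℚₚ.*-zeroʳ 1ℚ))
                                (dot-zeroˡ (Vec.replicate l 0ℚ) rs (λ j → Vecₚ.lookup-replicate j 0ℚ))) refl
... | some p ps rest p≢0 len to from with inverse p p≢0
...   | (p⁻¹ , pp⁻¹) with gauss l (List.map (λ r → eliminate (Vec.head r * p⁻¹) ps (Vec.tail r)) rest)
...     | inj₁ (y , ker , j , y≢0) =
            inj₁ (x₀ Vec.∷ y , to (λ r → dot (x₀ Vec.∷ y) r ≡ 0ℚ) e₀ (All.map (λ {r} → e₁ r) (Allₚ.map⁻ ker)) , Fin.suc j , y≢0)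
  where
  open +-*-Solver
  x₀ = - (dot y ps * p⁻¹)
  e₀ : x₀ * p + dot y ps ≡ 0ℚ
  e₀ = trans (solve 3 (λ d i p → :- (d :* i) :* p :+ d := d :* (con 1ℚ :- p :* i)) refl (dot y ps) p⁻¹ p)
         (trans (cong (λ z → dot y ps * (1ℚ - z)) pp⁻¹) (ℚₚ.*-zeroʳ (dot y ps)))
  e₁ : ∀ r → dot y (eliminate (Vec.head r * p⁻¹) ps (Vec.tail r)) ≡ 0ℚ → dot (x₀ Vec.∷ y) r ≡ 0ℚ
  e₁ (q Vec.∷ qs) e = trans (solve 4 (λ d i q b → :- (d :* i) :* q :+ b := b :- (q :* i) :* d) refl (dot y ps) p⁻¹ q (dot y qs))
                        (trans (sym (dot-eliminate (q * p⁻¹) y ps qs)) e)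
...     | inj₂ (triv , l≤) = inj₂ (only-zero , subst (suc l ≤_) (sym len) (s≤s (subst (l ≤_) (Listₚ.length-map _ rest) l≤)))
  where
  open +-*-Solver
  only-zero : ∀ x → Kernel rows x → ∀ j → Vec.lookup x j ≡ 0ℚ
  only-zero (x Vec.∷ xs) ker = zero-at
    where
    pr = from (λ r → dot (x Vec.∷ xs) r ≡ 0ℚ) ker
    e₁ : ∀ r → dot (x Vec.∷ xs) r ≡ 0ℚ → dot xs (eliminate (Vec.head r * p⁻¹) ps (Vec.tail r)) ≡ 0ℚ
    e₁ (q Vec.∷ qs) e = begin
      dot xs (eliminate (q * p⁻¹) ps qs)                    ≡⟨ dot-eliminate (q * p⁻¹) xs ps qs ⟩
      -- The solver treats p⁻¹ as an independent variable; the last term on the right compensates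
      -- until p * p⁻¹ = 1 is substituted.
      dot xs qs - (q * p⁻¹) * dot xs ps                 ≡⟨ solve 6 (λ a q i b x p → a :- (q :* i) :* b := (x :* q :+ a) :- (q :* i) :* (x :* p :+ b) :- x :* q :* (con 1ℚ :- p :* i)) refl (dot xs qs) q p⁻¹ (dot xs ps) x p ⟩
      (x * q + dot xs qs) - (q * p⁻¹) * (x * p + dot xs ps) - x * q * (1ℚ - p * p⁻¹)
        ≡⟨ cong₂ _-_ (cong₂ (λ u v → u - (q * p⁻¹) * v) e (proj₁ pr)) (cong (λ z → x * q * (1ℚ - z)) pp⁻¹) ⟩
      0ℚ - (q * p⁻¹) * 0ℚ - x * q * (1ℚ - 1ℚ) ≡⟨ solve 3 (λ q i x → con 0ℚ :- (q :* i) :* con 0ℚ :- x :* q :* con 0ℚ := con 0ℚ) refl q p⁻¹ x ⟩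
      0ℚ ∎
      where open ≡-Reasoning
    xs-zero : ∀ j → Vec.lookup xs j ≡ 0ℚ
    xs-zero = triv xs (Allₚ.map⁺ (All.map (λ {r} → e₁ r) (proj₂ pr)))
    zero-at : ∀ j → Vec.lookup (x Vec.∷ xs) j ≡ 0ℚ
    zero-at (Fin.suc j) = xs-zero j
    zero-at Fin.zero = cancel-zero p≢0 (trans (ℚₚ.*-comm p x)
      (trans (sym (ℚₚ.+-identityʳ (x * p))) (trans (cong (x * p +_) (sym (dot-zeroˡ xs ps xs-zero))) (proj₁ pr))))

module _ {m : ℕ} (L : List (Mono m)) where

  row : ∀ {r} → Vec (Poly m) r → Mono m → Vec ℚ r
  row bs μ = Vec.map (λ b → coeff b μ) bs

  dot-row : ∀ {r} (c : Vec ℚ r) (bs : Vec (Poly m) r) μ → dot c (row bs μ) ≡ combo c bs μ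
  dot-row Vec.[] Vec.[] μ = refl
  dot-row (c Vec.∷ cs) (b Vec.∷ bs) μ = cong (c * coeff b μ +_) (dot-row cs bs μ)

  IndependentOn : ∀ {r} → Vec (Poly m) r → Set
  IndependentOn bs = ∀ c → (∀ {μ} → μ ∈ₗ L → combo c bs μ ≡ 0ℚ) → ∀ k → Vec.lookup c k ≡ 0ℚ

  SpannedOn : ∀ {r} → Vec (Poly m) r → Poly m → Set
  SpannedOn {r} bs v = ∃ λ (c : Vec ℚ r) → ∀ {μ} → μ ∈ₗ L → coeff v μ ≡ combo c bs μ

  kernel-rows : ∀ {r} (bs : Vec (Poly m) r) c → Kernel (List.map (row bs) L) c → ∀ {μ} → μ ∈ₗ L → combo c bs μ ≡ 0ℚ
  kernel-rows bs c ker {μ} μ∈ = trans (sym (dot-row c bs μ)) (All.lookup (Allₚ.map⁻ ker) μ∈)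

  rows-kernel : ∀ {r} (bs : Vec (Poly m) r) c → (∀ {μ} → μ ∈ₗ L → combo c bs μ ≡ 0ℚ) → Kernel (List.map (row bs) L) c
  rows-kernel bs c z = Allₚ.map⁺ (All.tabulate λ {μ} μ∈ → trans (dot-row c bs μ) (z μ∈))

  independent-≤ : ∀ {r} (bs : Vec (Poly m) r) → IndependentOn bs → r ≤ length L
  independent-≤ {r} bs ind with gauss r (List.map (row bs) L)
  ... | inj₁ (c , ker , j , c≢0) = ⊥-elim (c≢0 (ind c (kernel-rows bs c ker) j))
  ... | inj₂ (_ , r≤) = subst (r ≤_) (Listₚ.length-map _ L) r≤

  combo-scale : ∀ {r} t (c : Vec ℚ r) (bs : Vec (Poly m) r) μ → combo (Vec.map (t *_) c) bs μ ≡ t * combo c bs μ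
  combo-scale t Vec.[] Vec.[] μ = sym (ℚₚ.*-zeroʳ t)
  combo-scale t (c Vec.∷ cs) (b Vec.∷ bs) μ = trans (cong₂ _+_ (ℚₚ.*-assoc t c (coeff b μ)) (combo-scale t cs bs μ))
    (sym (ℚₚ.*-distribˡ-+ t (c * coeff b μ) (combo cs bs μ)))

  -- A nontrivial relation must have a nonzero coefficient at v, as `bs` is independent, so it can
  -- be solved for v.
  extend : ∀ {r} (bs : Vec (Poly m) r) v → IndependentOn bs → IndependentOn (v Vec.∷ bs) ⊎ SpannedOn bs v
  extend {r} bs v ind with gauss (suc r) (List.map (row (v Vec.∷ bs)) L)
  ... | inj₂ (triv , _) = inj₁ λ c z → triv c (rows-kernel (v Vec.∷ bs) c z)
  ... | inj₁ (c Vec.∷ cs , ker , j , c≢0) with c ℚₚ.≟ 0ℚ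
  ...   | yes refl = ⊥-elim (c≢0 (all-zero j))
    where
    all-zero : ∀ j → Vec.lookup (c Vec.∷ cs) j ≡ 0ℚ
    all-zero Fin.zero = refl
    all-zero (Fin.suc j) = ind cs (λ {μ} μ∈ → trans (sym (trans (cong (_+ combo cs bs μ) (ℚₚ.*-zeroˡ (coeff v μ))) (ℚₚ.+-identityˡ _)))
                                               (kernel-rows (v Vec.∷ bs) (c Vec.∷ cs) ker μ∈)) j
  ...   | no c≢0′ with inverse c c≢0′
  ...     | (c⁻¹ , cc⁻¹) = inj₂ (Vec.map ((- c⁻¹) *_) cs , λ {μ} μ∈ →
              trans (express c c⁻¹ (coeff v μ) (combo cs bs μ) cc⁻¹ (kernel-rows (v Vec.∷ bs) (c Vec.∷ cs) ker μ∈)) (sym (combo-scale (- c⁻¹) cs bs μ)))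
    where
    express : ∀ c i v b → c * i ≡ 1ℚ → c * v + b ≡ 0ℚ → v ≡ (- i) * b
    express c i v b e z = begin
      v                                              ≡⟨ solve 4 (λ c i v b → v := v :* (con 1ℚ :- c :* i) :+ i :* (c :* v :+ b) :+ (:- i) :* b) refl c i v b ⟩
      v * (1ℚ - c * i) + i * (c * v + b) + (- i) * b ≡⟨ cong₂ (λ p q → v * (1ℚ - p) + i * q + (- i) * b) e z ⟩
      v * 0ℚ + i * 0ℚ + (- i) * b       ≡⟨ solve 3 (λ v i b → v :* con 0ℚ :+ i :* con 0ℚ :+ (:- i) :* b := (:- i) :* b) refl v i b ⟩
      (- i) * b                                  ∎
      where
      open ≡-Reasoning
      open +-*-Solver

  spanned-∷ : ∀ {r} (bs : Vec (Poly m) r) v w → SpannedOn bs w → SpannedOn (v Vec.∷ bs) w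
  spanned-∷ bs v w (c , e) = 0ℚ Vec.∷ c , λ {μ} μ∈ → trans (e μ∈) (sym (trans (cong (_+ _) (ℚₚ.*-zeroˡ (coeff v μ))) (ℚₚ.+-identityˡ _)))

  spanned-self : ∀ {r} (bs : Vec (Poly m) r) v → SpannedOn (v Vec.∷ bs) v
  spanned-self {r} bs v = 1ℚ Vec.∷ Vec.replicate r 0ℚ , λ {μ} _ → sym (trans (cong₂ _+_ (ℚₚ.*-identityˡ (coeff v μ)) (zeros bs μ)) (ℚₚ.+-identityʳ _))
    where
    zeros : ∀ {r} (bs : Vec (Poly m) r) μ → combo (Vec.replicate r 0ℚ) bs μ ≡ 0ℚ
    zeros Vec.[] μ = refl
    zeros (b Vec.∷ bs) μ = trans (cong₂ _+_ (ℚₚ.*-zeroˡ (coeff b μ)) (zeros bs μ)) refl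

  record BasisOf (gs : List (Poly m)) : Set where
    field
      {rank}  : ℕ
      elems   : Vec (Poly m) rank
      from    : ∀ k → Vec.lookup elems k ∈ₗ gs
      indep   : IndependentOn elems
      spans   : ∀ {v} → v ∈ₗ gs → SpannedOn elems v

  basisOf : ∀ gs → BasisOf gs
  basisOf [] = record { elems = Vec.[] ; from = λ () ; indep = λ _ _ () ; spans = λ () }
  basisOf (v ∷ gs) with basisOf gs
  ... | record { elems = bs ; from = from ; indep = ind ; spans = spans } with extend bs v ind
  ...   | inj₁ ind′ = record { elems = v Vec.∷ bs ; from = λ { Fin.zero → here refl ; (Fin.suc k) → there (from k) } ; indep = ind′
                             ; spans = λ { (here refl) → spanned-self bs v ; {w} (there w∈) → spanned-∷ bs v w (spans w∈) } }
  ...   | inj₂ sp = record { elems = bs ; from = there ∘ from ; indep = ind ; spans = λ { (here refl) → sp ; (there w∈) → spans w∈ } }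

-- From x_G to h_T and back


infixl 6 _⊞_

_⊞_ : ∀ {m} → Mono m → Mono m → Mono m
_⊞_ = Vec.zipWith ℕ._+_

⊞-comm : ∀ {m} (μ ν : Mono m) → μ ⊞ ν ≡ ν ⊞ μ
⊞-comm = Vecₚ.zipWith-comm ℕₚ.+-comm

⊞-assoc : ∀ {m} (μ ν ρ : Mono m) → (μ ⊞ ν) ⊞ ρ ≡ μ ⊞ (ν ⊞ ρ)
⊞-assoc = Vecₚ.zipWith-assoc ℕₚ.+-assoc

0ₘ : ∀ {m} → Mono m
0ₘ = Vec.replicate _ 0

⊞-identityˡ : ∀ {m} (μ : Mono m) → 0ₘ ⊞ μ ≡ μ
⊞-identityˡ = Vecₚ.zipWith-identityˡ ℕₚ.+-identityˡ

⊞-identityʳ : ∀ {m} (μ : Mono m) → μ ⊞ 0ₘ ≡ μ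
⊞-identityʳ = Vecₚ.zipWith-identityʳ ℕₚ.+-identityʳ

⊞-swap : ∀ {m} (μ ν ρ : Mono m) → (μ ⊞ ν) ⊞ ρ ≡ (μ ⊞ ρ) ⊞ ν
⊞-swap μ ν ρ = trans (⊞-assoc μ ν ρ) (trans (cong (μ ⊞_) (⊞-comm ν ρ)) (sym (⊞-assoc μ ρ ν)))

ev : ∀ {m} → (Mono m → ℚ) → Poly m → ℚ
ev φ []            = 0ℚ
ev φ ((q , ν) ∷ p) = q * φ ν + ev φ p

ev-cong : ∀ {m} {φ ψ : Mono m → ℚ} p → (∀ ν → φ ν ≡ ψ ν) → ev φ p ≡ ev ψ p
ev-cong [] e = refl
ev-cong ((q , ν) ∷ p) e = cong₂ (λ x y → q * x + y) (e ν) (ev-cong p e)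

ev-mulMono : ∀ {m} (φ : Mono m → ℚ) μ p → ev φ (mulMono μ p) ≡ ev (λ ν → φ (μ ⊞ ν)) p
ev-mulMono φ μ [] = refl
ev-mulMono φ μ ((q , ν) ∷ p) = cong (q * φ (μ ⊞ ν) +_) (ev-mulMono φ μ p)

ev-++ : ∀ {m} (φ : Mono m → ℚ) p p′ → ev φ (p ++ p′) ≡ ev φ p + ev φ p′
ev-++ φ [] p′ = sym (ℚₚ.+-identityˡ _)
ev-++ φ ((q , ν) ∷ p) p′ = trans (cong (q * φ ν +_) (ev-++ φ p p′)) (sym (ℚₚ.+-assoc (q * φ ν) (ev φ p) (ev φ p′)))

_⁰ _¹ : ∀ {n} → (Subset (suc n) → ℚ) → Subset n → ℚ
(g ⁰) V = g (outside Vec.∷ V)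
(g ¹) V = g (inside Vec.∷ V)

-- The sum over all supersets V of T, and its Möbius inverse, the sum with the signs (-1) ^ |V - T|,
-- both by recursion on the points.
up mob : ∀ {n} → Subset n → (Subset n → ℚ) → ℚ
up Vec.[] g = g Vec.[]
up (outside Vec.∷ T) g = up T (g ∘ (outside Vec.∷_)) + up T (g ∘ (inside Vec.∷_))
up (inside Vec.∷ T) g = up T (g ∘ (inside Vec.∷_))
mob Vec.[] g = g Vec.[]
mob (outside Vec.∷ T) g = mob T (g ∘ (outside Vec.∷_)) - mob T (g ∘ (inside Vec.∷_))
mob (inside Vec.∷ T) g = mob T (g ∘ (inside Vec.∷_))

∷-⊑ : ∀ {n s t} {T V : Subset n} → (s ≡ inside → t ≡ inside) → T ⊑ V → (s Vec.∷ T) ⊑ (t Vec.∷ V)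
∷-⊑ f T⊑V Fin.zero Vec.here with f refl
... | refl = Vec.here
∷-⊑ f T⊑V (Fin.suc x) (Vec.there x∈) = Vec.there (T⊑V x x∈)

∷-⊑⁻ : ∀ {n s t} {T V : Subset n} → (s Vec.∷ T) ⊑ (t Vec.∷ V) → T ⊑ V
∷-⊑⁻ f x x∈ with f (Fin.suc x) (Vec.there x∈)
... | Vec.there x∈V = x∈V

mob-cong : ∀ {n} (T : Subset n) {g h : Subset n → ℚ} → (∀ V → T ⊑ V → g V ≡ h V) → mob T g ≡ mob T h
mob-cong Vec.[] e = e Vec.[] (λ _ → id)
mob-cong (outside Vec.∷ T) e = cong₂ _-_ (mob-cong T (λ V T⊑ → e _ (∷-⊑ id T⊑))) (mob-cong T (λ V T⊑ → e _ (∷-⊑ (λ ()) T⊑)))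
mob-cong (inside Vec.∷ T) e = mob-cong T (λ V T⊑ → e _ (∷-⊑ id T⊑))

module _ where
  open +-*-Solver

  +-interchange : ∀ a b c d → (a + b) + (c + d) ≡ (a + c) + (b + d)
  +-interchange = solve 4 (λ a b c d → (a :+ b) :+ (c :+ d) := (a :+ c) :+ (b :+ d)) refl

  -‿interchange : ∀ a b c d → (a - b) - (c - d) ≡ (a - c) - (b - d)
  -‿interchange = solve 4 (λ a b c d → (a :- b) :- (c :- d) := (a :- c) :- (b :- d)) refl

  +-‿interchange : ∀ a b c d → (a + b) - (c + d) ≡ (a - c) + (b - d)
  +-‿interchange = solve 4 (λ a b c d → (a :+ b) :- (c :+ d) := (a :- c) :+ (b :- d)) refl

  minus-plus : ∀ a b → (a - b) + b ≡ a
  minus-plus = solve 2 (λ a b → (a :- b) :+ b := a) refl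

  plus-minus : ∀ a b → (a + b) - b ≡ a
  plus-minus = solve 2 (λ a b → (a :+ b) :- b := a) refl

  *-distribˡ-- : ∀ t a b → t * (a - b) ≡ t * a - t * b
  *-distribˡ-- = solve 3 (λ t a b → t :* (a :- b) := t :* a :- t :* b) refl

  from-difference : ∀ {a b} → a - b ≡ 0ℚ → a ≡ b
  from-difference {a} {b} e = trans (sym (minus-plus a b)) (trans (cong (_+ b) e) (ℚₚ.+-identityˡ b))

  to-difference : ∀ {a b} → a ≡ b → a - b ≡ 0ℚ
  to-difference {a} refl = ℚₚ.+-inverseʳ a

  quad-difference : ∀ {x y v c w u} → x + u ≡ v + w → y + u ≡ c + w → x - y ≡ v - c
  quad-difference {x} {y} {v} {c} {w} {u} e f = trans (solve 4 (λ x y v u → x :- y := (x :+ u) :- (y :+ u)) refl x y v u)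
    (trans (cong₂ _-_ e f) (solve 3 (λ v c w → (v :+ w) :- (c :+ w) := v :- c) refl v c w))

mob-zero : ∀ {n} (T : Subset n) {g} → (∀ V → T ⊑ V → g V ≡ 0ℚ) → mob T g ≡ 0ℚ
mob-zero T z = trans (mob-cong T z) (zero′ T)
  where
  zero′ : ∀ {n} (T : Subset n) → mob T (λ _ → 0ℚ) ≡ 0ℚ
  zero′ Vec.[] = refl
  zero′ (outside Vec.∷ T) = to-difference (trans (zero′ T) (sym (zero′ T)))
  zero′ (inside Vec.∷ T) = zero′ T

up-- : ∀ {n} (T : Subset n) g h → up T (λ V → g V - h V) ≡ up T g - up T h
up-- Vec.[] g h = refl
up-- (outside Vec.∷ T) g h = trans (cong₂ _+_ (up-- T (g ⁰) (h ⁰)) (up-- T (g ¹) (h ¹)))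
  (sym (+-‿interchange (up T (g ⁰)) (up T (g ¹)) (up T (h ⁰)) (up T (h ¹))))
up-- (inside Vec.∷ T) g h = up-- T (g ¹) (h ¹)

mob-- : ∀ {n} (T : Subset n) g h → mob T (λ V → g V - h V) ≡ mob T g - mob T h
mob-- Vec.[] g h = refl
mob-- (outside Vec.∷ T) g h = trans (cong₂ _-_ (mob-- T (g ⁰) (h ⁰)) (mob-- T (g ¹) (h ¹)))
  (-‿interchange (mob T (g ⁰)) (mob T (h ⁰)) (mob T (g ¹)) (mob T (h ¹)))
mob-- (inside Vec.∷ T) g h = mob-- T (g ¹) (h ¹)

mob-+ : ∀ {n} (T : Subset n) g h → mob T (λ V → g V + h V) ≡ mob T g + mob T h
mob-+ Vec.[] g h = refl
mob-+ (outside Vec.∷ T) g h = trans (cong₂ _-_ (mob-+ T (g ⁰) (h ⁰)) (mob-+ T (g ¹) (h ¹)))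
  (+-‿interchange (mob T (g ⁰)) (mob T (h ⁰)) (mob T (g ¹)) (mob T (h ¹)))
mob-+ (inside Vec.∷ T) g h = mob-+ T (g ¹) (h ¹)

mob-* : ∀ {n} (T : Subset n) t g → mob T (λ V → t * g V) ≡ t * mob T g
mob-* Vec.[] t g = refl
mob-* (outside Vec.∷ T) t g = trans (cong₂ _-_ (mob-* T t (g ⁰)) (mob-* T t (g ¹))) (sym (*-distribˡ-- t (mob T (g ⁰)) (mob T (g ¹))))
mob-* (inside Vec.∷ T) t g = mob-* T t (g ¹)

mob-sum : ∀ {n m} (T : Subset n) (f : Fin m → Subset n → ℚ) → mob T (λ V → sum (λ j → f j V)) ≡ sum (λ j → mob T (f j))
mob-sum {m = zero} T f = mob-zero T (λ _ _ → refl)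
mob-sum {m = suc m} T f = trans (mob-+ T (f Fin.zero) (λ V → sum (λ j → f (Fin.suc j) V))) (cong (mob T (f Fin.zero) +_) (mob-sum T (f ∘ Fin.suc)))

up-mob : ∀ {n} (T : Subset n) g → up T (λ V → mob V g) ≡ g T
up-mob Vec.[] g = refl
up-mob (outside Vec.∷ T) g = trans (cong₂ _+_
    (trans (up-- T (λ V → mob V (g ⁰)) (λ V → mob V (g ¹))) (cong₂ _-_ (up-mob T (g ⁰)) (up-mob T (g ¹)))) (up-mob T (g ¹)))
  (minus-plus (g (outside Vec.∷ T)) (g (inside Vec.∷ T)))
up-mob (inside Vec.∷ T) g = up-mob T (g ¹)

mob-comm : ∀ {n m} (S : Subset n) (T : Subset m) (F : Subset n → Subset m → ℚ) →
           mob S (λ V → mob T (λ W → F V W)) ≡ mob T (λ W → mob S (λ V → F V W))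
mob-comm Vec.[] T F = refl
mob-comm (outside Vec.∷ S) T F = trans
  (cong₂ _-_ (mob-comm S T (λ V → F (outside Vec.∷ V))) (mob-comm S T (λ V → F (inside Vec.∷ V))))
  (sym (mob-- T (λ W → mob S (λ V → F (outside Vec.∷ V) W)) (λ W → mob S (λ V → F (inside Vec.∷ V) W))))
mob-comm (inside Vec.∷ S) T F = mob-comm S T (λ V → F (inside Vec.∷ V))

∪⊥ : ∀ {n} (V : Subset n) → V ∪ ⊥ₛ ≡ V
∪⊥ V = Subsetₚ.∪-identityʳ V

-- The supersets of S without c and those with c occur with opposite signs and cancel in pairs.
mob-invariant : ∀ {n} (S : Subset n) c {g} → c ∉ S → (∀ V → S ⊑ V → g V ≡ g (V ∪ ⁅ c ⁆)) → mob S g ≡ 0ℚ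
mob-invariant (inside Vec.∷ S) Fin.zero c∉ e = ⊥-elim (c∉ Vec.here)
mob-invariant (outside Vec.∷ S) Fin.zero {g} c∉ e = to-difference (mob-cong S λ V S⊑ →
  trans (e (outside Vec.∷ V) (∷-⊑ id S⊑)) (cong (λ W → g (inside Vec.∷ W)) (∪⊥ V)))
mob-invariant (outside Vec.∷ S) (Fin.suc c) c∉ e = trans (cong₂ _-_ (mob-invariant S c (c∉ ∘ Vec.there) (λ V S⊑ → e _ (∷-⊑ id S⊑)))
  (mob-invariant S c (c∉ ∘ Vec.there) (λ V S⊑ → e _ (∷-⊑ (λ ()) S⊑)))) refl
mob-invariant (inside Vec.∷ S) (Fin.suc c) c∉ e = mob-invariant S c (c∉ ∘ Vec.there) (λ V S⊑ → e _ (∷-⊑ id S⊑))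

-- Since c ∈ T and d ∈ S, the unions of V, V ∪ c with W, W ∪ d all agree, so the second difference of F vanishes.
mob-crossing : ∀ {n} (S T : Subset n) (F : Subset n → Subset n → ℚ) → ¬ S ⊑ T → ¬ T ⊑ S →
  (∀ V W → S ⊑ V → T ⊑ W → F V W + F (V ∪ W) (V ∪ W) ≡ F V (V ∪ W) + F W (V ∪ W)) → mob S (λ V → mob T (λ W → F V W)) ≡ 0ℚ
mob-crossing S T F S⋢T T⋢S quad with ¬⊑⇒∃ S⋢T | ¬⊑⇒∃ T⋢S
... | (d , d∈S , d∉T) | (c , c∈T , c∉S) = mob-invariant S c c∉S λ V S⊑V → from-difference
    (trans (sym (mob-- T (F V) (F (V ∪ ⁅ c ⁆)))) (mob-invariant T d d∉T λ W T⊑W →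
      trans (diff V W S⊑V T⊑W) (sym (trans (diff V (W ∪ ⁅ d ⁆) S⊑V (⊑-trans T⊑W (∪⁺ˡ W ⁅ d ⁆)))
        (cong (λ U → F V U - F (V ∪ ⁅ c ⁆) U) (add-d V W S⊑V))))))
  where
  add-d : ∀ V W → S ⊑ V → V ∪ (W ∪ ⁅ d ⁆) ≡ V ∪ W
  add-d V W S⊑V = ⊑-antisym (∪-lub (∪⁺ˡ V W) (∪-lub (∪⁺ʳ V W) (⁅⁆⊑ (∪⁺ˡ V W d (S⊑V d d∈S)))))
                            (∪-lub (∪⁺ˡ V (W ∪ ⁅ d ⁆)) (⊑-trans (∪⁺ˡ W ⁅ d ⁆) (∪⁺ʳ V (W ∪ ⁅ d ⁆))))
  add-c : ∀ V W → T ⊑ W → (V ∪ ⁅ c ⁆) ∪ W ≡ V ∪ W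
  add-c V W T⊑W = ⊑-antisym (∪-lub (∪-lub (∪⁺ˡ V W) (⁅⁆⊑ (∪⁺ʳ V W c (T⊑W c c∈T)))) (∪⁺ʳ V W))
                            (∪-lub (⊑-trans (∪⁺ˡ V ⁅ c ⁆) (∪⁺ˡ (V ∪ ⁅ c ⁆) W)) (∪⁺ʳ (V ∪ ⁅ c ⁆) W))
  diff : ∀ V W → S ⊑ V → T ⊑ W → F V W - F (V ∪ ⁅ c ⁆) W ≡ F V (V ∪ W) - F (V ∪ ⁅ c ⁆) (V ∪ W)
  diff V W S⊑V T⊑W = quad-difference {F V W} {F (V ∪ ⁅ c ⁆) W} {F V (V ∪ W)} {F (V ∪ ⁅ c ⁆) (V ∪ W)} {F W (V ∪ W)} {F (V ∪ W) (V ∪ W)} (quad V W S⊑V T⊑W)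
    (subst (λ U → F (V ∪ ⁅ c ⁆) W + F U U ≡ F (V ∪ ⁅ c ⁆) U + F W U) (add-c V W T⊑W) (quad (V ∪ ⁅ c ⁆) W (⊑-trans S⊑V (∪⁺ˡ V ⁅ c ⁆)) T⊑W))

listSum : ∀ {A : Set} → (A → ℚ) → List A → ℚ
listSum f []       = 0ℚ
listSum f (x ∷ xs) = f x + listSum f xs

sum-lookup : ∀ {A : Set} (f : A → ℚ) xs → sum (λ j → f (List.lookup xs j)) ≡ listSum f xs
sum-lookup f [] = refl
sum-lookup f (x ∷ xs) = cong (f x +_) (sum-lookup f xs)

listSum-++ : ∀ {A : Set} (f : A → ℚ) xs ys → listSum f (xs ++ ys) ≡ listSum f xs + listSum f ys
listSum-++ f [] ys = sym (ℚₚ.+-identityˡ _)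
listSum-++ f (x ∷ xs) ys = trans (cong (f x +_) (listSum-++ f xs ys)) (sym (ℚₚ.+-assoc (f x) _ _))

listSum-concatMap : ∀ {A B : Set} (f : B → ℚ) (h : A → List B) xs → listSum f (concatMap h xs) ≡ listSum (λ x → listSum f (h x)) xs
listSum-concatMap f h [] = refl
listSum-concatMap f h (x ∷ xs) = trans (listSum-++ f (h x) (concatMap h xs)) (cong (listSum f (h x) +_) (listSum-concatMap f h xs))

listSum-cong : ∀ {A : Set} {f g : A → ℚ} xs → (∀ x → f x ≡ g x) → listSum f xs ≡ listSum g xs
listSum-cong [] e = refl
listSum-cong (x ∷ xs) e = cong₂ _+_ (e x) (listSum-cong xs e)

listSum-+ : ∀ {A : Set} (f g : A → ℚ) xs → listSum (λ x → f x + g x) xs ≡ listSum f xs + listSum g xs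
listSum-+ f g [] = refl
listSum-+ f g (x ∷ xs) = trans (cong (f x + g x +_) (listSum-+ f g xs)) (+-interchange (f x) (g x) _ _)

listSum-filter : ∀ {A : Set} {P : A → Set} (P? : Decidable P) (f : A → ℚ) xs → (∀ x → ¬ P x → f x ≡ 0ℚ) → listSum f (filter P? xs) ≡ listSum f xs
listSum-filter P? f [] z = refl
listSum-filter P? f (x ∷ xs) z with P? x
... | yes p = cong (f x +_) (listSum-filter P? f xs z)
... | no ¬p = trans (listSum-filter P? f xs z) (sym (trans (cong (_+ listSum f xs) (z x ¬p)) (ℚₚ.+-identityˡ _)))

listSum-subsets : ∀ {n} (T : Subset n) g → listSum (λ V → indicator (T ⊑? V) * g V) (subsets n) ≡ up T g
listSum-subsets Vec.[] g = trans (ℚₚ.+-identityʳ _) (trans (cong (_* g Vec.[]) (indicator-yes (λ _ → id) (Vec.[] ⊑? Vec.[]))) (ℚₚ.*-identityˡ _))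
listSum-subsets {suc n} (t Vec.∷ T) g = trans (listSum-concatMap _ _ (subsets n))
  (trans (listSum-cong (subsets n) (λ V → cong (λ z → H outside V + z) (ℚₚ.+-identityʳ (H inside V))))
    (trans (listSum-+ (H outside) (H inside) (subsets n)) (finish t refl)))
  where
  H : Bool → Subset n → ℚ
  H s V = indicator ((t Vec.∷ T) ⊑? (s Vec.∷ V)) * g (s Vec.∷ V)
  same : ∀ s → (t ≡ inside → s ≡ inside) → listSum (H s) (subsets n) ≡ up T (g ∘ (s Vec.∷_))
  same s f = trans (listSum-cong (subsets n) (λ V → cong (_* g (s Vec.∷ V)) (indicator-cong ∷-⊑⁻ (∷-⊑ f) ((t Vec.∷ T) ⊑? (s Vec.∷ V)) (T ⊑? V))))
               (listSum-subsets T (g ∘ (s Vec.∷_)))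
  vanish : ∀ {m} (xs : List (Subset m)) → listSum (λ _ → 0ℚ) xs ≡ 0ℚ
  vanish [] = refl
  vanish (x ∷ xs) = trans (ℚₚ.+-identityˡ _) (vanish xs)
  finish : ∀ s → s ≡ t → listSum (H outside) (subsets n) + listSum (H inside) (subsets n) ≡ up (s Vec.∷ T) g
  finish outside refl = cong₂ _+_ (same outside id) (same inside (λ ()))
  finish inside refl = trans (cong₂ _+_ (trans (listSum-cong (subsets n) (λ V → trans (cong (_* g (outside Vec.∷ V))
      (indicator-no (λ f → absurd (f Fin.zero Vec.here)) ((t Vec.∷ T) ⊑? (outside Vec.∷ V)))) (ℚₚ.*-zeroˡ (g (outside Vec.∷ V))))) (vanish (subsets n)))
      (same inside id)) (ℚₚ.+-identityˡ _)
    where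
    absurd : ∀ {V : Subset n} → ¬ Fin.zero ∈ (outside Vec.∷ V)
    absurd ()

big⇒2≤ : ∀ {n} {T : Subset n} → Big T → 2 ≤ ∣ T ∣
big⇒2≤ {T = T} (a , b , a∈ , b∈ , a≢b) = ℕₚ.≤-trans (∣⟦⟧∣≥ (a ∷ b ∷ []) ((a≢b ∷ []) ∷ [] ∷ []))
  (⊑⇒∣∣≤ λ x x∈ → case ∈-⟦⟧⁻ (a ∷ b ∷ []) x∈ of λ { (here refl) → a∈ ; (there (here refl)) → b∈ })

-- Every superset of a set with two points belongs to the building set, so restricting the sum to
-- the building set loses no term.
sum-building : ∀ {n} (T : Subset n) g → Big T → sum (λ j → indicator (T ⊑? G n j) * g (G n j)) ≡ up T g
sum-building {n} T g bT = trans (sum-lookup (λ V → indicator (T ⊑? V) * g V) (building n))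
  (trans (listSum-filter (λ s → 2 ℕ.≤? ∣ s ∣) _ (subsets n) (λ V ¬2≤ → trans (cong (_* g V)
      (indicator-no (λ T⊑V → ¬2≤ (big⇒2≤ (Big-mono T⊑V bT))) (T ⊑? V))) (ℚₚ.*-zeroˡ (g V))))
    (listSum-subsets T g))

*-swap : ∀ x y z → x * (y * z) ≡ y * (x * z)
*-swap = solve 3 (λ x y z → x :* (y :* z) := y :* (x :* z)) refl
  where open +-*-Solver

sum-zero : ∀ {m} (f : Fin m → ℚ) → (∀ j → f j ≡ 0ℚ) → sum f ≡ 0ℚ
sum-zero {m} f z = trans (sum-cong-≗ z) (sum-replicate-zero m)

sum-δ : ∀ {m} (f : Fin m → ℚ) j → (∀ i → i ≢ j → f i ≡ 0ℚ) → sum f ≡ f j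
sum-δ f Fin.zero z = trans (cong (f Fin.zero +_) (sum-zero (f ∘ Fin.suc) (λ i → z (Fin.suc i) (λ ())))) (ℚₚ.+-identityʳ _)
sum-δ f (Fin.suc j) z = trans (cong (_+ sum (f ∘ Fin.suc)) (z Fin.zero (λ ())))
  (trans (ℚₚ.+-identityˡ _) (sum-δ (f ∘ Fin.suc) j (λ i i≢j → z (Fin.suc i) (λ e → i≢j (Finₚ.suc-injective e)))))

sqfree-⁅⁆ : ∀ {m} (j : Fin m) → sqfree ⁅ j ⁆ ≡ var j
sqfree-⁅⁆ {suc m} Fin.zero = cong (1 Vec.∷_) (sqfree-⊥ m)
  where
  sqfree-⊥ : ∀ m → sqfree (⊥ₛ {m}) ≡ Vec.replicate m 0
  sqfree-⊥ zero = refl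
  sqfree-⊥ (suc m) = cong (0 Vec.∷_) (sqfree-⊥ m)
sqfree-⁅⁆ (Fin.suc j) = cong (0 Vec.∷_) (sqfree-⁅⁆ j)

sqfree-pair : ∀ {m} (i j : Fin m) → i ≢ j → sqfree (⁅ i ⁆ ∪ ⁅ j ⁆) ≡ var i ⊞ var j
sqfree-pair Fin.zero Fin.zero i≢j = ⊥-elim (i≢j refl)
sqfree-pair Fin.zero (Fin.suc j) _ = cong (1 Vec.∷_) (trans (cong sqfree (Subsetₚ.∪-identityˡ ⁅ j ⁆)) (trans (sqfree-⁅⁆ j) (sym (⊞-identityˡ (var j)))))
sqfree-pair (Fin.suc i) Fin.zero _ = cong (1 Vec.∷_) (trans (cong sqfree (Subsetₚ.∪-identityʳ ⁅ i ⁆)) (trans (sqfree-⁅⁆ i) (sym (⊞-identityʳ (var i)))))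
sqfree-pair (Fin.suc i) (Fin.suc j) i≢j = cong (0 Vec.∷_) (sqfree-pair i j (i≢j ∘ cong Fin.suc))

sqfree-∈ : ∀ {m} {S : Subset m} {j} → j ∈ S → Vec.lookup (sqfree S) j ≡ 1
sqfree-∈ Vec.here = refl
sqfree-∈ (Vec.there j∈) = sqfree-∈ j∈

extract-var : ∀ {m} (ν : Mono m) j {e} → Vec.lookup ν j ≡ suc e → ∃ λ ν′ → ν ≡ ν′ ⊞ var j × (∀ i → i ≢ j → Vec.lookup ν′ i ≡ Vec.lookup ν i)
extract-var (x Vec.∷ ν) Fin.zero {e} refl = e Vec.∷ ν , cong₂ Vec._∷_ (sym (ℕₚ.+-comm e 1)) (sym (⊞-identityʳ ν))
  , λ { Fin.zero z → ⊥-elim (z refl) ; (Fin.suc i) _ → refl }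
extract-var (x Vec.∷ ν) (Fin.suc j) eq with extract-var ν j eq
... | (ν′ , e , f) = x Vec.∷ ν′ , cong₂ Vec._∷_ (sym (ℕₚ.+-identityʳ x)) e
  , λ { Fin.zero _ → refl ; (Fin.suc i) z → f i (λ e → z (cong Fin.suc e)) }

module Link (n : ℕ) where

  ind⊑ : Subset n → Fin (N n) → ℚ
  ind⊑ T j = indicator (T ⊑? G n j)

  XValid : (Mono (N n) → ℚ) → Set
  XValid φ = ∀ {g d} → FYGen n g d → ∀ μ → ev φ (mulMono μ g) ≡ 0ℚ

  infixr 5 _▹_ _▸_

  -- `_▹_` and `_▸_` are the transposes of multiplication by one variable x_G and by h_T. With them
  -- `hat φ` evaluates φ on monomials in the h_T.
  _▹_ : Fin (N n) → (Mono (N n) → ℚ) → Mono (N n) → ℚ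
  (j ▹ φ) μ = φ (μ ⊞ var j)

  _▸_ : Subset n → (Mono (N n) → ℚ) → Mono (N n) → ℚ
  (T ▸ φ) μ = sum (λ j → ind⊑ T j * φ (μ ⊞ var j))

  hat : (Mono (N n) → ℚ) → Functional {n}
  hat φ []      = φ 0ₘ
  hat φ (T ∷ M) = hat (T ▸ φ) M

  ▸-cong : ∀ T {φ ψ} → (∀ μ → φ μ ≡ ψ μ) → ∀ μ → (T ▸ φ) μ ≡ (T ▸ ψ) μ
  ▸-cong T e μ = sum-cong-≗ (λ j → cong (ind⊑ T j *_) (e (μ ⊞ var j)))

  hat-cong : ∀ M {φ ψ} → (∀ μ → φ μ ≡ ψ μ) → hat φ M ≡ hat ψ M
  hat-cong [] e = e 0ₘ
  hat-cong (T ∷ M) e = hat-cong M (▸-cong T e)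

  hat-+ : ∀ M φ ψ → hat (λ μ → φ μ + ψ μ) M ≡ hat φ M + hat ψ M
  hat-+ [] φ ψ = refl
  hat-+ (T ∷ M) φ ψ = trans (hat-cong M λ μ → trans (sum-cong-≗ (λ j → ℚₚ.*-distribˡ-+ (ind⊑ T j) (φ (μ ⊞ var j)) (ψ (μ ⊞ var j))))
      (∑-distrib-+ (λ j → ind⊑ T j * φ (μ ⊞ var j)) (λ j → ind⊑ T j * ψ (μ ⊞ var j)))) (hat-+ M (T ▸ φ) (T ▸ ψ))

  hat-sum : ∀ M {m} (c : Fin m → ℚ) (φ : Fin m → Mono (N n) → ℚ) →
            hat (λ μ → sum (λ j → c j * φ j μ)) M ≡ sum (λ j → c j * hat (φ j) M)
  hat-sum [] c φ = refl
  hat-sum (T ∷ M) {m} c φ = trans (hat-cong M (λ μ → trans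
      (sum-cong-≗ (λ i → trans (*-distribˡ-sum (ind⊑ T i) (λ j → c j * φ j (μ ⊞ var i))) (sum-cong-≗ (λ j → *-swap (ind⊑ T i) (c j) (φ j (μ ⊞ var i))))))
      (trans (∑-comm (λ i j → c j * (ind⊑ T i * φ j (μ ⊞ var i))))
        (sum-cong-≗ (λ j → sym (*-distribˡ-sum (c j) (λ i → ind⊑ T i * φ j (μ ⊞ var i))))))))
    (hat-sum M c (λ j → T ▸ φ j))

  hat-∷ : ∀ φ T M → hat φ (T ∷ M) ≡ sum (λ j → ind⊑ T j * hat (j ▹ φ) M)
  hat-∷ φ T M = hat-sum M (ind⊑ T) (λ j → j ▹ φ)

  hat-zero : ∀ M {φ} → (∀ μ → φ μ ≡ 0ℚ) → hat φ M ≡ 0ℚ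
  hat-zero [] z = z 0ₘ
  hat-zero (T ∷ M) z = hat-zero M (λ μ → sum-zero _ (λ j → trans (cong (ind⊑ T j *_) (z _)) (ℚₚ.*-zeroʳ (ind⊑ T j))))

  ▸▸ : ∀ S T φ μ → (T ▸ S ▸ φ) μ ≡ sum (λ j → sum (λ i → ind⊑ T j * (ind⊑ S i * φ ((μ ⊞ var j) ⊞ var i))))
  ▸▸ S T φ μ = sum-cong-≗ (λ j → *-distribˡ-sum (ind⊑ T j) (λ i → ind⊑ S i * φ ((μ ⊞ var j) ⊞ var i)))

  ▸-comm : ∀ S T φ μ → (T ▸ S ▸ φ) μ ≡ (S ▸ T ▸ φ) μ
  ▸-comm S T φ μ = trans (▸▸ S T φ μ) (trans (∑-comm (λ j i → ind⊑ T j * (ind⊑ S i * φ ((μ ⊞ var j) ⊞ var i)))) (trans (sum-cong-≗ (λ i → sum-cong-≗ (λ j →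
    trans (*-swap (ind⊑ T j) (ind⊑ S i) _) (cong (λ ν → ind⊑ S i * (ind⊑ T j * φ ν)) (⊞-swap μ (var j) (var i)))))) (sym (▸▸ T S φ μ))))

  hat-perm : ∀ {M M′} → M ↭ M′ → ∀ φ → hat φ M ≡ hat φ M′
  hat-perm Perm.refl φ = refl
  hat-perm (prep T p) φ = hat-perm p (T ▸ φ)
  hat-perm (swap {xs = xs} S T p) φ = trans (hat-cong xs (▸-comm S T φ)) (hat-perm p (S ▸ T ▸ φ))
  hat-perm (Perm.trans p q) φ = trans (hat-perm p φ) (hat-perm q φ)

  ev-filter : ∀ φ μ {P : Fin (N n) → Set} (P? : Decidable P) js →
    ev φ (mulMono μ (List.map (λ j → (1ℚ , var j)) (filter P? js))) ≡ listSum (λ j → indicator (P? j) * φ (μ ⊞ var j)) js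
  ev-filter φ μ P? [] = refl
  ev-filter φ μ P? (j ∷ js) with P? j
  ... | yes _ = cong (1ℚ * φ (μ ⊞ var j) +_) (ev-filter φ μ P? js)
  ... | no _  = trans (ev-filter φ μ P? js) (sym (trans (cong (_+ rest) (ℚₚ.*-zeroˡ (φ (μ ⊞ var j)))) (ℚₚ.+-identityˡ rest)))
    where rest = listSum (λ j → indicator (P? j) * φ (μ ⊞ var j)) js

  linGen-ev : ∀ φ a b μ → ev φ (mulMono μ (linGen n a b)) ≡ ((⁅ a ⁆ ∪ ⁅ b ⁆) ▸ φ) μ
  linGen-ev φ a b μ = trans (linGen-list (List.allFin (N n))) (listSum-allFin (λ j → ind⊑ (⁅ a ⁆ ∪ ⁅ b ⁆) j * φ (μ ⊞ var j)))
    where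
    P? : ∀ j → Dec (a ∈ G n j × b ∈ G n j)
    P? j = (a ∈? G n j) ×-dec (b ∈? G n j)
    linGen-list : ∀ js → ev φ (mulMono μ (List.map (λ j → (1ℚ , var j)) (filter P? js))) ≡ listSum (λ j → ind⊑ (⁅ a ⁆ ∪ ⁅ b ⁆) j * φ (μ ⊞ var j)) js
    linGen-list js = trans (ev-filter φ μ P? js) (listSum-cong js (λ j → cong (_* φ (μ ⊞ var j)) (indicator-cong (λ (a∈ , b∈) → pair⊑ a∈ b∈)
      (λ ab⊑ → ab⊑ a (∪⁺ˡ ⁅ a ⁆ ⁅ b ⁆ a (x∈⁅x⁆ a)) , ab⊑ b (∪⁺ʳ ⁅ a ⁆ ⁅ b ⁆ b (x∈⁅x⁆ b))) (P? j) ((⁅ a ⁆ ∪ ⁅ b ⁆) ⊑? G n j))))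
    listSum-allFin : ∀ {m} (f : Fin m → ℚ) → listSum f (List.allFin m) ≡ sum f
    listSum-allFin {m} f = tab m f id
      where
      tab : ∀ m {A : Set} (f : A → ℚ) (g : Fin m → A) → listSum f (List.tabulate g) ≡ sum (f ∘ g)
      tab zero f g = refl
      tab (suc m) f g = cong (f (g Fin.zero) +_) (tab m f (g ∘ Fin.suc))

  atom-zero : ∀ {φ} → XValid φ → ∀ a b → a ≢ b → ∀ μ → ((⁅ a ⁆ ∪ ⁅ b ⁆) ▸ φ) μ ≡ 0ℚ
  atom-zero {φ} v a b a≢b μ = trans (sym (linGen-ev φ a b μ)) (v (atom a b a≢b) μ)

  crossing-zero : ∀ {φ} → XValid φ → ∀ j i μ → ¬ G n j ⊑ G n i → ¬ G n i ⊑ G n j → Meets (G n j) (G n i) → φ ((μ ⊞ var j) ⊞ var i) ≡ 0ℚ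
  crossing-zero {φ} v j i μ j⋢i i⋢j (x , x∈j , x∈i) =
    trans (cong φ (trans (⊞-assoc μ (var j) (var i)) (cong (μ ⊞_) (sym (sqfree-pair j i (λ { refl → j⋢i (λ _ → id) }))))))
      (trans (sym (trans (ℚₚ.+-identityʳ _) (ℚₚ.*-identityˡ _)))
        (v (nonNested (⁅ j ⁆ ∪ ⁅ i ⁆) (j , i , x∈p∪q⁺ (inj₁ (x∈⁅x⁆ j)) , x∈p∪q⁺ (inj₂ (x∈⁅x⁆ i)) , (λ s → j⋢i (λ _ → s)) , (λ s → i⋢j (λ _ → s)) , x , x∈j , x∈i)) μ))

  ind-∪ : ∀ S T j → ind⊑ (S ∪ T) j ≡ ind⊑ S j * ind⊑ T j
  ind-∪ S T j = go (S ⊑? G n j) (T ⊑? G n j)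
    where
    go : (s : Dec (S ⊑ G n j)) (t : Dec (T ⊑ G n j)) → ind⊑ (S ∪ T) j ≡ indicator s * indicator t
    go (yes s) (yes t) = trans (indicator-yes (∪-lub s t) ((S ∪ T) ⊑? G n j)) (sym (ℚₚ.*-identityˡ 1ℚ))
    go (yes s) (no ¬t) = trans (indicator-no (λ u → ¬t (⊑-trans (∪⁺ʳ S T) u)) ((S ∪ T) ⊑? G n j)) (sym (ℚₚ.*-identityˡ 0ℚ))
    go (no ¬s) t = trans (indicator-no (λ u → ¬s (⊑-trans (∪⁺ˡ S T) u)) ((S ∪ T) ⊑? G n j)) (sym (ℚₚ.*-zeroˡ (indicator t)))

  -- With s and t for the indicators, left minus right is t_j s_i (1 - s_j)(1 - t_i) k, a term of
  -- (h_T - h_U)(h_S - h_U). Where it survives, G_j contains T but not S and G_i contains S but not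
  -- T; they are incomparable and meet, so their product lies in the ideal.
  quad-term : ∀ {A B C D : Set} (sj : Dec A) (tj : Dec B) (si : Dec C) (ti : Dec D) k →
    (B → C → ¬ A → ¬ D → k ≡ 0ℚ) →
    indicator tj * (indicator si * k) + (indicator sj * indicator tj) * ((indicator si * indicator ti) * k)
    ≡ (indicator sj * indicator tj) * (indicator si * k) + (indicator si * indicator ti) * (indicator tj * k)
  quad-term (yes _) tj si ti k _ = solve 4 (λ t s u k → t :* (s :* k) :+ (con 1ℚ :* t) :* ((s :* u) :* k) := (con 1ℚ :* t) :* (s :* k) :+ (s :* u) :* (t :* k)) refl
      (indicator tj) (indicator si) (indicator ti) k
    where open +-*-Solver
  quad-term (no _) tj si (yes _) k _ = solve 3 (λ t s k → t :* (s :* k) :+ (con 0ℚ :* t) :* ((s :* con 1ℚ) :* k) := (con 0ℚ :* t) :* (s :* k) :+ (s :* con 1ℚ) :* (t :* k)) refl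
      (indicator tj) (indicator si) k
    where open +-*-Solver
  quad-term (no _) (no _) si (no _) k _ = solve 2 (λ s k → con 0ℚ :* (s :* k) :+ (con 0ℚ :* con 0ℚ) :* ((s :* con 0ℚ) :* k) := (con 0ℚ :* con 0ℚ) :* (s :* k) :+ (s :* con 0ℚ) :* (con 0ℚ :* k)) refl
      (indicator si) k
    where open +-*-Solver
  quad-term (no _) (yes _) (no _) (no _) k _ = solve 1 (λ k → con 1ℚ :* (con 0ℚ :* k) :+ (con 0ℚ :* con 1ℚ) :* ((con 0ℚ :* con 0ℚ) :* k) := (con 0ℚ :* con 1ℚ) :* (con 0ℚ :* k) :+ (con 0ℚ :* con 0ℚ) :* (con 1ℚ :* k)) refl k
    where open +-*-Solver
  quad-term (no ¬a) (yes b) (yes c) (no ¬d) k z rewrite z b c ¬a ¬d = refl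

  hat-quad : ∀ {φ} → XValid φ → ∀ S T M → Meets S T →
    hat φ (S ∷ T ∷ M) + hat φ (S ∪ T ∷ S ∪ T ∷ M) ≡ hat φ (S ∷ S ∪ T ∷ M) + hat φ (T ∷ S ∪ T ∷ M)
  hat-quad {φ} v S T M (x , x∈S , x∈T) =
    trans (sym (hat-+ M (T ▸ S ▸ φ) (U ▸ U ▸ φ))) (trans (hat-cong M pointwise) (hat-+ M (U ▸ S ▸ φ) (U ▸ T ▸ φ)))
    where
    U = S ∪ T
    k : Mono (N n) → Fin (N n) → Fin (N n) → ℚ
    k μ j i = φ ((μ ⊞ var j) ⊞ var i)
    double-+ : ∀ {m} (f g : Fin m → Fin m → ℚ) → sum (λ j → sum (f j)) + sum (λ j → sum (g j)) ≡ sum (λ j → sum (λ i → f j i + g j i))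
    double-+ f g = trans (sym (∑-distrib-+ (λ j → sum (f j)) (λ j → sum (g j)))) (sum-cong-≗ (λ j → sym (∑-distrib-+ (f j) (g j))))
    -- The two summation indices change places in this one product, so that the four double sums can
    -- be compared term by term.
    swapped : ∀ μ → (U ▸ T ▸ φ) μ ≡ sum (λ j → sum (λ i → ind⊑ U i * (ind⊑ T j * k μ j i)))
    swapped μ = trans (▸▸ T U φ μ) (trans (∑-comm (λ j i → ind⊑ U j * (ind⊑ T i * k μ j i))) (sum-cong-≗ (λ i → sum-cong-≗ (λ j → cong (λ ν → ind⊑ U j * (ind⊑ T i * φ ν)) (⊞-swap μ (var j) (var i))))))
    termwise : ∀ μ j i → ind⊑ T j * (ind⊑ S i * k μ j i) + ind⊑ U j * (ind⊑ U i * k μ j i)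
                     ≡ ind⊑ U j * (ind⊑ S i * k μ j i) + ind⊑ U i * (ind⊑ T j * k μ j i)
    termwise μ j i rewrite ind-∪ S T j | ind-∪ S T i = quad-term (S ⊑? G n j) (T ⊑? G n j) (S ⊑? G n i) (T ⊑? G n i) (k μ j i)
      λ t⊑j s⊑i ¬s⊑j ¬t⊑i → crossing-zero v j i μ (λ j⊑i → ¬t⊑i (⊑-trans t⊑j j⊑i)) (λ i⊑j → ¬s⊑j (⊑-trans s⊑i i⊑j)) (x , t⊑j x x∈T , s⊑i x x∈S)
    _·_ : Subset n → Subset n → Mono (N n) → Fin (N n) → Fin (N n) → ℚ
    (A · B) μ j i = ind⊑ A j * (ind⊑ B i * k μ j i)
    pointwise : ∀ μ → (T ▸ S ▸ φ) μ + (U ▸ U ▸ φ) μ ≡ (U ▸ S ▸ φ) μ + (U ▸ T ▸ φ) μ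
    pointwise μ = trans (cong₂ _+_ (▸▸ S T φ μ) (▸▸ U U φ μ)) (trans (double-+ ((T · S) μ) ((U · U) μ))
      (trans (sum-cong-≗ (λ j → sum-cong-≗ (termwise μ j)))
        (sym (trans (cong₂ _+_ (▸▸ S U φ μ) (swapped μ)) (double-+ ((U · S) μ) (λ j i → ind⊑ U i * (ind⊑ T j * k μ j i)))))))

  hat-valid : ∀ {φ} → XValid φ → ∀ X → ValidOn X (hat φ)
  hat-valid {φ} v X = record
    { perm = λ p → hat-perm p φ
    ; quad = λ S T M _ _ _ _ m _ → hat-quad v S T M m
    ; pair = λ a b M _ _ a≢b _ → hat-zero M (atom-zero v a b a≢b)
    }

2≤⇒big : ∀ {n} (V : Subset n) → 2 ≤ ∣ V ∣ → Big V
2≤⇒big {n} V 2≤ with big? V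
... | yes b = b
... | no ¬b with Subsetₚ.nonempty? V
...   | yes (c , c∈) = ⊥-elim (ℕₚ.<-irrefl refl (subst (2 ≤_) (trans (cong ∣_∣ (small-nonempty c∈ ¬b)) (∣⁅⁆∣≡1 c)) 2≤))
...   | no ¬ne = ⊥-elim (ℕₚ.n≮0 (subst (1 ≤_) (trans (cong ∣_∣ (Subsetₚ.Empty-unique ¬ne)) (Subsetₚ.∣⊥∣≡0 n)) (ℕₚ.≤-trans (s≤s z≤n) 2≤)))

subsets-unique : ∀ n → Unique (subsets n)
subsets-unique zero = [] ∷ []
subsets-unique (suc n) = Uniqueₚ.concat⁺ (Allₚ.map⁺ (All.tabulate (λ _ → ((λ ()) ∷ []) ∷ [] ∷ [])))
  (AllPairsₚ.map⁺ (AllPairs.map disjoint (subsets-unique n)))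
  where
  disjoint : ∀ {s t : Subset n} → s ≢ t → ∀ {v} → ¬ (v ∈ₗ (outside Vec.∷ s) ∷ (inside Vec.∷ s) ∷ [] × v ∈ₗ (outside Vec.∷ t) ∷ (inside Vec.∷ t) ∷ [])
  disjoint s≢t (here refl , here refl) = s≢t refl
  disjoint s≢t (here refl , there (here ()))
  disjoint s≢t (there (here refl) , there (here refl)) = s≢t refl
  disjoint s≢t (there (here refl) , here ())

lookup-injective : ∀ {A : Set} (xs : List A) → Unique xs → ∀ i j → List.lookup xs i ≡ List.lookup xs j → i ≡ j
lookup-injective (x ∷ xs) (x∉ ∷ u) Fin.zero Fin.zero _ = refl
lookup-injective (x ∷ xs) (x∉ ∷ u) Fin.zero (Fin.suc j) e = ⊥-elim (All.lookup x∉ (∈ₗ.∈-lookup {xs = xs} j) e)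
lookup-injective (x ∷ xs) (x∉ ∷ u) (Fin.suc i) Fin.zero e = ⊥-elim (All.lookup x∉ (∈ₗ.∈-lookup {xs = xs} i) (sym e))
lookup-injective (x ∷ xs) (x∉ ∷ u) (Fin.suc i) (Fin.suc j) e = cong Fin.suc (lookup-injective xs u i j e)

G-injective : ∀ n i j → G n i ≡ G n j → i ≡ j
G-injective n = lookup-injective (building n) (Uniqueₚ.filter⁺ (λ s → 2 ℕ.≤? ∣ s ∣) (subsets-unique n))

G-big : ∀ n j → Big (G n j)
G-big n j = 2≤⇒big (G n j) (proj₂ (∈ₗ.∈-filter⁻ (λ s → 2 ℕ.≤? ∣ s ∣) {xs = subsets n} (∈ₗ.∈-lookup {xs = building n} j)))

zero-or-var : ∀ {m} (μ : Mono m) → μ ≡ 0ₘ ⊎ ∃ λ j → ∃ λ e → Vec.lookup μ j ≡ suc e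
zero-or-var Vec.[] = inj₁ refl
zero-or-var (suc e Vec.∷ μ) = inj₂ (Fin.zero , e , refl)
zero-or-var (zero Vec.∷ μ) with zero-or-var μ
... | inj₁ e = inj₁ (cong (0 Vec.∷_) e)
... | inj₂ (j , e , p) = inj₂ (Fin.suc j , e , p)

sum-⊞ : ∀ {m} (μ ν : Mono m) → Vec.sum (μ ⊞ ν) ≡ Vec.sum μ ℕ.+ Vec.sum ν
sum-⊞ Vec.[] Vec.[] = refl
sum-⊞ (x Vec.∷ μ) (y Vec.∷ ν) = trans (cong (x ℕ.+ y ℕ.+_) (sum-⊞ μ ν)) (interchange x y (Vec.sum μ) (Vec.sum ν))
  where
  open import Algebra.Properties.CommutativeSemigroup ℕₚ.+-commutativeSemigroup using (interchange)

sum-0ₘ : ∀ m → Vec.sum (0ₘ {m}) ≡ 0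
sum-0ₘ zero = refl
sum-0ₘ (suc m) = sum-0ₘ m

sum-var : ∀ {m} (j : Fin m) → Vec.sum (var j) ≡ 1
sum-var {suc m} Fin.zero = cong suc (sum-0ₘ m)
sum-var (Fin.suc j) = sum-var j

module Dual (n : ℕ) where

  open Link n

  Vanishes : (Mono (N n) → ℚ) → Set
  Vanishes φ = ∀ M → All Big M → hat φ M ≡ 0ℚ

  -- Downward induction on |G n j|: in hat φ (G n j ∷ M) = 0 all terms other than that of j belong to larger sets.
  vanishes-▹ : ∀ {φ} → Vanishes φ → ∀ m j → n ≤ m ℕ.+ ∣ G n j ∣ → Vanishes (j ▹ φ)
  vanishes-▹ {φ} v m j n≤ M bM = trans (sym (trans (cong (_* hat (j ▹ φ) M) (indicator-yes (λ _ → id) (G n j ⊑? G n j))) (ℚₚ.*-identityˡ _)))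
    (trans (sym (sum-δ (λ i → ind⊑ (G n j) i * hat (i ▹ φ) M) j others)) (trans (sym (hat-∷ φ (G n j) M)) (v (G n j ∷ M) (G-big n j ∷ bM))))
    where
    larger : ∀ m i → n ≤ m ℕ.+ ∣ G n j ∣ → ∣ G n j ∣ < ∣ G n i ∣ → hat (i ▹ φ) M ≡ 0ℚ
    larger zero i n≤ lt = ⊥-elim (ℕₚ.<-irrefl refl (ℕₚ.<-≤-trans lt (ℕₚ.≤-trans (∣p∣≤n (G n i)) n≤)))
    larger (suc m) i n≤ lt = vanishes-▹ v m i (ℕₚ.≤-trans n≤ (subst (_≤ m ℕ.+ ∣ G n i ∣) (ℕₚ.+-suc m ∣ G n j ∣) (ℕₚ.+-monoʳ-≤ m lt))) M bM
    others : ∀ i → i ≢ j → ind⊑ (G n j) i * hat (i ▹ φ) M ≡ 0ℚ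
    others i i≢j with G n j ⊑? G n i
    ... | no _ = ℚₚ.*-zeroˡ (hat (i ▹ φ) M)
    ... | yes j⊑i = trans (cong (1ℚ *_) (larger m i n≤ (p⊂q⇒∣p∣<∣q∣ ((λ {x} → j⊑i x) ,
            (let (y , y∈ , y∉) = ¬⊑⇒∃ (λ i⊑j → i≢j (G-injective n i j (⊑-antisym i⊑j j⊑i))) in y , y∈ , y∉))))) (ℚₚ.*-zeroʳ 1ℚ)

  -- The dual of the statement that the h_T generate: induction on the degree, splitting off one
  -- variable and passing to the form transposed by it.
  vanishes⇒zero : ∀ s {φ} → Vanishes φ → ∀ μ → Vec.sum μ ≡ s → φ μ ≡ 0ℚ
  vanishes⇒zero s {φ} v μ e with zero-or-var μ
  ... | inj₁ refl = v [] []
  ... | inj₂ (j , _ , p) with extract-var μ j p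
  ...   | (ν , refl , _) = go s e
    where
    go : ∀ s → Vec.sum (ν ⊞ var j) ≡ s → φ (ν ⊞ var j) ≡ 0ℚ
    go zero e = case trans (sym (trans (sum-⊞ ν (var j)) (trans (cong (Vec.sum ν ℕ.+_) (sum-var j)) (ℕₚ.+-comm _ 1)))) e of λ ()
    go (suc s) e = vanishes⇒zero s {j ▹ φ} (vanishes-▹ v n j (ℕₚ.m≤m+n n _)) ν
      (ℕₚ.suc-injective (trans (sym (trans (sum-⊞ ν (var j)) (trans (cong (Vec.sum ν ℕ.+_) (sum-var j)) (ℕₚ.+-comm _ 1)))) e))

  Fun : Set
  Fun = Functional {n}

  PermInv : Fun → Set
  PermInv F = ∀ {M M′} → M ↭ M′ → F M ≡ F M′

  infixr 5 _▷_

  _▷_ : Subset n → Fun → Fun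
  (V ▷ F) M = mob V (λ T → F (T ∷ M))

  _≐_ : Fun → Fun → Set
  F ≐ F′ = ∀ M → F M ≡ F′ M

  ▷-cong : ∀ V {F F′} → F ≐ F′ → (V ▷ F) ≐ (V ▷ F′)
  ▷-cong V e M = mob-cong V (λ T _ → e (T ∷ M))

  ▷-perm : ∀ V {F} → PermInv F → PermInv (V ▷ F)
  ▷-perm V p q = mob-cong V (λ T _ → p (prep T q))

  ▷-comm : ∀ V W {F} → PermInv F → (V ▷ W ▷ F) ≐ (W ▷ V ▷ F)
  ▷-comm V W {F} p M = trans (mob-comm V W (λ T T′ → F (T′ ∷ T ∷ M))) (mob-cong W (λ T′ _ → mob-cong V (λ T _ → p (swap T′ T ↭-refl))))

  ▷-sum : ∀ V {m} (c : Fin m → ℚ) (F : Fin m → Fun) → (V ▷ λ M → sum (λ j → c j * F j M)) ≐ (λ M → sum (λ j → c j * (V ▷ F j) M))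
  ▷-sum V c F M = trans (mob-sum V (λ j T → c j * F j (T ∷ M))) (sum-cong-≗ (λ j → mob-* V (c j) (λ T → F j (T ∷ M))))

  pow : ℕ → Subset n → Fun → Fun
  pow zero    V F = F
  pow (suc e) V F = pow e V (V ▷ F)

  act : ∀ {m} → (Fin m → Subset n) → Mono m → Fun → Fun
  act g Vec.[]       F = F
  act g (e Vec.∷ μ) F = act (g ∘ Fin.suc) μ (pow e (g Fin.zero) F)

  pow-cong : ∀ e V {F F′} → F ≐ F′ → pow e V F ≐ pow e V F′
  pow-cong zero V e = e
  pow-cong (suc k) V e = pow-cong k V (▷-cong V e)

  act-cong : ∀ {m} (g : Fin m → Subset n) μ {F F′} → F ≐ F′ → act g μ F ≐ act g μ F′
  act-cong g Vec.[] e = e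
  act-cong g (k Vec.∷ μ) e = act-cong (g ∘ Fin.suc) μ (pow-cong k (g Fin.zero) e)

  pow-perm : ∀ e V {F} → PermInv F → PermInv (pow e V F)
  pow-perm zero V p = p
  pow-perm (suc e) V {F} p = pow-perm e V {V ▷ F} (▷-perm V {F} p)

  pow-▷ : ∀ e V W {F} → PermInv F → pow e V (W ▷ F) ≐ (W ▷ pow e V F)
  pow-▷ zero V W p M = refl
  pow-▷ (suc e) V W {F} p M = trans (pow-cong e V {F′ = W ▷ V ▷ F} (▷-comm V W {F} p) M) (pow-▷ e V W {V ▷ F} (▷-perm V {F} p) M)

  pow-sum : ∀ e V {m} (c : Fin m → ℚ) (F : Fin m → Fun) → pow e V (λ M → sum (λ j → c j * F j M)) ≐ (λ M → sum (λ j → c j * pow e V (F j) M))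
  pow-sum zero V c F M = refl
  pow-sum (suc e) V c F M = trans (pow-cong e V {F′ = λ M → sum (λ j → c j * (V ▷ F j) M)} (▷-sum V c F) M) (pow-sum e V c (λ j → V ▷ F j) M)

  act-sum : ∀ {k} (g : Fin k → Subset n) μ {m} (c : Fin m → ℚ) (F : Fin m → Fun) → act g μ (λ M → sum (λ j → c j * F j M)) ≐ (λ M → sum (λ j → c j * act g μ (F j) M))
  act-sum g Vec.[] c F M = refl
  act-sum g (e Vec.∷ μ) c F M = trans (act-cong (g ∘ Fin.suc) μ {F′ = λ M → sum (λ j → c j * pow e (g Fin.zero) (F j) M)} (pow-sum e (g Fin.zero) c F) M) (act-sum (g ∘ Fin.suc) μ c (λ j → pow e (g Fin.zero) (F j)) M)

  act-zero : ∀ {k} (g : Fin k → Subset n) μ {F} → (∀ M → F M ≡ 0ℚ) → ∀ M → act g μ F M ≡ 0ℚ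
  act-zero g μ z M = trans (act-cong g μ {F′ = λ M → sum {0} (λ ())} z M) (act-sum g μ {0} (λ ()) (λ ()) M)

  act-0ₘ : ∀ {k} (g : Fin k → Subset n) F → act g 0ₘ F ≐ F
  act-0ₘ {zero} g F M = refl
  act-0ₘ {suc k} g F M = act-0ₘ (g ∘ Fin.suc) F M

  act-var : ∀ {k} (g : Fin k → Subset n) μ j {F} → PermInv F → act g (μ ⊞ var j) F ≐ act g μ (g j ▷ F)
  act-var g (e Vec.∷ μ) Fin.zero {F} p M = trans (cong (λ k → act (g ∘ Fin.suc) (μ ⊞ 0ₘ) (pow k (g Fin.zero) F) M) (ℕₚ.+-comm e 1))
    (cong (λ ν → act (g ∘ Fin.suc) ν (pow e (g Fin.zero) (g Fin.zero ▷ F)) M) (⊞-identityʳ μ))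
  act-var g (e Vec.∷ μ) (Fin.suc j) {F} p M = trans (cong (λ k → act (g ∘ Fin.suc) (μ ⊞ var j) (pow k (g Fin.zero) F) M) (ℕₚ.+-identityʳ e))
    (trans (act-var (g ∘ Fin.suc) μ j {pow e (g Fin.zero) F} (pow-perm e (g Fin.zero) {F} p) M)
      (act-cong (g ∘ Fin.suc) μ {F′ = pow e (g Fin.zero) (g (Fin.suc j) ▷ F)} (λ M → sym (pow-▷ e (g Fin.zero) (g (Fin.suc j)) {F} p M)) M))

  -- The form on monomials in the x_G, each x_G acting as the Möbius transform of the h_T.
  onMonos : Fun → Mono (N n) → ℚ
  onMonos F μ = act (G n) μ F []

  -- Summing the Möbius transforms x_G over all G ⊇ T gives back h_T, by `up-mob`.
  ▸-onMonos : ∀ {F} → PermInv F → ∀ T → Big T → ∀ μ → (T ▸ onMonos F) μ ≡ onMonos (λ M → F (T ∷ M)) μ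
  ▸-onMonos {F} p T bT μ = trans (sum-cong-≗ (λ j → cong (ind⊑ T j *_) (act-var (G n) μ j {F} p [])))
    (trans (sym (act-sum (G n) μ (ind⊑ T) (λ j → G n j ▷ F) []))
      (act-cong (G n) μ {F′ = λ M → F (T ∷ M)} (λ M → trans (sum-building T (λ V → mob V (λ W → F (W ∷ M))) bT) (up-mob T (λ W → F (W ∷ M)))) []))

  hat-onMonos : ∀ {F} → PermInv F → ∀ M → All Big M → hat (onMonos F) M ≡ F M
  hat-onMonos {F} p [] [] = act-0ₘ (G n) F []
  hat-onMonos {F} p (T ∷ M) (bT ∷ bM) = trans (hat-cong M (▸-onMonos {F} p T bT)) (hat-onMonos {λ M → F (T ∷ M)} (λ q → p (prep T q)) M bM)

  -- A linear generator acts as h_{a,b}. From a non-nested monomial the variables of one crossing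
  -- pair are split off, and the product of their Möbius transforms is zero by `mob-crossing`,
  -- whatever the remaining factors are.
  onMonos-valid : ∀ {F} → Valid F → XValid (onMonos F)
  onMonos-valid {F} v (atom a b a≢b) μ = trans (linGen-ev (onMonos F) a b μ) (trans (▸-onMonos {F} V.perm (⁅ a ⁆ ∪ ⁅ b ⁆) (pair-big a≢b) μ)
      (act-zero (G n) μ {λ M → F (⁅ a ⁆ ∪ ⁅ b ⁆ ∷ M)} (λ M → V.pair a b M a≢b) []))
    where module V = Valid v
  onMonos-valid {F} v (nonNested S (j , k , j∈ , k∈ , j⊈k , k⊈j , x , x∈j , x∈k)) μ =
    trans (ℚₚ.+-identityʳ _) (trans (ℚₚ.*-identityˡ _) vanish)
    where
    module V = Valid v
    suc-at : ∀ {i} → i ∈ S → Vec.lookup (μ ⊞ sqfree S) i ≡ suc (Vec.lookup μ i)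
    suc-at {i} i∈ = trans (Vecₚ.lookup-zipWith ℕ._+_ i μ (sqfree S)) (trans (cong (Vec.lookup μ i ℕ.+_) (sqfree-∈ i∈)) (ℕₚ.+-comm _ 1))
    k≢j : k ≢ j
    k≢j refl = j⊈k id
    crossing : ∀ M → (G n k ▷ G n j ▷ F) M ≡ 0ℚ
    crossing M = mob-crossing (G n k) (G n j) (λ V W → F (W ∷ V ∷ M)) (λ s → k⊈j (λ {x} → s x)) (λ s → j⊈k (λ {x} → s x))
      λ A B k⊑A j⊑B → trans (cong (_+ F (A ∪ B ∷ A ∪ B ∷ M)) (V.perm (swap B A ↭-refl)))
        (trans (V.quad A B M (x , k⊑A x x∈k , j⊑B x x∈j)) (cong₂ _+_ (V.perm (swap A (A ∪ B) ↭-refl)) (V.perm (swap B (A ∪ B) ↭-refl))))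
    vanish : onMonos F (μ ⊞ sqfree S) ≡ 0ℚ
    vanish with extract-var (μ ⊞ sqfree S) j (suc-at j∈)
    ... | (ν , e , f) with extract-var ν k (trans (f k k≢j) (suc-at k∈))
    ...   | (ρ , refl , _) = trans (cong (onMonos F) e) (trans (act-var (G n) (ρ ⊞ var k) j {F} V.perm [])
              (trans (act-var (G n) ρ k {G n j ▷ F} (▷-perm (G n j) {F} V.perm) []) (act-zero (G n) ρ {G n k ▷ G n j ▷ F} crossing [])))

-- The dimension of the Chow ring


monos-sum : ∀ m k {μ} → μ ∈ₗ monos m k → Vec.sum μ ≡ k
monos-sum zero zero (here refl) = refl
monos-sum (suc m) k μ∈ with find (∈ₗ.∈-concatMap⁻ (λ e → List.map (e Vec.∷_) (monos m (k ∸ e))) {xs = List.upTo (suc k)} μ∈)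
... | (e , e∈ , r) with ∈ₗ.∈-map⁻ _ r
...   | (ν , ν∈ , refl) = trans (cong (e ℕ.+_) (monos-sum m (k ∸ e) ν∈)) (ℕₚ.m+[n∸m]≡n (ℕ.s≤s⁻¹ (∈ₗ.∈-upTo⁻ e∈)))

sum-monos : ∀ m k {μ} → Vec.sum μ ≡ k → μ ∈ₗ monos m k
sum-monos zero zero {Vec.[]} refl = here refl
sum-monos (suc m) k {e Vec.∷ μ} eq = ∈ₗ.∈-concatMap⁺ (λ e → List.map (e Vec.∷_) (monos m (k ∸ e)))
  (Any.map (λ { refl → ∈ₗ.∈-map⁺ (e Vec.∷_) (sum-monos m (k ∸ e) (trans (sym (ℕₚ.m+n∸m≡n e _)) (cong (_∸ e) eq))) })
    (∈ₗ.∈-upTo⁺ (s≤s (subst (e ≤_) eq (ℕₚ.m≤m+n e _)))))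

monos-unique : ∀ m k → Unique (monos m k)
monos-unique zero zero = [] ∷ []
monos-unique zero (suc k) = []
monos-unique (suc m) k = Uniqueₚ.concat⁺
  (Allₚ.map⁺ (All.tabulate (λ {e} _ → Uniqueₚ.map⁺ (λ { refl → refl }) (monos-unique m (k ∸ e)))))
  (AllPairsₚ.map⁺ (AllPairs.map disjoint (Uniqueₚ.upTo⁺ (suc k))))
  where
  disjoint : ∀ {e f} → e ≢ f → ∀ {v} → ¬ (v ∈ₗ List.map (e Vec.∷_) (monos m (k ∸ e)) × v ∈ₗ List.map (f Vec.∷_) (monos m (k ∸ f)))
  disjoint e≢f (p , q) with ∈ₗ.∈-map⁻ _ p | ∈ₗ.∈-map⁻ _ q
  ... | (_ , _ , refl) | (_ , _ , refl) = e≢f refl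

_≟ₘ_ : ∀ {m} (μ ν : Mono m) → Dec (μ ≡ ν)
_≟ₘ_ = Vecₚ.≡-dec ℕ._≟_

coeff-∷ : ∀ {m} q (ν : Mono m) p μ → coeff ((q , ν) ∷ p) μ ≡ indicator (ν ≟ₘ μ) * q + coeff p μ
coeff-∷ q ν p μ with Vecₚ.≡-dec ℕ._≟_ ν μ
... | yes _ = cong (_+ coeff p μ) (sym (ℚₚ.*-identityˡ q))
... | no _ = sym (trans (cong (_+ coeff p μ) (ℚₚ.*-zeroˡ q)) (ℚₚ.+-identityˡ _))

Homogeneous : ∀ {m} → ℕ → Poly m → Set
Homogeneous i = All (λ (_ , ν) → Vec.sum ν ≡ i)

coeff-outside : ∀ {m i} (p : Poly m) μ → Homogeneous i p → Vec.sum μ ≢ i → coeff p μ ≡ 0ℚ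
coeff-outside [] μ _ _ = refl
coeff-outside ((q , ν) ∷ p) μ (h ∷ hs) ≢i with Vecₚ.≡-dec ℕ._≟_ ν μ
... | yes refl = ⊥-elim (≢i h)
... | no _ = coeff-outside p μ hs ≢i

listSum-zero : ∀ {A : Set} (f : A → ℚ) xs → (∀ {x} → x ∈ₗ xs → f x ≡ 0ℚ) → listSum f xs ≡ 0ℚ
listSum-zero f [] z = refl
listSum-zero f (x ∷ xs) z = trans (cong₂ _+_ (z (here refl)) (listSum-zero f xs (z ∘ there))) refl

listSum-δ : ∀ {A : Set} (f : A → ℚ) {xs x} → Unique xs → x ∈ₗ xs → (∀ y → x ≢ y → f y ≡ 0ℚ) → listSum f xs ≡ f x
listSum-δ f {x ∷ xs} (x∉ ∷ u) (here refl) z = trans (cong (f x +_) (listSum-zero f xs (λ y∈ → z _ (All.lookup x∉ y∈)))) (ℚₚ.+-identityʳ _)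
listSum-δ f {y ∷ xs} (y∉ ∷ u) (there x∈) z = trans (cong (_+ listSum f xs) (z y (λ { refl → All.lookup y∉ x∈ refl })))
  (trans (ℚₚ.+-identityˡ _) (listSum-δ f u x∈ z))

listSum-cong∈ : ∀ {A : Set} {f g : A → ℚ} xs → (∀ {x} → x ∈ₗ xs → f x ≡ g x) → listSum f xs ≡ listSum g xs
listSum-cong∈ [] e = refl
listSum-cong∈ (x ∷ xs) e = cong₂ _+_ (e (here refl)) (listSum-cong∈ xs (e ∘ there))

listSum-* : ∀ {A : Set} t (f : A → ℚ) xs → listSum (λ x → t * f x) xs ≡ t * listSum f xs
listSum-* t f [] = sym (ℚₚ.*-zeroʳ t)
listSum-* t f (x ∷ xs) = trans (cong (t * f x +_) (listSum-* t f xs)) (sym (ℚₚ.*-distribˡ-+ t (f x) (listSum f xs)))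

module _ {m i : ℕ} where

  L : List (Mono m)
  L = monos m i

  ev-coeff : ∀ φ (p : Poly m) → Homogeneous i p → ev φ p ≡ listSum (λ μ → coeff p μ * φ μ) L
  ev-coeff φ [] [] = sym (listSum-zero _ L (λ {μ} _ → ℚₚ.*-zeroˡ (φ μ)))
  ev-coeff φ ((q , ν) ∷ p) (h ∷ hs) = sym (trans
    (listSum-cong L (λ μ → trans (cong (_* φ μ) (coeff-∷ q ν p μ)) (ℚₚ.*-distribʳ-+ (φ μ) (indicator (ν ≟ₘ μ) * q) (coeff p μ))))
    (trans (listSum-+ (λ μ → (indicator (ν ≟ₘ μ) * q) * φ μ) (λ μ → coeff p μ * φ μ) L)
      (cong₂ _+_ (trans (listSum-δ (λ μ → (indicator (ν ≟ₘ μ) * q) * φ μ) (monos-unique m i) (sum-monos m i h) off) on) (sym (ev-coeff φ p hs)))))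
    where
    off : ∀ μ → ν ≢ μ → (indicator (ν ≟ₘ μ) * q) * φ μ ≡ 0ℚ
    off μ ν≢μ = trans (cong (λ z → (z * q) * φ μ) (indicator-no ν≢μ (ν ≟ₘ μ))) (trans (cong (_* φ μ) (ℚₚ.*-zeroˡ q)) (ℚₚ.*-zeroˡ (φ μ)))
    on : (indicator (ν ≟ₘ ν) * q) * φ ν ≡ q * φ ν
    on = cong (_* φ ν) (trans (cong (_* q) (indicator-yes refl (ν ≟ₘ ν))) (ℚₚ.*-identityˡ q))

  ev-combo : ∀ φ {r} (c : Vec ℚ r) (bs : Vec (Poly m) r) → (∀ k → Homogeneous i (Vec.lookup bs k)) →
             dot c (Vec.map (ev φ) bs) ≡ listSum (λ μ → combo c bs μ * φ μ) L
  ev-combo φ Vec.[] Vec.[] _ = sym (listSum-zero _ L (λ {μ} _ → ℚₚ.*-zeroˡ (φ μ)))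
  ev-combo φ (c Vec.∷ cs) (b Vec.∷ bs) h = sym (trans
    (listSum-cong L (λ μ → trans (ℚₚ.*-distribʳ-+ (φ μ) (c * coeff b μ) (combo cs bs μ)) (cong (_+ combo cs bs μ * φ μ) (ℚₚ.*-assoc c (coeff b μ) (φ μ)))))
    (trans (listSum-+ (λ μ → c * (coeff b μ * φ μ)) (λ μ → combo cs bs μ * φ μ) L)
      (cong₂ _+_ (trans (listSum-* c _ L) (cong (c *_) (sym (ev-coeff φ b (h Fin.zero))))) (sym (ev-combo φ cs bs (h ∘ Fin.suc))))))

δ-dual : ∀ {m} (L : List (Mono m)) → Vec ℚ (length L) → Mono m → ℚ
δ-dual L y ν = dot y (Vec.map (λ μ → indicator (ν ≟ₘ μ)) (Vec.fromList L))

ev-δ-dual : ∀ {m} (L : List (Mono m)) y p → ev (δ-dual L y) p ≡ dot y (Vec.map (coeff p) (Vec.fromList L))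
ev-δ-dual L y [] = sym (zero-row L y)
  where
  zero-row : ∀ {m} (L : List (Mono m)) y → dot y (Vec.map (coeff []) (Vec.fromList L)) ≡ 0ℚ
  zero-row [] Vec.[] = refl
  zero-row (μ ∷ L) (y Vec.∷ ys) = trans (cong₂ _+_ (ℚₚ.*-zeroʳ y) (zero-row L ys)) refl
ev-δ-dual L y ((q , ν) ∷ p) = trans (cong (q * δ-dual L y ν +_) (ev-δ-dual L y p)) (sym (linear L y))
  where
  open +-*-Solver
  linear : ∀ L y → dot y (Vec.map (coeff ((q , ν) ∷ p)) (Vec.fromList L)) ≡ q * δ-dual L y ν + dot y (Vec.map (coeff p) (Vec.fromList L))
  linear [] Vec.[] = trans (sym (ℚₚ.*-zeroʳ q)) (sym (ℚₚ.+-identityʳ _))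
  linear (μ ∷ L) (y Vec.∷ ys) = trans (cong₂ (λ a b → y * a + b) (coeff-∷ q ν p μ) (linear L ys))
    (solve 6 (λ y d q c D R → y :* (d :* q :+ c) :+ (q :* D :+ R) := q :* (y :* d :+ D) :+ (y :* c :+ R)) refl
      y (indicator (ν ≟ₘ μ)) q (coeff p μ) (δ-dual L ys ν) (dot ys (Vec.map (coeff p) (Vec.fromList L))))

δ-dual-∉ : ∀ {m} (L : List (Mono m)) y {ν} → ν ∉ₗ L → δ-dual L y ν ≡ 0ℚ
δ-dual-∉ [] Vec.[] _ = refl
δ-dual-∉ (μ ∷ L) (y Vec.∷ ys) {ν} ν∉ = trans (cong₂ _+_ (trans (cong (y *_) (indicator-no (ν∉ ∘ here) (ν ≟ₘ μ))) (ℚₚ.*-zeroʳ y)) (δ-dual-∉ L ys (ν∉ ∘ there))) refl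

δ-dual-lookup : ∀ {m} (L : List (Mono m)) y → Unique L → ∀ j → δ-dual L y (List.lookup L j) ≡ Vec.lookup y j
δ-dual-lookup (μ ∷ L) (y Vec.∷ ys) (μ∉ ∷ u) Fin.zero =
  trans (cong₂ _+_ (trans (cong (y *_) (indicator-yes refl (μ ≟ₘ μ))) (ℚₚ.*-identityʳ y)) (δ-dual-∉ L ys (λ μ∈ → All.lookup μ∉ μ∈ refl))) (ℚₚ.+-identityʳ y)
δ-dual-lookup (μ ∷ L) (y Vec.∷ ys) (μ∉ ∷ u) (Fin.suc j) =
  trans (cong₂ _+_ (trans (cong (y *_) (indicator-no (λ { refl → All.lookup μ∉ (∈ₗ.∈-lookup {xs = L} j) refl }) (List.lookup L j ≟ₘ μ))) (ℚₚ.*-zeroʳ y)) (δ-dual-lookup L ys u j)) (ℚₚ.+-identityˡ _)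

module _ {n : ℕ} {P : Item {n} → Set} (P? : Decidable P) where

  -- Padding by zeros: independence is known for the basis in all degrees together, while the
  -- dimension count takes one degree at a time.
  extend-coefficients : ∀ xs → Vec ℚ (length (filter P? xs)) → ℕ → ℚ
  extend-coefficients [] c i = 0ℚ
  extend-coefficients (x ∷ xs) c i with P? x
  extend-coefficients (x ∷ xs) (c Vec.∷ cs) zero    | yes _ = c
  extend-coefficients (x ∷ xs) (c Vec.∷ cs) (suc i) | yes _ = extend-coefficients xs cs i
  extend-coefficients (x ∷ xs) c zero    | no _ = 0ℚ
  extend-coefficients (x ∷ xs) c (suc i) | no _ = extend-coefficients xs c i

  combine-extend : ∀ xs c g → combine (extend-coefficients xs c) g xs ≡ dot c (Vec.map g (Vec.fromList (filter P? xs)))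
  combine-extend [] Vec.[] g = refl
  combine-extend (x ∷ xs) c g with P? x
  combine-extend (x ∷ xs) (c Vec.∷ cs) g | yes _ = cong (c * g x +_) (combine-extend xs cs g)
  combine-extend (x ∷ xs) c g | no _ = trans (cong₂ _+_ (ℚₚ.*-zeroˡ (g x)) (combine-extend xs c g)) (ℚₚ.+-identityˡ _)

  extend-zero : ∀ xs c → (∀ i → i < length xs → extend-coefficients xs c i ≡ 0ℚ) → ∀ k → Vec.lookup c k ≡ 0ℚ
  extend-zero (x ∷ xs) c z k with P? x
  extend-zero (x ∷ xs) (c Vec.∷ cs) z Fin.zero    | yes _ = z 0 (s≤s z≤n)
  extend-zero (x ∷ xs) (c Vec.∷ cs) z (Fin.suc k) | yes _ = extend-zero xs cs (λ i i< → z (suc i) (s≤s i<)) k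
  extend-zero (x ∷ xs) c z k | no _ = extend-zero xs c (λ i i< → z (suc i) (s≤s i<)) k

∈-subsets : ∀ {n} (S : Subset n) → S ∈ₗ subsets n
∈-subsets Vec.[] = here refl
∈-subsets {suc n} (s Vec.∷ S) = ∈ₗ.∈-concatMap⁺ (λ s → (outside Vec.∷ s) ∷ (inside Vec.∷ s) ∷ []) (Any.map (λ { refl → head s }) (∈-subsets S))
  where
  head : ∀ s → (s Vec.∷ S) ∈ₗ (outside Vec.∷ S) ∷ (inside Vec.∷ S) ∷ []
  head outside = here refl
  head inside = there (here refl)

sum-sqfree : ∀ {m} (S : Subset m) → Vec.sum (sqfree S) ≡ ∣ S ∣
sum-sqfree Vec.[] = refl
sum-sqfree (outside Vec.∷ S) = sum-sqfree S
sum-sqfree (inside Vec.∷ S) = cong suc (sum-sqfree S)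

module Generators (n : ℕ) where

  open Link n

  notNested? : ∀ S → Dec (NotNested n S)
  notNested? S = Finₚ.any? λ j → Finₚ.any? λ k → (j ∈? S) ×-dec (k ∈? S) ×-dec ¬? (G n j ⊆? G n k) ×-dec
    ¬? (G n k ⊆? G n j) ×-dec Finₚ.any? λ v → (v ∈? G n j) ×-dec (v ∈? G n k)

  gen-homogeneous : ∀ {g d} → FYGen n g d → Homogeneous d g
  gen-homogeneous (nonNested S _) = sum-sqfree S ∷ []
  gen-homogeneous (atom a b _) = Allₚ.map⁺ (All.tabulate (λ {j} _ → sum-var j))

  mulMono-homogeneous : ∀ {d} μ (g : Poly (N n)) → Homogeneous d g → Homogeneous (Vec.sum μ ℕ.+ d) (mulMono μ g)
  mulMono-homogeneous μ [] [] = []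
  mulMono-homogeneous μ ((q , ν) ∷ g) (h ∷ hs) = trans (sum-⊞ μ ν) (cong (Vec.sum μ ℕ.+_) h) ∷ mulMono-homogeneous μ g hs

  ideal-homogeneous : ∀ {i v} → IdealSpan n i v → Homogeneous i v
  ideal-homogeneous {i} (g , d , k , μ , gen , k+d , μ∈ , refl) =
    subst (λ e → Homogeneous e (mulMono μ g)) (trans (cong (ℕ._+ d) (monos-sum (N n) k μ∈)) k+d) (mulMono-homogeneous μ g (gen-homogeneous gen))

  -- The spanning family of the ideal in degree i as a finite list, from which a basis can be
  -- selected. The lower bounds on i in the filters guard against truncated subtraction, which would
  -- admit generators of degree above i with the cofactor 1.
  monoGens linGens ideal : ℕ → List (Poly (N n))
  monoGens i = concatMap (λ S → List.map (λ μ → mulMono μ ((1ℚ , sqfree S) ∷ [])) (monos (N n) (i ∸ ∣ S ∣)))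
                 (filter (λ S → notNested? S ×-dec (∣ S ∣ ℕ.≤? i)) (subsets (N n)))
  linGens i = concatMap (λ (a , b) → List.map (λ μ → mulMono μ (linGen n a b)) (monos (N n) (i ∸ 1)))
                (filter (λ (a , b) → ¬? (a Fin.≟ b) ×-dec (1 ℕ.≤? i)) (List.cartesianProduct (List.allFin n) (List.allFin n)))
  ideal i = monoGens i ++ linGens i

  ideal-sound : ∀ i {v} → v ∈ₗ ideal i → IdealSpan n i v
  ideal-sound i v∈ with ∈ₗ.∈-++⁻ (monoGens i) v∈
  ideal-sound i v∈ | inj₁ p with find (∈ₗ.∈-concatMap⁻ _ {xs = filter (λ S → notNested? S ×-dec (∣ S ∣ ℕ.≤? i)) (subsets (N n))} p)
  ... | (S , S∈ , r) with ∈ₗ.∈-filter⁻ (λ S → notNested? S ×-dec (∣ S ∣ ℕ.≤? i)) {xs = subsets (N n)} S∈ | ∈ₗ.∈-map⁻ _ r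
  ...   | (_ , nn , le) | (μ , μ∈ , e) = _ , ∣ S ∣ , i ∸ ∣ S ∣ , μ , nonNested S nn , ℕₚ.m∸n+n≡m le , μ∈ , e
  ideal-sound i v∈ | inj₂ p with find (∈ₗ.∈-concatMap⁻ _ {xs = filter (λ (a , b) → ¬? (a Fin.≟ b) ×-dec (1 ℕ.≤? i)) (List.cartesianProduct (List.allFin n) (List.allFin n))} p)
  ... | ((a , b) , ab∈ , r) with ∈ₗ.∈-filter⁻ (λ (a , b) → ¬? (a Fin.≟ b) ×-dec (1 ℕ.≤? i)) {xs = List.cartesianProduct (List.allFin n) (List.allFin n)} ab∈ | ∈ₗ.∈-map⁻ _ r
  ...   | (_ , a≢b , le) | (μ , μ∈ , e) = _ , 1 , i ∸ 1 , μ , atom a b a≢b , ℕₚ.m∸n+n≡m le , μ∈ , e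

  ideal-complete : ∀ i {v} → IdealSpan n i v → v ∈ₗ ideal i
  ideal-complete i (_ , _ , k , μ , nonNested S nn , k+d , μ∈ , refl) = ∈ₗ.∈-++⁺ˡ (∈ₗ.∈-concatMap⁺ _
    (Any.map (λ { refl → ∈ₗ.∈-map⁺ _ (subst (λ k → μ ∈ₗ monos (N n) k) (sym (trans (cong (_∸ ∣ S ∣) (sym k+d)) (ℕₚ.m+n∸n≡m k ∣ S ∣))) μ∈) })
      (∈ₗ.∈-filter⁺ (λ S → notNested? S ×-dec (∣ S ∣ ℕ.≤? i)) (∈-subsets S) (nn , subst (∣ S ∣ ≤_) k+d (ℕₚ.m≤n+m ∣ S ∣ k)))))
  ideal-complete i (_ , _ , k , μ , atom a b a≢b , k+d , μ∈ , refl) = ∈ₗ.∈-++⁺ʳ (monoGens i) (∈ₗ.∈-concatMap⁺ _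
    (Any.map (λ { refl → ∈ₗ.∈-map⁺ _ (subst (λ k → μ ∈ₗ monos (N n) k) (sym (trans (cong (_∸ 1) (sym k+d)) (ℕₚ.m+n∸n≡m k 1))) μ∈) })
      (∈ₗ.∈-filter⁺ (λ (a , b) → ¬? (a Fin.≟ b) ×-dec (1 ℕ.≤? i)) (∈ₗ.∈-cartesianProduct⁺ (∈ₗ.∈-allFin a) (∈ₗ.∈-allFin b)) (a≢b , subst (1 ≤_) k+d (ℕₚ.m≤n+m 1 k)))))

  wordPoly : Word {n} → Poly (N n)
  wordPoly []      = (1ℚ , 0ₘ) ∷ []
  wordPoly (T ∷ M) = concatMap (λ j → mulMono (var j) (wordPoly M)) (filter (λ j → T ⊑? G n j) (List.allFin (N n)))

  wordPoly-homogeneous : ∀ M → Homogeneous (length M) (wordPoly M)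
  wordPoly-homogeneous [] = sum-0ₘ (N n) ∷ []
  wordPoly-homogeneous (T ∷ M) = Allₚ.concat⁺ (Allₚ.map⁺ {xs = filter (λ j → T ⊑? G n j) (List.allFin (N n))} (All.tabulate (λ {j} _ →
    subst (λ e → Homogeneous (e ℕ.+ length M) (mulMono (var j) (wordPoly M))) (sum-var j) (mulMono-homogeneous (var j) (wordPoly M) (wordPoly-homogeneous M)))))

  ev-wordPoly : ∀ M φ → ev φ (wordPoly M) ≡ hat φ M
  ev-wordPoly [] φ = trans (ℚₚ.+-identityʳ _) (ℚₚ.*-identityˡ _)
  ev-wordPoly (T ∷ M) φ = trans (over (List.allFin (N n))) (trans (tabulated (N n) id) (sym (hat-∷ φ T M)))
    where
    f : Fin (N n) → ℚ
    f j = ind⊑ T j * hat (j ▹ φ) M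
    one : ∀ j → ev φ (mulMono (var j) (wordPoly M)) ≡ hat (j ▹ φ) M
    one j = trans (ev-mulMono φ (var j) (wordPoly M)) (trans (ev-cong (wordPoly M) (λ ν → cong φ (⊞-comm (var j) ν))) (ev-wordPoly M (j ▹ φ)))
    over : ∀ js → ev φ (concatMap (λ j → mulMono (var j) (wordPoly M)) (filter (λ j → T ⊑? G n j) js)) ≡ listSum f js
    over [] = refl
    over (j ∷ js) with T ⊑? G n j
    ... | yes _ = trans (ev-++ φ (mulMono (var j) (wordPoly M)) _) (cong₂ _+_ (trans (one j) (sym (ℚₚ.*-identityˡ _))) (over js))
    ... | no _ = trans (over js) (sym (trans (cong (_+ listSum f js) (ℚₚ.*-zeroˡ (hat (j ▹ φ) M))) (ℚₚ.+-identityˡ _)))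
    tabulated : ∀ m (g : Fin m → Fin (N n)) → listSum f (List.tabulate g) ≡ sum (f ∘ g)
    tabulated zero g = refl
    tabulated (suc m) g = cong (f (g Fin.zero) +_) (tabulated m (g ∘ Fin.suc))

combo-++ : ∀ {m r s} (c : Vec ℚ r) (d : Vec ℚ s) (bs : Vec (Poly m) r) (ws : Vec (Poly m) s) μ →
           combo (c Vec.++ d) (bs Vec.++ ws) μ ≡ combo c bs μ + combo d ws μ
combo-++ Vec.[] d Vec.[] ws μ = sym (ℚₚ.+-identityˡ _)
combo-++ (c Vec.∷ cs) d (b Vec.∷ bs) ws μ = trans (cong (c * coeff b μ +_) (combo-++ cs d bs ws μ))
  (sym (ℚₚ.+-assoc (c * coeff b μ) (combo cs bs μ) (combo d ws μ)))

combo-zero : ∀ {m r} (c : Vec ℚ r) (bs : Vec (Poly m) r) μ → (∀ k → Vec.lookup c k ≡ 0ℚ) → combo c bs μ ≡ 0ℚ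
combo-zero Vec.[] Vec.[] μ z = refl
combo-zero (c Vec.∷ cs) (b Vec.∷ bs) μ z = trans (cong₂ _+_ (trans (cong (_* coeff b μ) (z Fin.zero)) (ℚₚ.*-zeroˡ (coeff b μ))) (combo-zero cs bs μ (z ∘ Fin.suc))) refl

combo-outside : ∀ {m i r} (c : Vec ℚ r) (bs : Vec (Poly m) r) μ → (∀ k → Homogeneous i (Vec.lookup bs k)) → Vec.sum μ ≢ i → combo c bs μ ≡ 0ℚ
combo-outside Vec.[] Vec.[] μ h ≢i = refl
combo-outside (c Vec.∷ cs) (b Vec.∷ bs) μ h ≢i = trans (cong₂ _+_ (trans (cong (c *_) (coeff-outside b μ (h Fin.zero) ≢i)) (ℚₚ.*-zeroʳ c)) (combo-outside cs bs μ (h ∘ Fin.suc) ≢i)) refl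

dot-zeroʳ : ∀ {A : Set} {l} (c : Vec ℚ l) (f : A → ℚ) (bs : Vec A l) → (∀ k → f (Vec.lookup bs k) ≡ 0ℚ) → dot c (Vec.map f bs) ≡ 0ℚ
dot-zeroʳ Vec.[] f Vec.[] z = refl
dot-zeroʳ (c Vec.∷ cs) f (b Vec.∷ bs) z = trans (cong₂ _+_ (trans (cong (c *_) (z Fin.zero)) (ℚₚ.*-zeroʳ c)) (dot-zeroʳ cs f bs (z ∘ Fin.suc))) refl

lookup-++-zero : ∀ {r s} (c : Vec ℚ r) (d : Vec ℚ s) → (∀ k → Vec.lookup c k ≡ 0ℚ) → (∀ k → Vec.lookup d k ≡ 0ℚ) → ∀ k → Vec.lookup (c Vec.++ d) k ≡ 0ℚ
lookup-++-zero Vec.[] d _ zd k = zd k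
lookup-++-zero (c Vec.∷ cs) d zc zd Fin.zero = zc Fin.zero
lookup-++-zero (c Vec.∷ cs) d zc zd (Fin.suc k) = lookup-++-zero cs d (zc ∘ Fin.suc) zd k

lookup-fromList : ∀ {A : Set} (xs : List A) k → Vec.lookup (Vec.fromList xs) k ≡ List.lookup xs k
lookup-fromList (x ∷ xs) Fin.zero = refl
lookup-fromList (x ∷ xs) (Fin.suc k) = lookup-fromList xs k

-- The equation d + r = number of monomials splits into two inequalities: `upper` because a basis of
-- the ideal and the basis words are independent together, `lower` because no nonzero form kills
-- them all.
module Chow (n i : ℕ) (1≤n : 1 ≤ n) (basisOfIdeal : BasisOf (monos (N n) i) (Generators.ideal n i)) where

  open Link n
  open Dual n
  open Generators n

  points : List (Fin n)
  points = List.allFin n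

  points-unique : Unique points
  points-unique = Uniqueₚ.allFin⁺ n

  points-length : length points ≡ n
  points-length = Listₚ.length-tabulate id

  ⊑points : ∀ {T : Subset n} → T ⊑ ⟦ points ⟧
  ⊑points x _ = ∈-⟦⟧⁺ points (∈ₗ.∈-allFin x)

  items : List (Item {n})
  items = basis n points

  degree? : (p : Item {n}) → Dec (length (proj₁ p) ≡ i)
  degree? p = length (proj₁ p) ℕ.≟ i

  selected : List (Item {n})
  selected = filter degree? items

  poly : Item → Poly (N n)
  poly p = wordPoly (proj₁ p)

  ws : Vec (Poly (N n)) (length selected)
  ws = Vec.map poly (Vec.fromList selected)

  open BasisOf basisOfIdeal renaming (elems to bs)

  bs-ideal : ∀ k → IdealSpan n i (Vec.lookup bs k)
  bs-ideal k = ideal-sound i (from k)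

  bs-homogeneous : ∀ k → Homogeneous i (Vec.lookup bs k)
  bs-homogeneous k = ideal-homogeneous (bs-ideal k)

  ws-homogeneous : ∀ k → Homogeneous i (Vec.lookup ws k)
  ws-homogeneous k = subst (Homogeneous i) (sym (trans (Vecₚ.lookup-map k poly (Vec.fromList selected)) (cong poly (lookup-fromList selected k))))
    (subst (λ e → Homogeneous e (poly (List.lookup selected k)))
      (proj₂ (∈ₗ.∈-filter⁻ degree? {xs = items} (∈ₗ.∈-lookup {xs = selected} k)))
      (wordPoly-homogeneous (proj₁ (List.lookup selected k))))

  item-big : ∀ {p} → p ∈ₗ items → All Big (proj₁ p)
  item-big p∈ = All.map proj₂ (basis-on n points points-unique p∈)

  valid-kills : ∀ {φ} → XValid φ → ∀ {v} → IdealSpan n i v → ev φ v ≡ 0ℚ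
  valid-kills v (g , d , k , μ , gen , _ , _ , refl) = v gen μ

  -- The dual forms kill the ideal part of a relation, so `basis-independent` makes the coefficients
  -- of the words zero. What remains is a relation in the basis of the ideal.
  both-independent : IndependentOn (monos (N n) i) (bs Vec.++ ws)
  both-independent c z with Vec.splitAt rank c
  ... | (c₁ , c₂ , refl) = lookup-++-zero c₁ c₂ c₁-zero c₂-zero
    where
    split-zero : ∀ {μ} → μ ∈ₗ monos (N n) i → combo c₁ bs μ + combo c₂ ws μ ≡ 0ℚ
    split-zero {μ} μ∈ = trans (sym (combo-++ c₁ c₂ bs ws μ)) (z μ∈)
    ev-ws : ∀ {φ} → XValid φ → dot c₂ (Vec.map (ev φ) ws) ≡ 0ℚ
    ev-ws {φ} v = begin
      dot c₂ (Vec.map (ev φ) ws)                                     ≡⟨ ev-combo φ c₂ ws ws-homogeneous ⟩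
      listSum (λ μ → combo c₂ ws μ * φ μ) (monos (N n) i)           ≡⟨ sym (ℚₚ.+-identityˡ _) ⟩
      0ℚ + listSum (λ μ → combo c₂ ws μ * φ μ) (monos (N n) i)   ≡⟨ cong (_+ listSum (λ μ → combo c₂ ws μ * φ μ) (monos (N n) i)) (sym (trans (sym (ev-combo φ c₁ bs bs-homogeneous)) (dot-zeroʳ c₁ (ev φ) bs (λ k → valid-kills v (bs-ideal k))))) ⟩
      listSum (λ μ → combo c₁ bs μ * φ μ) (monos (N n) i) + listSum (λ μ → combo c₂ ws μ * φ μ) (monos (N n) i)
        ≡⟨ sym (listSum-+ (λ μ → combo c₁ bs μ * φ μ) (λ μ → combo c₂ ws μ * φ μ) (monos (N n) i)) ⟩
      listSum (λ μ → combo c₁ bs μ * φ μ + combo c₂ ws μ * φ μ) (monos (N n) i)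
        ≡⟨ listSum-zero _ (monos (N n) i) (λ {μ} μ∈ → trans (sym (ℚₚ.*-distribʳ-+ (φ μ) (combo c₁ bs μ) (combo c₂ ws μ))) (trans (cong (_* φ μ) (split-zero μ∈)) (ℚₚ.*-zeroˡ (φ μ)))) ⟩
      0ℚ ∎
      where open ≡-Reasoning
    pair-zero : ∀ {o} → o ∈ₗ items → combine (extend-coefficients degree? items c₂) (pairing o) items ≡ 0ℚ
    pair-zero {o} o∈ = begin
      combine c′ (pairing o) items                       ≡⟨ combine-cong items (λ _ → refl) (λ {p} p∈ → sym (trans (ev-wordPoly (proj₁ p) φ) (hat-onMonos {F} V.perm (proj₁ p) (item-big p∈)))) ⟩
      combine c′ (ev φ ∘ poly) items                     ≡⟨ combine-extend degree? items c₂ (ev φ ∘ poly) ⟩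
      dot c₂ (Vec.map (ev φ ∘ poly) (Vec.fromList selected)) ≡⟨ cong (dot c₂) (Vecₚ.map-∘ (ev φ) poly (Vec.fromList selected)) ⟩
      dot c₂ (Vec.map (ev φ) ws)                         ≡⟨ ev-ws (λ {g} {d} → onMonos-valid {F} valid {g} {d}) ⟩
      0ℚ                                                 ∎
      where
      open ≡-Reasoning
      c′ = extend-coefficients degree? items c₂
      F : Functional {n}
      F = proj₂ o []
      valid : Valid F
      valid = basis-valid n points o∈ []
      module V = Valid valid
      φ = onMonos F
    c₂-zero : ∀ k → Vec.lookup c₂ k ≡ 0ℚ
    c₂-zero = extend-zero degree? items c₂ (basis-independent n points points-unique _ pair-zero)
    c₁-zero : ∀ k → Vec.lookup c₁ k ≡ 0ℚ
    c₁-zero = indep c₁ (λ {μ} μ∈ → trans (sym (trans (cong (combo c₁ bs μ +_) (combo-zero c₂ ws μ c₂-zero)) (ℚₚ.+-identityʳ _))) (split-zero μ∈))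

  upper : rank ℕ.+ length selected ≤ length (monos (N n) i)
  upper = independent-≤ (monos (N n) i) (bs Vec.++ ws) both-independent

  coords : Poly (N n) → Vec ℚ (length (monos (N n) i))
  coords p = Vec.map (coeff p) (Vec.fromList (monos (N n) i))

  -- A vector of coordinates in degree i is extended by zero to a form on all monomials. As the
  -- generators are homogeneous, this form is valid once it kills `bs`; it then kills all basis
  -- words, of every degree, and `basis-spans` makes it zero.
  module Annihilator (y : Vec ℚ (length (monos (N n) i)))
    (kill-bs : ∀ k → dot y (coords (Vec.lookup bs k)) ≡ 0ℚ)
    (kill-ws : ∀ {p} → p ∈ₗ selected → dot y (coords (poly p)) ≡ 0ℚ) where

    φ : Mono (N n) → ℚ
    φ = δ-dual (monos (N n) i) y

    ev-outside : ∀ {d} (p : Poly (N n)) → Homogeneous d p → d ≢ i → ev φ p ≡ 0ℚ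
    ev-outside [] [] _ = refl
    ev-outside ((q , ν) ∷ p) (refl ∷ hs) d≢i = trans (cong₂ _+_ (trans (cong (q *_) (δ-dual-∉ (monos (N n) i) y {ν} (d≢i ∘ monos-sum (N n) i))) (ℚₚ.*-zeroʳ q)) (ev-outside p hs d≢i)) refl

    φ-valid : XValid φ
    φ-valid {g} {d} gen μ with (Vec.sum μ ℕ.+ d) ℕ.≟ i
    ... | no ≢i = ev-outside (mulMono μ g) (mulMono-homogeneous μ g (gen-homogeneous gen)) ≢i
    ... | yes ≡i with spans (ideal-complete i (g , d , Vec.sum μ , μ , gen , ≡i , sum-monos (N n) (Vec.sum μ) refl , refl))
    ...   | (c , e) = begin
      ev φ (mulMono μ g)                                          ≡⟨ ev-coeff φ (mulMono μ g) (subst (λ e → Homogeneous e (mulMono μ g)) ≡i (mulMono-homogeneous μ g (gen-homogeneous gen))) ⟩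
      listSum (λ ν → coeff (mulMono μ g) ν * φ ν) (monos (N n) i) ≡⟨ listSum-cong∈ (monos (N n) i) (λ {ν} ν∈ → cong (_* φ ν) (e ν∈)) ⟩
      listSum (λ ν → combo c bs ν * φ ν) (monos (N n) i)          ≡⟨ sym (ev-combo φ c bs bs-homogeneous) ⟩
      dot c (Vec.map (ev φ) bs)                                   ≡⟨ dot-zeroʳ c (ev φ) bs (λ k → trans (ev-δ-dual (monos (N n) i) y (Vec.lookup bs k)) (kill-bs k)) ⟩
      0ℚ                                                          ∎
      where open ≡-Reasoning

    items-killed : ∀ {p} → p ∈ₗ items → hat φ (proj₁ p) ≡ 0ℚ
    items-killed {p} p∈ = trans (sym (ev-wordPoly (proj₁ p) φ)) (go (degree? p))
      where
      go : Dec (length (proj₁ p) ≡ i) → ev φ (poly p) ≡ 0ℚ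
      go (yes e) = trans (ev-δ-dual (monos (N n) i) y (poly p)) (kill-ws (∈ₗ.∈-filter⁺ degree? p∈ e))
      go (no ¬e) = ev-outside (poly p) (wordPoly-homogeneous (proj₁ p)) ¬e

    φ-vanishes : Vanishes φ
    φ-vanishes M bM = basis-spans n points (ℕₚ.≤-reflexive points-length) (subst (1 ≤_) (sym points-length) 1≤n) points-unique
      (hat-valid (λ {g} {d} → φ-valid {g} {d}) ⟦ points ⟧) items-killed M (All.map (λ b → ⊑points , b) bM)

    y-zero : ∀ j → Vec.lookup y j ≡ 0ℚ
    y-zero j = trans (sym (δ-dual-lookup (monos (N n) i) y (monos-unique (N n) i) j)) (vanishes⇒zero (Vec.sum (List.lookup (monos (N n) i) j)) φ-vanishes (List.lookup (monos (N n) i) j) refl)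

  -- A kernel vector of the rows given by `bs` and the selected words is an annihilator, hence zero;
  -- a trivial kernel needs at least as many rows as there are monomials.
  lower : length (monos (N n) i) ≤ rank ℕ.+ length selected
  lower with gauss (length (monos (N n) i)) (List.map coords (Vec.toList bs) ++ List.map (coords ∘ poly) selected)
  ... | inj₂ (_ , le) = subst (length (monos (N n) i) ≤_) (trans (Listₚ.length-++ (List.map coords (Vec.toList bs)))
          (cong₂ ℕ._+_ (trans (Listₚ.length-map coords (Vec.toList bs)) (Vecₚ.length-toList bs)) (Listₚ.length-map (coords ∘ poly) selected))) le
  ... | inj₁ (y , ker , j , y≢0) = ⊥-elim (y≢0 (Annihilator.y-zero y kill-bs (λ p∈ → All.lookup (Allₚ.map⁻ (proj₂ kers)) p∈) j))
    where
    kers = Allₚ.++⁻ (List.map coords (Vec.toList bs)) ker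
    lookup∈ : ∀ {A : Set} {r} (v : Vec A r) k → Vec.lookup v k ∈ₗ Vec.toList v
    lookup∈ (x Vec.∷ v) Fin.zero = here refl
    lookup∈ (x Vec.∷ v) (Fin.suc k) = there (lookup∈ v k)
    kill-bs : ∀ k → dot y (coords (Vec.lookup bs k)) ≡ 0ℚ
    kill-bs k = All.lookup (Allₚ.map⁻ (proj₁ kers)) (lookup∈ bs k)

  chowDim : ChowDim n i (length selected)
  chowDim = rank , (bs , bs-ideal , (λ c z → indep c (λ {μ} _ → z μ)) , inSpan)
    , trans (ℕₚ.+-comm (length selected) rank) (ℕₚ.≤-antisym upper lower)
    where
    inSpan : ∀ v → IdealSpan n i v → InSpan bs v
    inSpan v v∈ with spans (ideal-complete i v∈)
    ... | (c , e) = c , λ μ → at μ (Vec.sum μ ℕ.≟ i)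
      where
      at : ∀ μ → Dec (Vec.sum μ ≡ i) → coeff v μ ≡ combo c bs μ
      at μ (yes ≡i) = e (sum-monos (N n) i ≡i)
      at μ (no ≢i) = trans (coeff-outside v μ (ideal-homogeneous v∈) ≢i) (sym (combo-outside c bs μ bs-homogeneous ≢i))

-- Exponential generating functions


Seq : Set
Seq = ℕ → ℚ

∂ : Seq → Seq
∂ A m = A (suc m)

infixl 7 _⋆_

-- The product of exponential generating functions, defined through the Leibniz rule.
_⋆_ : Seq → Seq → Seq
(A ⋆ B) zero    = A 0 * B 0
(A ⋆ B) (suc m) = (∂ A ⋆ B) m + (A ⋆ ∂ B) m

δ u : Seq
δ zero    = 1ℚ
δ (suc _) = 0ℚ
u zero    = 0ℚ
u (suc m) = δ m

-- Natural numbers as rationals by repeated addition of 1, which suits induction and the ring solver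
-- better than the normalised fraction; `ι≡/1` translates.
ι : ℕ → ℚ
ι zero    = 0ℚ
ι (suc m) = 1ℚ + ι m

ι-+ : ∀ a b → ι (a ℕ.+ b) ≡ ι a + ι b
ι-+ zero b = sym (ℚₚ.+-identityˡ _)
ι-+ (suc a) b = trans (cong (1ℚ +_) (ι-+ a b)) (sym (ℚₚ.+-assoc 1ℚ (ι a) (ι b)))

ι-* : ∀ a b → ι (a ℕ.* b) ≡ ι a * ι b
ι-* zero b = sym (ℚₚ.*-zeroˡ (ι b))
ι-* (suc a) b = trans (ι-+ b (a ℕ.* b)) (trans (cong (ι b +_) (ι-* a b)) (solve 2 (λ a b → b :+ a :* b := (con 1ℚ :+ a) :* b) refl (ι a) (ι b)))
  where open +-*-Solver

0≤ι : ∀ m → 0ℚ ℚ.≤ ι m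
0≤ι zero = ℚₚ.≤-refl
0≤ι (suc m) = ℚₚ.+-mono-≤ (ℚₚ.nonNegative⁻¹ 1ℚ) (0≤ι m)

ι-suc≢0 : ∀ m → ι (suc m) ≢ 0ℚ
ι-suc≢0 m e = ℚₚ.<-irrefl (sym e) (ℚₚ.+-mono-<-≤ (ℚₚ.positive⁻¹ 1ℚ) (0≤ι m))

cancel-ι : ∀ m {x y} → ι (suc m) * x ≡ ι (suc m) * y → x ≡ y
cancel-ι m {x} {y} e = from-difference (cancel-zero (ι-suc≢0 m) (trans (*-distribˡ-- (ι (suc m)) x y) (to-difference e)))

-- Compares products of coefficients instead of the factors, for the case that one factor vanishes
-- where nothing is known about the other.
⋆-cong-joint : ∀ m {A B A′ B′ : Seq} → (∀ s r → s ℕ.+ r ≡ m → A s * B r ≡ A′ s * B′ r) → (A ⋆ B) m ≡ (A′ ⋆ B′) m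
⋆-cong-joint zero e = e 0 0 refl
⋆-cong-joint (suc m) e = cong₂ _+_ (⋆-cong-joint m (λ s r p → e (suc s) r (cong suc p)))
  (⋆-cong-joint m (λ s r p → e s (suc r) (trans (ℕₚ.+-suc s r) (cong suc p))))

⋆-cong : ∀ m {A B A′ B′ : Seq} → (∀ j → j ≤ m → A j ≡ A′ j) → (∀ j → j ≤ m → B j ≡ B′ j) → (A ⋆ B) m ≡ (A′ ⋆ B′) m
⋆-cong m e f = ⋆-cong-joint m λ { s r refl → cong₂ _*_ (e s (ℕₚ.m≤m+n s r)) (f r (ℕₚ.m≤n+m r s)) }

⋆-congˡ : ∀ m B {A A′ : Seq} → (∀ j → A j ≡ A′ j) → (A ⋆ B) m ≡ (A′ ⋆ B) m
⋆-congˡ m B e = ⋆-cong m (λ j _ → e j) (λ _ _ → refl)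

⋆-congʳ : ∀ m A {B B′ : Seq} → (∀ j → B j ≡ B′ j) → (A ⋆ B) m ≡ (A ⋆ B′) m
⋆-congʳ m A e = ⋆-cong m (λ _ _ → refl) (λ j _ → e j)

⋆-comm : ∀ A B m → (A ⋆ B) m ≡ (B ⋆ A) m
⋆-comm A B zero = ℚₚ.*-comm (A 0) (B 0)
⋆-comm A B (suc m) = trans (cong₂ _+_ (⋆-comm (∂ A) B m) (⋆-comm A (∂ B) m)) (ℚₚ.+-comm ((B ⋆ ∂ A) m) ((∂ B ⋆ A) m))

infixl 6 _⊹_
infixr 8 _∙_

_⊹_ : Seq → Seq → Seq
(A ⊹ B) m = A m + B m

_∙_ : ℚ → Seq → Seq
(x ∙ A) m = x * A m

⋆-distribʳ : ∀ A B C m → ((A ⊹ B) ⋆ C) m ≡ (A ⋆ C) m + (B ⋆ C) m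
⋆-distribʳ A B C zero = ℚₚ.*-distribʳ-+ (C 0) (A 0) (B 0)
⋆-distribʳ A B C (suc m) = trans (cong₂ _+_ (⋆-distribʳ (∂ A) (∂ B) C m) (⋆-distribʳ A B (∂ C) m))
  (+-interchange ((∂ A ⋆ C) m) ((∂ B ⋆ C) m) ((A ⋆ ∂ C) m) ((B ⋆ ∂ C) m))

⋆-distribˡ : ∀ A B C m → (A ⋆ (B ⊹ C)) m ≡ (A ⋆ B) m + (A ⋆ C) m
⋆-distribˡ A B C m = trans (⋆-comm A (B ⊹ C) m) (trans (⋆-distribʳ B C A m) (cong₂ _+_ (⋆-comm B A m) (⋆-comm C A m)))

⋆-scaleˡ : ∀ x A B m → ((x ∙ A) ⋆ B) m ≡ x * (A ⋆ B) m
⋆-scaleˡ x A B zero = ℚₚ.*-assoc x (A 0) (B 0)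
⋆-scaleˡ x A B (suc m) = trans (cong₂ _+_ (⋆-scaleˡ x (∂ A) B m) (⋆-scaleˡ x A (∂ B) m)) (sym (ℚₚ.*-distribˡ-+ x ((∂ A ⋆ B) m) ((A ⋆ ∂ B) m)))

⋆-scaleʳ : ∀ x A B m → (A ⋆ (x ∙ B)) m ≡ x * (A ⋆ B) m
⋆-scaleʳ x A B m = trans (⋆-comm A (x ∙ B) m) (trans (⋆-scaleˡ x B A m) (cong (x *_) (⋆-comm B A m)))

⋆-assoc : ∀ A B C m → ((A ⋆ B) ⋆ C) m ≡ (A ⋆ (B ⋆ C)) m
⋆-assoc A B C zero = ℚₚ.*-assoc (A 0) (B 0) (C 0)
⋆-assoc A B C (suc m) = begin
  ((∂ A ⋆ B ⊹ A ⋆ ∂ B) ⋆ C) m + ((A ⋆ B) ⋆ ∂ C) m                 ≡⟨ cong (_+ ((A ⋆ B) ⋆ ∂ C) m) (⋆-distribʳ (∂ A ⋆ B) (A ⋆ ∂ B) C m) ⟩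
  ((∂ A ⋆ B) ⋆ C) m + ((A ⋆ ∂ B) ⋆ C) m + ((A ⋆ B) ⋆ ∂ C) m     ≡⟨ cong₂ _+_ (cong₂ _+_ (⋆-assoc (∂ A) B C m) (⋆-assoc A (∂ B) C m)) (⋆-assoc A B (∂ C) m) ⟩
  (∂ A ⋆ (B ⋆ C)) m + (A ⋆ (∂ B ⋆ C)) m + (A ⋆ (B ⋆ ∂ C)) m     ≡⟨ ℚₚ.+-assoc ((∂ A ⋆ (B ⋆ C)) m) _ _ ⟩
  (∂ A ⋆ (B ⋆ C)) m + ((A ⋆ (∂ B ⋆ C)) m + (A ⋆ (B ⋆ ∂ C)) m)   ≡⟨ cong ((∂ A ⋆ (B ⋆ C)) m +_) (sym (⋆-distribˡ A (∂ B ⋆ C) (B ⋆ ∂ C) m)) ⟩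
  (∂ A ⋆ (B ⋆ C)) m + (A ⋆ (∂ B ⋆ C ⊹ B ⋆ ∂ C)) m                 ∎
  where open ≡-Reasoning

⋆-swap : ∀ A B C m → (A ⋆ (B ⋆ C)) m ≡ (B ⋆ (A ⋆ C)) m
⋆-swap A B C m = trans (sym (⋆-assoc A B C m)) (trans (⋆-congˡ m C (⋆-comm A B)) (⋆-assoc B A C m))

⋆-zeroˡ : ∀ B m → ((λ _ → 0ℚ) ⋆ B) m ≡ 0ℚ
⋆-zeroˡ B zero = ℚₚ.*-zeroˡ (B 0)
⋆-zeroˡ B (suc m) = trans (cong₂ _+_ (⋆-zeroˡ B m) (⋆-zeroˡ (∂ B) m)) refl

δ-⋆ : ∀ B m → (δ ⋆ B) m ≡ B m
δ-⋆ B zero = ℚₚ.*-identityˡ (B 0)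
δ-⋆ B (suc m) = trans (cong₂ _+_ (⋆-zeroˡ B m) (δ-⋆ (∂ B) m)) (ℚₚ.+-identityˡ _)

u-⋆ : ∀ B m → (u ⋆ B) (suc m) ≡ ι (suc m) * B m
u-⋆ B zero = trans (cong₂ _+_ (δ-⋆ B 0) (ℚₚ.*-zeroˡ (B 1))) (solve 1 (λ b → b :+ con 0ℚ := (con 1ℚ :+ con 0ℚ) :* b) refl (B 0))
  where open +-*-Solver
u-⋆ B (suc m) = trans (cong₂ _+_ (δ-⋆ B (suc m)) (u-⋆ (∂ B) m)) (solve 2 (λ i b → b :+ i :* b := (con 1ℚ :+ i) :* b) refl (ι (suc m)) (B (suc m)))
  where open +-*-Solver

u-⋆∂ : ∀ B m → (u ⋆ ∂ B) m ≡ ι m * B m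
u-⋆∂ B zero = trans (ℚₚ.*-zeroˡ (B 1)) (sym (ℚₚ.*-zeroˡ (B 0)))
u-⋆∂ B (suc m) = u-⋆ (∂ B) m

-- Bell a k is the exponential generating function of a ^ k / k! when a 0 = 0.
Bell : Seq → ℕ → Seq
Bell a zero            = δ
Bell a (suc k) zero    = 0ℚ
Bell a (suc k) (suc m) = (Bell a k ⋆ ∂ a) m

Bell-vanishes : ∀ a k m → m < k → Bell a k m ≡ 0ℚ
Bell-vanishes a (suc k) zero _ = refl
Bell-vanishes a (suc k) (suc m) (s≤s m<k) = trans (⋆-cong-joint m {A′ = λ _ → 0ℚ} {B′ = ∂ a}
    λ { s r refl → cong (_* a (suc r)) (Bell-vanishes a k s (ℕₚ.≤-<-trans (ℕₚ.m≤m+n s r) m<k)) })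
  (⋆-zeroˡ (∂ a) m)

-- For powers: a · a ^ k / k! is k + 1 times a ^ (k + 1) / (k + 1)!. Both sides vanish at 0, and
-- their derivatives agree by the Leibniz rule and the case k - 1.
⋆-Bell : ∀ a → a 0 ≡ 0ℚ → ∀ k m → (a ⋆ Bell a k) m ≡ ι (suc k) * Bell a (suc k) m
⋆-Bell a a₀ k zero = trans (cong (_* Bell a k 0) a₀) (trans (ℚₚ.*-zeroˡ (Bell a k 0)) (sym (ℚₚ.*-zeroʳ (ι (suc k)))))
⋆-Bell a a₀ zero (suc m) = begin
  (∂ a ⋆ δ) m + (a ⋆ (λ _ → 0ℚ)) m    ≡⟨ cong₂ _+_ (⋆-comm (∂ a) δ m) (trans (⋆-comm a _ m) (⋆-zeroˡ a m)) ⟩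
  (δ ⋆ ∂ a) m + 0ℚ                    ≡⟨ solve 1 (λ b → b :+ con 0ℚ := (con 1ℚ :+ con 0ℚ) :* b) refl ((δ ⋆ ∂ a) m) ⟩
  ι 1 * (δ ⋆ ∂ a) m                   ∎
  where open ≡-Reasoning
        open +-*-Solver
⋆-Bell a a₀ (suc k) (suc m) = begin
  (∂ a ⋆ Bell a (suc k)) m + (a ⋆ (Bell a k ⋆ ∂ a)) m                   ≡⟨ cong₂ _+_ (⋆-comm (∂ a) (Bell a (suc k)) m) (sym (⋆-assoc a (Bell a k) (∂ a) m)) ⟩
  (Bell a (suc k) ⋆ ∂ a) m + ((a ⋆ Bell a k) ⋆ ∂ a) m                   ≡⟨ cong ((Bell a (suc k) ⋆ ∂ a) m +_) (⋆-congˡ m (∂ a) (⋆-Bell a a₀ k)) ⟩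
  (Bell a (suc k) ⋆ ∂ a) m + ((ι (suc k) ∙ Bell a (suc k)) ⋆ ∂ a) m     ≡⟨ cong ((Bell a (suc k) ⋆ ∂ a) m +_) (⋆-scaleˡ (ι (suc k)) (Bell a (suc k)) (∂ a) m) ⟩
  (Bell a (suc k) ⋆ ∂ a) m + ι (suc k) * (Bell a (suc k) ⋆ ∂ a) m     ≡⟨ solve 2 (λ i b → b :+ i :* b := (con 1ℚ :+ i) :* b) refl (ι (suc k)) ((Bell a (suc k) ⋆ ∂ a) m) ⟩
  ι (suc (suc k)) * (Bell a (suc k) ⋆ ∂ a) m                            ∎
  where open ≡-Reasoning
        open +-*-Solver

-- F is the generating function of the P_n, with F ′ = 1 + F + t F ′ (F - u).
module Tree (t : ℚ) (F : Seq) (F₀ : F 0 ≡ 0ℚ) (G : Seq) (F≡ : ∀ m → F m ≡ G m + u m)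
  (ode : ∀ m → ∂ F m ≡ δ m + F m + t * (G ⋆ ∂ F) m) where

  E : ℕ → Seq
  E = Bell F

  -- The differential equation of F times F ^ κ / κ!; the left side is then the derivative of E (κ +
  -- 1). In the last term, multiplying that derivative by F gives a multiple of the derivative of E
  -- (κ + 2), and multiplying it by u gives the Euler operator, hence the factor `ι m`.
  E-rec : ∀ κ m → E (suc κ) (suc m) ≡ E κ m + ι (suc κ) * E (suc κ) m
                  + t * (ι (suc κ) * E (suc (suc κ)) (suc m) - ι m * E (suc κ) m)
  E-rec κ m = begin
    (E κ ⋆ ∂ F) m                                                ≡⟨ ⋆-congʳ m (E κ) {B′ = (δ ⊹ F) ⊹ t ∙ (G ⋆ ∂ F)} ode ⟩
    (E κ ⋆ ((δ ⊹ F) ⊹ t ∙ (G ⋆ ∂ F))) m                          ≡⟨ ⋆-distribˡ (E κ) (δ ⊹ F) (t ∙ (G ⋆ ∂ F)) m ⟩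
    (E κ ⋆ (δ ⊹ F)) m + (E κ ⋆ t ∙ (G ⋆ ∂ F)) m                ≡⟨ cong₂ _+_ (trans (⋆-distribˡ (E κ) δ F m) (cong₂ _+_ first second)) (trans (⋆-scaleʳ t (E κ) (G ⋆ ∂ F) m) (cong (t *_) third)) ⟩
    E κ m + ι (suc κ) * E (suc κ) m + t * (ι (suc κ) * E (suc (suc κ)) (suc m) - ι m * E (suc κ) m) ∎
    where
    open ≡-Reasoning
    first : (E κ ⋆ δ) m ≡ E κ m
    first = trans (⋆-comm (E κ) δ m) (δ-⋆ (E κ) m)
    second : (E κ ⋆ F) m ≡ ι (suc κ) * E (suc κ) m
    second = trans (⋆-comm (E κ) F m) (⋆-Bell F F₀ κ m)
    whole : (F ⋆ ∂ (E (suc κ))) m ≡ ι (suc κ) * E (suc (suc κ)) (suc m)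
    whole = trans (sym (⋆-assoc F (E κ) (∂ F) m)) (trans (⋆-congˡ m (∂ F) (⋆-Bell F F₀ κ)) (⋆-scaleˡ (ι (suc κ)) (E (suc κ)) (∂ F) m))
    parts : (F ⋆ ∂ (E (suc κ))) m ≡ (G ⋆ ∂ (E (suc κ))) m + (u ⋆ ∂ (E (suc κ))) m
    parts = trans (⋆-congˡ m (∂ (E (suc κ))) {A′ = G ⊹ u} F≡) (⋆-distribʳ G u (∂ (E (suc κ))) m)
    third : (E κ ⋆ (G ⋆ ∂ F)) m ≡ ι (suc κ) * E (suc (suc κ)) (suc m) - ι m * E (suc κ) m
    third = trans (⋆-swap (E κ) G (∂ F) m) (trans (sym (plus-minus ((G ⋆ ∂ (E (suc κ))) m) ((u ⋆ ∂ (E (suc κ))) m)))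
      (cong₂ _-_ (trans (sym parts) whole) (u-⋆∂ (E (suc κ)) m)))

-- The rising factorial α (α + 1) ⋯ (α + ℓ - 1), which is ℓ! times the coefficient of h ^ ℓ in (1 -
-- h) ^ (- α).
rise : ℕ → ℕ → ℚ
rise α zero    = 1ℚ
rise α (suc ℓ) = ι α * rise (suc α) ℓ

rise-last : ∀ α ℓ → rise α (suc ℓ) ≡ rise α ℓ * ι (α ℕ.+ ℓ)
rise-last α zero = trans (ℚₚ.*-comm (ι α) 1ℚ) (cong (λ m → 1ℚ * ι m) (sym (ℕₚ.+-identityʳ α)))
rise-last α (suc ℓ) = trans (cong (ι α *_) (rise-last (suc α) ℓ))
  (trans (sym (ℚₚ.*-assoc (ι α) (rise (suc α) ℓ) _)) (cong (λ m → rise α (suc ℓ) * ι m) (sym (ℕₚ.+-suc α ℓ))))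

rise-suc : ∀ α ℓ → rise (suc α) (suc ℓ) ≡ rise α (suc ℓ) + ι (suc ℓ) * rise (suc α) ℓ
rise-suc α ℓ = trans (rise-last (suc α) ℓ) (trans (cong (λ z → rise (suc α) ℓ * (1ℚ + z)) (ι-+ α ℓ))
  (solve 3 (λ r a l → r :* (con 1ℚ :+ (a :+ l)) := a :* r :+ (con 1ℚ :+ l) :* r) refl (rise (suc α) ℓ) (ι α) (ι ℓ)))
  where open +-*-Solver

sumTo : ℕ → (ℕ → ℚ) → ℚ
sumTo zero    f = 0ℚ
sumTo (suc L) f = f 0 + sumTo L (f ∘ suc)

sumTo-cong : ∀ L {f g : ℕ → ℚ} → (∀ ℓ → f ℓ ≡ g ℓ) → sumTo L f ≡ sumTo L g
sumTo-cong zero e = refl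
sumTo-cong (suc L) e = cong₂ _+_ (e 0) (sumTo-cong L (e ∘ suc))

sumTo-zero : ∀ L {f} → (∀ ℓ → f ℓ ≡ 0ℚ) → sumTo L f ≡ 0ℚ
sumTo-zero zero z = refl
sumTo-zero (suc L) z = trans (cong₂ _+_ (z 0) (sumTo-zero L (z ∘ suc))) refl

sumTo-extend : ∀ {L L′ f} → L ≤ L′ → (∀ ℓ → L ≤ ℓ → f ℓ ≡ 0ℚ) → sumTo L′ f ≡ sumTo L f
sumTo-extend {zero} {L′} _ z = sumTo-zero L′ (λ ℓ → z ℓ z≤n)
sumTo-extend {suc L} {suc L′} {f} (s≤s le) z = cong (f 0 +_) (sumTo-extend le (λ ℓ le → z (suc ℓ) (s≤s le)))

sumTo-+ : ∀ L f g → sumTo L (λ ℓ → f ℓ + g ℓ) ≡ sumTo L f + sumTo L g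
sumTo-+ zero f g = refl
sumTo-+ (suc L) f g = trans (cong (f 0 + g 0 +_) (sumTo-+ L (f ∘ suc) (g ∘ suc))) (+-interchange (f 0) (g 0) (sumTo L (f ∘ suc)) (sumTo L (g ∘ suc)))

sumTo-* : ∀ L x f → sumTo L (λ ℓ → x * f ℓ) ≡ x * sumTo L f
sumTo-* zero x f = sym (ℚₚ.*-zeroʳ x)
sumTo-* (suc L) x f = trans (cong (x * f 0 +_) (sumTo-* L x (f ∘ suc))) (sym (ℚₚ.*-distribˡ-+ x (f 0) _))

⋆-sumTo : ∀ A L (c : ℕ → ℚ) (X : ℕ → Seq) m → (A ⋆ (λ j → sumTo L (λ ℓ → c ℓ * X ℓ j))) m ≡ sumTo L (λ ℓ → c ℓ * (A ⋆ X ℓ) m)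
⋆-sumTo A zero c X m = trans (⋆-comm A (λ _ → 0ℚ) m) (⋆-zeroˡ A m)
⋆-sumTo A (suc L) c X m = trans (⋆-distribˡ A (c 0 ∙ X 0) (λ j → sumTo L (λ ℓ → c (suc ℓ) * X (suc ℓ) j)) m)
  (cong₂ _+_ (⋆-scaleʳ (c 0) A (X 0) m) (⋆-sumTo A L (c ∘ suc) (X ∘ suc) m))

-- Φ α is the generating function of (1 - h) ^ (- α).
module Power (h : Seq) (h₀ : h 0 ≡ 0ℚ) where

  Φ : ℕ → Seq
  Φ α m = sumTo (suc m) (λ ℓ → rise α ℓ * Bell h ℓ m)

  Φ-stable : ∀ α m {L} → m < L → sumTo L (λ ℓ → rise α ℓ * Bell h ℓ m) ≡ Φ α m
  Φ-stable α m m<L = sumTo-extend m<L (λ ℓ m<ℓ → trans (cong (rise α ℓ *_) (Bell-vanishes h ℓ m m<ℓ)) (ℚₚ.*-zeroʳ (rise α ℓ)))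

  ∂Φ : ∀ α m → Φ α (suc m) ≡ ι α * (∂ h ⋆ Φ (suc α)) m
  ∂Φ α m = begin
    1ℚ * 0ℚ + sumTo (suc m) (λ ℓ → ι α * rise (suc α) ℓ * (Bell h ℓ ⋆ ∂ h) m)
      ≡⟨ trans (cong (_+ sumTo (suc m) (λ ℓ → ι α * rise (suc α) ℓ * (Bell h ℓ ⋆ ∂ h) m)) (ℚₚ.*-zeroʳ 1ℚ)) (ℚₚ.+-identityˡ _) ⟩
    sumTo (suc m) (λ ℓ → ι α * rise (suc α) ℓ * (Bell h ℓ ⋆ ∂ h) m)
      ≡⟨ sumTo-cong (suc m) (λ ℓ → trans (ℚₚ.*-assoc (ι α) (rise (suc α) ℓ) _) (cong (λ z → ι α * (rise (suc α) ℓ * z)) (⋆-comm (Bell h ℓ) (∂ h) m))) ⟩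
    sumTo (suc m) (λ ℓ → ι α * (rise (suc α) ℓ * (∂ h ⋆ Bell h ℓ) m))
      ≡⟨ sumTo-* (suc m) (ι α) (λ ℓ → rise (suc α) ℓ * (∂ h ⋆ Bell h ℓ) m) ⟩
    ι α * sumTo (suc m) (λ ℓ → rise (suc α) ℓ * (∂ h ⋆ Bell h ℓ) m)
      ≡⟨ cong (ι α *_) (sym (⋆-sumTo (∂ h) (suc m) (rise (suc α)) (Bell h) m)) ⟩
    ι α * (∂ h ⋆ (λ j → sumTo (suc m) (λ ℓ → rise (suc α) ℓ * Bell h ℓ j))) m
      ≡⟨ cong (ι α *_) (⋆-cong m (λ _ _ → refl) (λ j j≤m → Φ-stable (suc α) j (s≤s j≤m))) ⟩
    ι α * (∂ h ⋆ Φ (suc α)) m ∎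
    where open ≡-Reasoning

  Φ-suc : ∀ α m → Φ (suc α) m ≡ Φ α m + (h ⋆ Φ (suc α)) m
  Φ-suc α m = begin
    Φ (suc α) m                             ≡⟨ sym (Φ-stable (suc α) m {suc (suc m)} (ℕₚ.n≤1+n _)) ⟩
    1ℚ * δ m + sumTo (suc m) (λ ℓ → rise (suc α) (suc ℓ) * Bell h (suc ℓ) m)
      ≡⟨ cong (1ℚ * δ m +_) (trans (sumTo-cong (suc m) (λ ℓ → trans (cong (_* Bell h (suc ℓ) m) (rise-suc α ℓ))
           (ℚₚ.*-distribʳ-+ (Bell h (suc ℓ) m) (rise α (suc ℓ)) (ι (suc ℓ) * rise (suc α) ℓ)))) (sumTo-+ (suc m) (λ ℓ → rise α (suc ℓ) * Bell h (suc ℓ) m) (λ ℓ → ι (suc ℓ) * rise (suc α) ℓ * Bell h (suc ℓ) m))) ⟩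
    1ℚ * δ m + (sumTo (suc m) (λ ℓ → rise α (suc ℓ) * Bell h (suc ℓ) m) + sumTo (suc m) (λ ℓ → ι (suc ℓ) * rise (suc α) ℓ * Bell h (suc ℓ) m))
      ≡⟨ sym (ℚₚ.+-assoc (1ℚ * δ m) _ _) ⟩
    sumTo (suc (suc m)) (λ ℓ → rise α ℓ * Bell h ℓ m) + sumTo (suc m) (λ ℓ → ι (suc ℓ) * rise (suc α) ℓ * Bell h (suc ℓ) m)
      ≡⟨ cong₂ _+_ (Φ-stable α m {suc (suc m)} (ℕₚ.n≤1+n _)) (trans (sumTo-cong (suc m) (λ ℓ → regroup ℓ))
           (trans (sym (⋆-sumTo h (suc m) (rise (suc α)) (Bell h) m)) (⋆-cong m (λ _ _ → refl) (λ j j≤m → Φ-stable (suc α) j (s≤s j≤m))))) ⟩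
    Φ α m + (h ⋆ Φ (suc α)) m ∎
    where
    open ≡-Reasoning
    open +-*-Solver
    regroup : ∀ ℓ → ι (suc ℓ) * rise (suc α) ℓ * Bell h (suc ℓ) m ≡ rise (suc α) ℓ * (h ⋆ Bell h ℓ) m
    regroup ℓ = trans (solve 3 (λ i r b → i :* r :* b := r :* (i :* b)) refl (ι (suc ℓ)) (rise (suc α) ℓ) (Bell h (suc ℓ) m))
      (cong (rise (suc α) ℓ *_) (sym (⋆-Bell h h₀ ℓ m)))

  -- The differential equation (1 + u)(1 - h - u h ′) = 1 - t u h, multiplied by α Φ (α + 1).
  module _ (t : ℚ) (ode : ∀ m → h m + (u ⋆ ∂ h) m + (u ⋆ h) m + (u ⋆ (u ⋆ ∂ h)) m ≡ u m + t * (u ⋆ h) m) where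

    Φ-rec : ∀ α m → let W = Φ (suc α); V = Φ α; a = ι α; s = ι (suc m) in
      a * (W (suc m) - V (suc m)) + s * V (suc m) + a * (s * (W m - V m)) + s * (ι m * V m)
      ≡ a * (s * W m) + t * (a * (s * (W m - V m)))
    Φ-rec α m = begin
      a * (W (suc m) - V (suc m)) + s * V (suc m) + a * (s * (W m - V m)) + s * (ι m * V m)
        ≡⟨ sym (cong₂ _+_ (cong₂ _+_ (cong₂ _+_ (cong (a *_) (H≡ (suc m))) (uD (suc m))) (cong (a *_) (trans (u-⋆ Hw m) (cong (s *_) (H≡ m)))))
             (trans (cong (a *_) (u-⋆ (u ⋆ Dw) m)) (trans (*-swap a s ((u ⋆ Dw) m)) (cong (s *_) (uD m))))) ⟩
      a * Hw (suc m) + a * (u ⋆ Dw) (suc m) + a * (u ⋆ Hw) (suc m) + a * (u ⋆ (u ⋆ Dw)) (suc m)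
        ≡⟨ solve 5 (λ a p q r v → a :* p :+ a :* q :+ a :* r :+ a :* v := a :* (p :+ q :+ r :+ v)) refl a (Hw (suc m)) ((u ⋆ Dw) (suc m)) ((u ⋆ Hw) (suc m)) ((u ⋆ (u ⋆ Dw)) (suc m)) ⟩
      a * (Hw (suc m) + (u ⋆ Dw) (suc m) + (u ⋆ Hw) (suc m) + (u ⋆ (u ⋆ Dw)) (suc m))
        ≡⟨ cong (a *_) (multiplied (suc m)) ⟩
      a * ((u ⋆ W) (suc m) + t * (u ⋆ Hw) (suc m))
        ≡⟨ cong₂ (λ x y → a * (x + t * y)) (u-⋆ W m) (trans (u-⋆ Hw m) (cong (s *_) (H≡ m))) ⟩
      a * (s * W m + t * (s * (W m - V m)))
        ≡⟨ solve 4 (λ a x t y → a :* (x :+ t :* y) := a :* x :+ t :* (a :* y)) refl a (s * W m) t (s * (W m - V m)) ⟩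
      a * (s * W m) + t * (a * (s * (W m - V m))) ∎
      where
      open ≡-Reasoning
      open +-*-Solver
      W = Φ (suc α)
      V = Φ α
      a = ι α
      s = ι (suc m)
      Hw = h ⋆ W
      Dw = ∂ h ⋆ W
      H≡ : ∀ j → Hw j ≡ W j - V j
      H≡ j = trans (sym (plus-minus (Hw j) (V j))) (cong (_- V j) (trans (ℚₚ.+-comm (Hw j) (V j)) (sym (Φ-suc α j))))
      uD : ∀ j → a * (u ⋆ Dw) j ≡ ι j * V j
      uD j = trans (sym (⋆-scaleʳ a u Dw j)) (trans (⋆-congʳ j u (λ i → sym (∂Φ α i))) (u-⋆∂ V j))
      multiplied : ∀ j → Hw j + (u ⋆ Dw) j + (u ⋆ Hw) j + (u ⋆ (u ⋆ Dw)) j ≡ (u ⋆ W) j + t * (u ⋆ Hw) j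
      multiplied j = begin
        Hw j + (u ⋆ Dw) j + (u ⋆ Hw) j + (u ⋆ (u ⋆ Dw)) j
          ≡⟨ sym (cong₂ _+_ (cong₂ _+_ (cong (Hw j +_) (⋆-assoc u (∂ h) W j)) (⋆-assoc u h W j)) (trans (⋆-assoc u (u ⋆ ∂ h) W j) (⋆-congʳ j u (⋆-assoc u (∂ h) W)))) ⟩
        (h ⋆ W) j + ((u ⋆ ∂ h) ⋆ W) j + ((u ⋆ h) ⋆ W) j + ((u ⋆ (u ⋆ ∂ h)) ⋆ W) j
          ≡⟨ sym (trans (⋆-distribʳ (h ⊹ u ⋆ ∂ h ⊹ u ⋆ h) (u ⋆ (u ⋆ ∂ h)) W j) (cong (_+ ((u ⋆ (u ⋆ ∂ h)) ⋆ W) j)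
               (trans (⋆-distribʳ (h ⊹ u ⋆ ∂ h) (u ⋆ h) W j) (cong (_+ ((u ⋆ h) ⋆ W) j) (⋆-distribʳ h (u ⋆ ∂ h) W j))))) ⟩
        ((h ⊹ u ⋆ ∂ h ⊹ u ⋆ h ⊹ u ⋆ (u ⋆ ∂ h)) ⋆ W) j
          ≡⟨ ⋆-congˡ j W {A′ = u ⊹ t ∙ (u ⋆ h)} ode ⟩
        ((u ⊹ t ∙ (u ⋆ h)) ⋆ W) j
          ≡⟨ trans (⋆-distribʳ u (t ∙ (u ⋆ h)) W j) (cong ((u ⋆ W) j +_) (trans (⋆-scaleˡ t (u ⋆ h) W j) (cong (t *_) (⋆-assoc u h W j)))) ⟩
        (u ⋆ W) j + t * (u ⋆ Hw) j ∎

-- The binomial coefficient of κ + m over κ, indexed by the two parts so that no subtraction occurs.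
binomial : ℕ → ℕ → ℚ
binomial zero    m       = 1ℚ
binomial (suc κ) zero    = 1ℚ
binomial (suc κ) (suc m) = binomial κ (suc m) + binomial (suc κ) m

binomial-zero : ∀ κ → binomial κ 0 ≡ 1ℚ
binomial-zero zero = refl
binomial-zero (suc κ) = refl

binomial-left : ∀ κ m → ι (suc κ) * binomial (suc κ) m ≡ ι (suc κ ℕ.+ m) * binomial κ m
binomial-right : ∀ κ m → ι (suc m) * binomial κ (suc m) ≡ ι (suc κ ℕ.+ m) * binomial κ m
binomial-left κ zero = cong₂ (λ x y → ι (suc x) * y) (sym (ℕₚ.+-identityʳ κ)) (sym (binomial-zero κ))
binomial-left κ (suc m) = begin
  ι (suc κ) * (b + binomial (suc κ) m)                       ≡⟨ ℚₚ.*-distribˡ-+ (ι (suc κ)) b (binomial (suc κ) m) ⟩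
  ι (suc κ) * b + ι (suc κ) * binomial (suc κ) m           ≡⟨ cong (ι (suc κ) * b +_) (trans (binomial-left κ m) (sym (binomial-right κ m))) ⟩
  ι (suc κ) * b + ι (suc m) * b                            ≡⟨ sym (ℚₚ.*-distribʳ-+ b (ι (suc κ)) (ι (suc m))) ⟩
  (ι (suc κ) + ι (suc m)) * b                                ≡⟨ cong (_* b) (sym (ι-+ (suc κ) (suc m))) ⟩
  ι (suc κ ℕ.+ suc m) * b                                      ∎
  where open ≡-Reasoning
        b = binomial κ (suc m)
binomial-right zero m = refl
binomial-right (suc κ) m = begin
  ι (suc m) * (binomial κ (suc m) + b)                       ≡⟨ ℚₚ.*-distribˡ-+ (ι (suc m)) (binomial κ (suc m)) b ⟩
  ι (suc m) * binomial κ (suc m) + ι (suc m) * b           ≡⟨ cong (_+ ι (suc m) * b) (trans (binomial-right κ m) (sym (binomial-left κ m))) ⟩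
  ι (suc κ) * b + ι (suc m) * b                            ≡⟨ sym (ℚₚ.*-distribʳ-+ b (ι (suc κ)) (ι (suc m))) ⟩
  (ι (suc κ) + ι (suc m)) * b                                ≡⟨ cong (_* b) (trans (sym (ι-+ (suc κ) (suc m))) (cong (ι ∘ suc) (ℕₚ.+-suc κ m))) ⟩
  ι (suc (suc κ) ℕ.+ m) * b                                    ∎
  where open ≡-Reasoning
        b = binomial (suc κ) m

-- Lagrange inversion: the coefficients of F ^ k / k! are binomial multiples of those of (1 - h) ^ (- m), because both
-- satisfy the same linear recursion.
module Inversion (t : ℚ) (h : Seq) (h₀ : h 0 ≡ 0ℚ)
  (h-ode : ∀ m → h m + (u ⋆ ∂ h) m + (u ⋆ h) m + (u ⋆ (u ⋆ ∂ h)) m ≡ u m + t * (u ⋆ h) m)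
  (F : Seq) (F₀ : F 0 ≡ 0ℚ) (G : Seq) (F≡ : ∀ m → F m ≡ G m + u m)
  (F-ode : ∀ m → ∂ F m ≡ δ m + F m + t * (G ⋆ ∂ F) m) where

  open Power h h₀
  open Tree t F F₀ G F≡ F-ode

  -- The binomial coefficient with κ - 1 in place of κ. The value 0 for κ = 0 matches F ^ 0 = 1,
  -- which has no coefficient in positive degree.
  previous : ℕ → ℕ → ℚ
  previous zero    m = 0ℚ
  previous (suc κ) m = binomial κ m

  previous-left : ∀ κ m → ι κ * binomial κ m ≡ ι (κ ℕ.+ m) * previous κ m
  previous-left zero m = trans (ℚₚ.*-zeroˡ 1ℚ) (sym (ℚₚ.*-zeroʳ (ι m)))
  previous-left (suc κ) m = binomial-left κ m

  step : ∀ k s′ M W V W′ V′ t β β′ γ p → M ≡ k + (1ℚ + s′) →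
    M * (W - V) + (1ℚ + s′) * V + M * ((1ℚ + s′) * (W′ - V′)) + (1ℚ + s′) * (s′ * V′)
      ≡ M * ((1ℚ + s′) * W′) + t * (M * ((1ℚ + s′) * (W′ - V′))) →
    (1ℚ + s′) * β ≡ M * β′ → (1ℚ + k) * γ ≡ M * β′ → k * β ≡ M * p →
    M * (p * V + (1ℚ + k) * (β′ * V′) + t * ((1ℚ + k) * (γ * W′) - M * (β′ * V′))) ≡ M * (β * W)
  step k s′ M W V W′ V′ t β β′ γ p refl rec e₁ e₂ e₃ = begin
    M * (p * V + (1ℚ + k) * (β′ * V′) + t * ((1ℚ + k) * (γ * W′) - M * (β′ * V′)))
      ≡⟨ solve 9 (λ M p V k β′ V′ t γ W′ → M :* (p :* V :+ (con 1ℚ :+ k) :* (β′ :* V′) :+ t :* ((con 1ℚ :+ k) :* (γ :* W′) :- M :* (β′ :* V′)))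
           := (M :* p) :* V :+ (M :* β′) :* ((con 1ℚ :+ k) :* V′) :+ t :* (M :* (((con 1ℚ :+ k) :* γ) :* W′) :- M :* ((M :* β′) :* V′))) refl M p V k β′ V′ t γ W′ ⟩
    (M * p) * V + (M * β′) * ((1ℚ + k) * V′) + t * (M * (((1ℚ + k) * γ) * W′) - M * ((M * β′) * V′))
      ≡⟨ cong₂ (λ x y → x * V + (M * β′) * ((1ℚ + k) * V′) + t * (M * (y * W′) - M * ((M * β′) * V′))) (sym e₃) e₂ ⟩
    (k * β) * V + (M * β′) * ((1ℚ + k) * V′) + t * (M * ((M * β′) * W′) - M * ((M * β′) * V′))
      ≡⟨ cong (λ x → (k * β) * V + x * ((1ℚ + k) * V′) + t * (M * (x * W′) - M * (x * V′))) (sym e₁) ⟩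
    (k * β) * V + (n * β) * ((1ℚ + k) * V′) + t * (M * ((n * β) * W′) - M * ((n * β) * V′))
      ≡⟨ solve 8 (λ k s β W V W′ V′ t → let n = con 1ℚ :+ s; M = k :+ n in
           (k :* β) :* V :+ (n :* β) :* ((con 1ℚ :+ k) :* V′) :+ t :* (M :* ((n :* β) :* W′) :- M :* ((n :* β) :* V′))
           := β :* ((M :* (n :* W′) :+ t :* (M :* (n :* (W′ :- V′)))) :- (M :* (W :- V) :+ n :* V :+ M :* (n :* (W′ :- V′)) :+ n :* (s :* V′))) :+ M :* (β :* W)) refl k s′ β W V W′ V′ t ⟩
    β * ((M * (n * W′) + t * (M * (n * (W′ - V′)))) - (M * (W - V) + n * V + M * (n * (W′ - V′)) + n * (s′ * V′))) + M * (β * W)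
      ≡⟨ cong (λ z → β * z + M * (β * W)) (to-difference (sym rec)) ⟩
    β * 0ℚ + M * (β * W)  ≡⟨ trans (cong (_+ M * (β * W)) (ℚₚ.*-zeroʳ β)) (ℚₚ.+-identityˡ _) ⟩
    M * (β * W) ∎
    where
    open ≡-Reasoning
    open +-*-Solver
    n = 1ℚ + s′

  -- F begins with u, so F ^ κ / κ! begins with u ^ κ / κ!. In `E-rec` the powers F ^ (κ + 1) and F
  -- ^ (κ + 2) have not yet started at these degrees.
  diagonal : ∀ κ → E κ (κ ℕ.+ 0) ≡ 1ℚ
  diagonal zero = refl
  diagonal (suc κ) = trans (E-rec κ (κ ℕ.+ 0))
    (trans (cong₂ (λ x y → E κ (κ ℕ.+ 0) + ι (suc κ) * x + t * (ι (suc κ) * y - ι (κ ℕ.+ 0) * x))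
             (Bell-vanishes F (suc κ) (κ ℕ.+ 0) (s≤s (ℕₚ.≤-reflexive (ℕₚ.+-identityʳ κ))))
             (Bell-vanishes F (suc (suc κ)) (suc (κ ℕ.+ 0)) (s≤s (s≤s (ℕₚ.≤-reflexive (ℕₚ.+-identityʳ κ))))))
      (trans (solve 4 (λ e i j t → e :+ i :* con 0ℚ :+ t :* (i :* con 0ℚ :- j :* con 0ℚ) := e) refl (E κ (κ ℕ.+ 0)) (ι (suc κ)) (ι (κ ℕ.+ 0)) t)
             (diagonal κ)))
    where open +-*-Solver

  -- With k = κ + 1 and N = m - k the binomial is that of m - 1 over k - 1. The recursion leads from
  -- (N + 1, κ) to (N, κ), (N, κ + 1) and, through `E-previous`, to (N + 1, κ - 1), so the induction
  -- is lexicographic.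
  E-closed : ∀ N κ m → m ≡ suc κ ℕ.+ N → E (suc κ) m ≡ binomial κ N * Φ m N
  E-previous : ∀ N κ m → N ≢ 0 → m ≡ κ ℕ.+ N → E κ m ≡ previous κ N * Φ m N
  E-closed zero κ _ refl = trans (diagonal (suc κ)) (sym (cong (_* 1ℚ) (binomial-zero κ)))
  E-closed (suc N) κ _ refl = trans (E-rec κ m) (trans (cong₂ (λ x y → x + ι (suc κ) * y + t * (ι (suc κ) * E (suc (suc κ)) (suc m) - ι m * y)) (E-previous (suc N) κ m (λ ()) refl) (E-closed N κ m (ℕₚ.+-suc κ N)))
      (trans (cong (λ z → previous κ (suc N) * Φ m (suc N) + ι (suc κ) * (binomial κ N * Φ m N) + t * (ι (suc κ) * z - ι m * (binomial κ N * Φ m N)))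
               (E-closed N (suc κ) (suc m) (cong suc (ℕₚ.+-suc κ N))))
        (cancel-ι (κ ℕ.+ N) (trans (cong (_* lhs) (sym M≡)) (trans
          (step (ι κ) (ι N) (ι m) (Φ (suc m) (suc N)) (Φ m (suc N)) (Φ (suc m) N) (Φ m N) t (binomial κ (suc N)) (binomial κ N) (binomial (suc κ) N) (previous κ (suc N))
            (ι-+ κ (suc N)) (Φ-rec t h-ode m N)
            (trans (binomial-right κ N) (cong (_* binomial κ N) (sym M≡)))
            (trans (binomial-left κ N) (cong (_* binomial κ N) (sym M≡)))
            (previous-left κ (suc N)))
          (cong (_* (binomial κ (suc N) * Φ (suc m) (suc N))) M≡))))))
    where
    m = κ ℕ.+ suc N
    M≡ : ι m ≡ ι (suc (κ ℕ.+ N))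
    M≡ = cong ι (ℕₚ.+-suc κ N)
    lhs = previous κ (suc N) * Φ m (suc N) + ι (suc κ) * (binomial κ N * Φ m N)
          + t * (ι (suc κ) * (binomial (suc κ) N * Φ (suc m) N) - ι m * (binomial κ N * Φ m N))
  E-previous zero zero m N≢0 _ = ⊥-elim (N≢0 refl)
  E-previous (suc N) zero m _ refl = sym (ℚₚ.*-zeroˡ (Φ m (suc N)))
  E-previous N (suc κ) m _ e = E-closed N κ m e

  inversion : ∀ m → F (suc m) ≡ Φ (suc m) m
  inversion m = trans (sym (δ-⋆ (∂ F) m)) (trans (E-closed m 0 (suc m) refl) (ℚₚ.*-identityˡ _))

-- The generating function of the basis and of the right-hand side


listSum-map : ∀ {A B : Set} (f : B → ℚ) (g : A → B) xs → listSum f (List.map g xs) ≡ listSum (f ∘ g) xs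
listSum-map f g [] = refl
listSum-map f g (x ∷ xs) = cong (f (g x) +_) (listSum-map f g xs)

-- The Leibniz rule that defines `_⋆_` decides whether the first point goes to S or to R.
listSum-splits : ∀ {X : Set} (A B : Seq) (xs : List X) → listSum (λ (S , R) → A (length S) * B (length R)) (splits xs) ≡ (A ⋆ B) (length xs)
listSum-splits A B [] = ℚₚ.+-identityʳ _
listSum-splits A B (x ∷ xs) = trans (listSum-++ _ (List.map (λ (S , R) → S , x ∷ R) (splits xs)) _)
  (trans (cong₂ _+_ (trans (listSum-map _ _ (splits xs)) (listSum-splits A (∂ B) xs)) (trans (listSum-map _ _ (splits xs)) (listSum-splits (∂ A) B xs)))
    (ℚₚ.+-comm ((A ⋆ ∂ B) (length xs)) ((∂ A ⋆ B) (length xs))))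

-- The condition |S| ≥ 2 on the grafts. For the series of the basis, with P 0 = 0 and P 1 = 1, it
-- subtracts u.
cut : Seq → Seq
cut A zero          = 0ℚ
cut A (suc zero)    = 0ℚ
cut A (suc (suc s)) = A (suc (suc s))

module Series (t : ℚ) where

  power : ℕ → ℚ
  power zero    = 1ℚ
  power (suc k) = t * power k

  power-+ : ∀ j k → power (j ℕ.+ k) ≡ power j * power k
  power-+ zero k = sym (ℚₚ.*-identityˡ _)
  power-+ (suc j) k = trans (cong (t *_) (power-+ j k)) (sym (ℚₚ.*-assoc t (power j) (power k)))

  -- k bounds the recursion depth as in basis k; the value does not depend on it once m ≤ k.
  bounded : ℕ → Seq
  bounded zero    m             = 0ℚ
  bounded (suc k) zero          = 0ℚ
  bounded (suc k) (suc zero)    = 1ℚ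
  bounded (suc k) (suc (suc m)) = t * (cut (bounded k) ⋆ ∂ (bounded k)) (suc m) + bounded k (suc m)

  module _ {n : ℕ} where

    weight : Item {n} → ℚ
    weight p = power (length (proj₁ p))

    weight-graft : ∀ a S R (p₁ p₂ : Item) → weight (graft a S R p₁ p₂) ≡ t * (weight p₁ * weight p₂)
    weight-graft a S R (w₁ , _) (w₂ , _) = cong (t *_) (trans
      (cong power (trans (Listₚ.length-++ w₁) (cong (length w₁ ℕ.+_) (Listₚ.length-map (blowUp a ⟦ S ⟧) w₂))))
      (power-+ (length w₁) (length w₂)))

    listSum-tensor : ∀ (g : Item → Item → Item) L₁ L₂ → (∀ p₁ p₂ → weight (g p₁ p₂) ≡ t * (weight p₁ * weight p₂)) →
                     listSum weight (tensor g L₁ L₂) ≡ t * (listSum weight L₁ * listSum weight L₂)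
    listSum-tensor g [] L₂ e = sym (trans (cong (t *_) (ℚₚ.*-zeroˡ (listSum weight L₂))) (ℚₚ.*-zeroʳ t))
    listSum-tensor g (p ∷ L₁) L₂ e = trans (listSum-++ weight (List.map (g p) L₂) (tensor g L₁ L₂))
      (trans (cong₂ _+_ (trans (listSum-map weight (g p) L₂) (trans (listSum-cong L₂ (λ p₂ → trans (e p p₂) (sym (ℚₚ.*-assoc t (weight p) (weight p₂)))))
                (listSum-* (t * weight p) weight L₂))) (listSum-tensor g L₁ L₂ e))
        (solve 4 (λ t w a b → t :* w :* b :+ t :* (a :* b) := t :* ((w :+ a) :* b)) refl t (weight p) (listSum weight L₁) (listSum weight L₂)))
      where open +-*-Solver

    listSum-basis : ∀ k (xs : List (Fin n)) → listSum weight (basis k xs) ≡ bounded k (length xs)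
    listSum-basis zero xs = refl
    listSum-basis (suc k) [] = refl
    listSum-basis (suc k) (a ∷ []) = refl
    listSum-basis (suc k) (a ∷ b ∷ xs) = trans (listSum-++ weight grafts (List.map (lift b (b ∷ xs)) (basis k (b ∷ xs))))
      (cong₂ _+_ grafted-sum (trans (listSum-map weight (lift b (b ∷ xs)) (basis k (b ∷ xs))) (listSum-basis k (b ∷ xs))))
      where
      grafts = concatMap (λ (S , R) → tensor (graft a S R) (basis k S) (basis k (a ∷ R))) (bigSplits (b ∷ xs))
      f : List (Fin n) × List (Fin n) → ℚ
      f (S , R) = cut (bounded k) (length S) * bounded k (suc (length R))
      small : ∀ S → ¬ 2 ≤ length S → cut (bounded k) (length S) ≡ 0ℚ
      small [] _ = refl
      small (_ ∷ []) _ = refl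
      small (_ ∷ _ ∷ _) ¬2≤ = ⊥-elim (¬2≤ (s≤s (s≤s z≤n)))
      large : ∀ S → 2 ≤ length S → cut (bounded k) (length S) ≡ bounded k (length S)
      large (_ ∷ []) (s≤s ())
      large (_ ∷ _ ∷ _) _ = refl
      grafted-sum : listSum weight grafts ≡ t * (cut (bounded k) ⋆ ∂ (bounded k)) (suc (length xs))
      grafted-sum = trans (listSum-concatMap weight _ (bigSplits (b ∷ xs)))
        (trans (listSum-cong∈ (bigSplits (b ∷ xs)) (λ {(S , R)} SR∈ → trans (listSum-tensor (graft a S R) (basis k S) (basis k (a ∷ R)) (weight-graft a S R))
            (cong (t *_) (cong₂ _*_ (trans (listSum-basis k S) (sym (large S (proj₂ (∈ₗ.∈-filter⁻ (λ (S , _) → 2 ℕ.≤? length S) {xs = splits (b ∷ xs)} SR∈))))) (listSum-basis k (a ∷ R))))))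
          (trans (listSum-* t f (bigSplits (b ∷ xs)))
            (cong (t *_) (trans (listSum-filter (λ (S , _) → 2 ℕ.≤? length S) f (splits (b ∷ xs)) (λ (S , R) ¬2≤ → trans (cong (_* bounded k (suc (length R))) (small S ¬2≤)) (ℚₚ.*-zeroˡ (bounded k (suc (length R))))))
              (listSum-splits (cut (bounded k)) (∂ (bounded k)) (b ∷ xs))))))

  -- The derivative would reach A (m + 2), but only next to `cut A 0`, which is zero. Thus the
  -- recursion for the next coefficient uses earlier ones only.
  cut-product : ∀ m {A A′ : Seq} → (∀ j → j ≤ suc m → A j ≡ A′ j) → (cut A ⋆ ∂ A) (suc m) ≡ (cut A′ ⋆ ∂ A′) (suc m)
  cut-product m {A} {A′} e = ⋆-cong-joint (suc m) λ
    { zero r _ → trans (ℚₚ.*-zeroˡ (A (suc r))) (sym (ℚₚ.*-zeroˡ (A′ (suc r))))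
    ; (suc zero) r _ → trans (ℚₚ.*-zeroˡ (A (suc r))) (sym (ℚₚ.*-zeroˡ (A′ (suc r))))
    ; (suc (suc s)) r eq → cong₂ _*_ (e (suc (suc s)) (subst (suc (suc s) ≤_) eq (ℕₚ.m≤m+n _ r)))
        (e (suc r) (subst (suc r ≤_) eq (s≤s (ℕₚ.m≤n⇒m≤1+n (ℕₚ.m≤n+m r s))))) }

  bounded-stable : ∀ k k′ m → m ≤ k → m ≤ k′ → bounded k m ≡ bounded k′ m
  bounded-stable zero zero m _ _ = refl
  bounded-stable zero (suc k′) zero _ _ = refl
  bounded-stable (suc k) zero zero _ _ = refl
  bounded-stable (suc k) (suc k′) zero _ _ = refl
  bounded-stable (suc k) (suc k′) (suc zero) _ _ = refl
  bounded-stable (suc k) (suc k′) (suc (suc m)) (s≤s m≤k) (s≤s m≤k′) =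
    cong₂ (λ x y → t * x + y) (cut-product m (λ j j≤ → bounded-stable k k′ j (ℕₚ.≤-trans j≤ m≤k) (ℕₚ.≤-trans j≤ m≤k′)))
      (bounded-stable k k′ (suc m) m≤k m≤k′)

  P : Seq
  P m = bounded m m

  P≡ : ∀ m → P m ≡ cut P m + u m
  P≡ zero = refl
  P≡ (suc zero) = refl
  P≡ (suc (suc m)) = sym (ℚₚ.+-identityʳ _)

  P-ode : ∀ m → ∂ P m ≡ δ m + P m + t * (cut P ⋆ ∂ P) m
  P-ode zero = sym (trans (cong (λ z → 1ℚ + 0ℚ + t * z) (ℚₚ.*-zeroˡ 1ℚ)) (cong (1ℚ + 0ℚ +_) (ℚₚ.*-zeroʳ t)))
  P-ode (suc m) = trans (cong (λ z → t * z + P (suc m)) (cut-product m (λ j j≤ → bounded-stable (suc m) j j j≤ ℕₚ.≤-refl)))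
    (solve 3 (λ t x p → t :* x :+ p := con 0ℚ :+ p :+ t :* x) refl t ((cut P ⋆ ∂ P) (suc m)) (P (suc m)))
    where open +-*-Solver

  eval : UPoly → ℚ
  eval []      = 0ℚ
  eval (a ∷ p) = a + t * eval p

  eval-⊕ : ∀ p q → eval (p ⊕ q) ≡ eval p + eval q
  eval-⊕ [] q = sym (ℚₚ.+-identityˡ _)
  eval-⊕ (a ∷ p) [] = sym (ℚₚ.+-identityʳ _)
  eval-⊕ (a ∷ p) (b ∷ q) = trans (cong (λ z → a + b + t * z) (eval-⊕ p q))
    (solve 5 (λ a b t p q → a :+ b :+ t :* (p :+ q) := (a :+ t :* p) :+ (b :+ t :* q)) refl a b t (eval p) (eval q))
    where open +-*-Solver

  eval-scale : ∀ c p → eval (scale c p) ≡ c * eval p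
  eval-scale c [] = sym (ℚₚ.*-zeroʳ c)
  eval-scale c (a ∷ p) = trans (cong (λ z → c * a + t * z) (eval-scale c p))
    (solve 4 (λ c a t p → c :* a :+ t :* (c :* p) := c :* (a :+ t :* p)) refl c a t (eval p))
    where open +-*-Solver

  eval-⊗ : ∀ p q → eval (p ⊗ q) ≡ eval p * eval q
  eval-⊗ [] q = sym (ℚₚ.*-zeroˡ (eval q))
  eval-⊗ (a ∷ p) q = trans (eval-⊕ (scale a q) (0ℚ ∷ (p ⊗ q))) (trans (cong₂ (λ x y → x + (0ℚ + t * y)) (eval-scale a q) (eval-⊗ p q))
    (solve 4 (λ a q t p → a :* q :+ (con 0ℚ :+ t :* (p :* q)) := (a :+ t :* p) :* q) refl a (eval q) t (eval p)))
    where open +-*-Solver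

  eval-usum : ∀ {A : Set} (f : A → UPoly) xs → eval (usum (List.map f xs)) ≡ listSum (eval ∘ f) xs
  eval-usum f [] = refl
  eval-usum f (x ∷ xs) = trans (eval-⊕ (f x) (usum (List.map f xs))) (cong (eval (f x) +_) (eval-usum f xs))

-- Rational constants: fractions and factorial quotients

private
  /-toℚᵘ : ∀ i d → ℚ.toℚᵘ (i / suc d) ℚᵘ.≃ mkℚᵘ i d
  /-toℚᵘ i d = ℚₚ.toℚᵘ-fromℚᵘ (mkℚᵘ i d)

ι≡/1 : ∀ m → ι m ≡ ℤ.+ m / 1
ι≡/1 zero = refl
ι≡/1 (suc m) = trans (cong (1ℚ +_) (ι≡/1 m)) (ℚₚ.toℚᵘ-injective (ℚᵘₚ.≃-trans (ℚₚ.toℚᵘ-homo-+ 1ℚ (ℤ.+ m / 1))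
  (ℚᵘₚ.≃-trans (ℚᵘₚ.+-cong (ℚᵘₚ.≃-refl {ℚ.toℚᵘ 1ℚ}) (/-toℚᵘ (ℤ.+ m) 0))
    (ℚᵘₚ.≃-trans (*≡* (cong (ℤ._* ℤ.+ 1) (cong (λ z → ℤ.+ 1 ℤ.+ z) (ℤₚ.*-identityʳ (ℤ.+ m))))) (ℚᵘₚ.≃-sym (/-toℚᵘ (ℤ.+ suc m) 0))))))

/-cancel : ∀ a b .{{_ : ℕ.NonZero b}} → (ℤ.+ a / b) * ι b ≡ ι a
/-cancel a (suc b) = trans (cong ((ℤ.+ a / suc b) *_) (ι≡/1 (suc b))) (trans (ℚₚ.toℚᵘ-injective (ℚᵘₚ.≃-trans (ℚₚ.toℚᵘ-homo-* (ℤ.+ a / suc b) (ℤ.+ suc b / 1))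
  (ℚᵘₚ.≃-trans (ℚᵘₚ.*-cong (/-toℚᵘ (ℤ.+ a) b) (/-toℚᵘ (ℤ.+ suc b) 0))
    (ℚᵘₚ.≃-trans (*≡* (trans (ℤₚ.*-identityʳ (ℤ.+ a ℤ.* ℤ.+ suc b)) (cong (λ z → ℤ.+ a ℤ.* ℤ.+ suc z) (sym (ℕₚ.*-identityʳ b))))) (ℚᵘₚ.≃-sym (/-toℚᵘ (ℤ.+ a) 0)))))) (sym (ι≡/1 a)))

factorial-rise : ∀ m ℓ → ι ((m ℕ.+ ℓ) !) ≡ rise (suc m) ℓ * ι (m !)
factorial-rise m zero = trans (cong (ι ∘ _!) (ℕₚ.+-identityʳ m)) (sym (ℚₚ.*-identityˡ _))
factorial-rise m (suc ℓ) = begin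
  ι ((m ℕ.+ suc ℓ) !)                                   ≡⟨ cong (ι ∘ _!) (ℕₚ.+-suc m ℓ) ⟩
  ι (suc (m ℕ.+ ℓ) ℕ.* (m ℕ.+ ℓ) !)                     ≡⟨ ι-* (suc (m ℕ.+ ℓ)) ((m ℕ.+ ℓ) !) ⟩
  ι (suc (m ℕ.+ ℓ)) * ι ((m ℕ.+ ℓ) !)                 ≡⟨ cong (ι (suc (m ℕ.+ ℓ)) *_) (factorial-rise m ℓ) ⟩
  ι (suc m ℕ.+ ℓ) * (rise (suc m) ℓ * ι (m !))      ≡⟨ sym (ℚₚ.*-assoc (ι (suc m ℕ.+ ℓ)) (rise (suc m) ℓ) (ι (m !))) ⟩
  ι (suc m ℕ.+ ℓ) * rise (suc m) ℓ * ι (m !)        ≡⟨ cong (_* ι (m !)) (trans (ℚₚ.*-comm (ι (suc m ℕ.+ ℓ)) (rise (suc m) ℓ)) (sym (rise-last (suc m) ℓ))) ⟩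
  rise (suc m) (suc ℓ) * ι (m !)                      ∎
  where open ≡-Reasoning

cancel-nonZero : ∀ b .{{_ : ℕ.NonZero b}} {x y} → x * ι b ≡ y * ι b → x ≡ y
cancel-nonZero (suc b) {x} {y} e = cancel-ι b (trans (ℚₚ.*-comm (ι (suc b)) x) (trans e (ℚₚ.*-comm y (ι (suc b)))))

factorial-ratio : ∀ m ℓ → (ℤ.+ ((m ℕ.+ ℓ) !) / (m !)) {{m !≢0}} ≡ rise (suc m) ℓ
factorial-ratio m ℓ = cancel-nonZero (m !) {{m !≢0}} (trans (/-cancel ((m ℕ.+ ℓ) !) (m !) {{m !≢0}}) (factorial-rise m ℓ))

-- Iterated derivatives as sums over set partitions

⋆-listSum : ∀ {X : Set} (A : Seq) (f : X → Seq) xs m → (A ⋆ (λ j → listSum (λ x → f x j) xs)) m ≡ listSum (λ x → (A ⋆ f x) m) xs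
⋆-listSum A f [] m = trans (⋆-comm A (λ _ → 0ℚ) m) (⋆-zeroˡ A m)
⋆-listSum A f (x ∷ xs) m = trans (⋆-distribˡ A (f x) (λ j → listSum (λ x → f x j) xs) m) (cong ((A ⋆ f x) m +_) (⋆-listSum A f xs m))

shift : ℕ → Seq → Seq
shift zero    A = A
shift (suc j) A = ∂ (shift j A)

shift-at : ∀ j A i → shift j A i ≡ A (j ℕ.+ i)
shift-at zero A i = refl
shift-at (suc j) A i = trans (shift-at j A (suc i)) (cong A (ℕₚ.+-suc j i))

insertEach-length : ∀ x (p : List (List ℕ)) {p′} → p′ ∈ₗ insertEach x p → length p′ ≡ length p
insertEach-length x (B ∷ p) (here refl) = refl
insertEach-length x (B ∷ p) (there p′∈) with ∈ₗ.∈-map⁻ _ p′∈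
... | (q , q∈ , refl) = cong suc (insertEach-length x p q∈)

insertEach-nonempty : ∀ x (p : List (List ℕ)) → All (λ B → 1 ≤ length B) p → ∀ {p′} → p′ ∈ₗ insertEach x p → All (λ B → 1 ≤ length B) p′
insertEach-nonempty x (B ∷ p) (b ∷ bs) (here refl) = s≤s z≤n ∷ bs
insertEach-nonempty x (B ∷ p) (b ∷ bs) (there p′∈) with ∈ₗ.∈-map⁻ _ p′∈
... | (q , q∈ , refl) = b ∷ insertEach-nonempty x p bs q∈

setPartitions-nonempty : ∀ k {p} → p ∈ₗ setPartitions k → All (λ B → 1 ≤ length B) p
setPartitions-nonempty zero (here refl) = []
setPartitions-nonempty (suc k) p∈ with find (∈ₗ.∈-concatMap⁻ (λ p → (List.[ suc k ] ∷ p) ∷ insertEach (suc k) p) {xs = setPartitions k} p∈)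
... | (q , q∈ , here refl) = s≤s z≤n ∷ setPartitions-nonempty k q∈
... | (q , q∈ , there r) = insertEach-nonempty (suc k) q (setPartitions-nonempty k q∈) r

module Partitions (h : Seq) (h₀ : h 0 ≡ 0ℚ) where

  open Power h h₀

  -- The contribution of a set partition to an iterated derivative of Φ: each block B carries the |B|-th derivative of h.
  T : Seq → List (List ℕ) → Seq
  T Ψ []      = Ψ
  T Ψ (B ∷ p) = shift (length B) h ⋆ T Ψ p

  T-cong : ∀ p {Ψ Ψ′} → (∀ m → Ψ m ≡ Ψ′ m) → ∀ m → T Ψ p m ≡ T Ψ′ p m
  T-cong [] e = e
  T-cong (B ∷ p) e m = ⋆-congʳ m (shift (length B) h) (T-cong p e)

  T-scale : ∀ p x Ψ m → T (x ∙ Ψ) p m ≡ x * T Ψ p m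
  T-scale [] x Ψ m = refl
  T-scale (B ∷ p) x Ψ m = trans (⋆-congʳ m (shift (length B) h) (T-scale p x Ψ)) (⋆-scaleʳ x (shift (length B) h) (T Ψ p) m)

  T-⋆ : ∀ p A Ψ m → T (A ⋆ Ψ) p m ≡ (A ⋆ T Ψ p) m
  T-⋆ [] A Ψ m = refl
  T-⋆ (B ∷ p) A Ψ m = trans (⋆-congʳ m (shift (length B) h) (T-⋆ p A Ψ)) (⋆-swap (shift (length B) h) A (T Ψ p) m)

  -- By the Leibniz rule the derivative falls on Ψ or on the factor of one block B; the latter is
  -- the same as inserting a new element x into B.
  ∂T : ∀ x p Ψ m → ∂ (T Ψ p) m ≡ T (∂ Ψ) p m + listSum (λ p′ → T Ψ p′ m) (insertEach x p)
  ∂T x [] Ψ m = sym (ℚₚ.+-identityʳ _)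
  ∂T x (B ∷ p) Ψ m = begin
    first + (A ⋆ ∂ (T Ψ p)) m
      ≡⟨ cong (first +_) (trans (⋆-congʳ m A {B′ = T (∂ Ψ) p ⊹ (λ j → listSum (λ p′ → T Ψ p′ j) (insertEach x p))} (∂T x p Ψ)) (⋆-distribˡ A (T (∂ Ψ) p) _ m)) ⟩
    first + ((A ⋆ T (∂ Ψ) p) m + (A ⋆ (λ j → listSum (λ p′ → T Ψ p′ j) (insertEach x p))) m)
      ≡⟨ cong (λ z → first + ((A ⋆ T (∂ Ψ) p) m + z)) (trans (⋆-listSum A (T Ψ) (insertEach x p) m) (sym (listSum-map (λ p′ → T Ψ p′ m) (B ∷_) (insertEach x p)))) ⟩
    first + ((A ⋆ T (∂ Ψ) p) m + rest)
      ≡⟨ solve 3 (λ a b c → a :+ (b :+ c) := b :+ (a :+ c)) refl first ((A ⋆ T (∂ Ψ) p) m) rest ⟩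
    (A ⋆ T (∂ Ψ) p) m + (first + rest) ∎
    where
    open ≡-Reasoning
    open +-*-Solver
    A = shift (length B) h
    first = (∂ A ⋆ T Ψ p) m
    rest = listSum (λ p′ → T Ψ p′ m) (List.map (B ∷_) (insertEach x p))

  summand : ℕ → ℕ → List (List ℕ) → ℚ
  summand α m p = rise α (length p) * T (Φ (α ℕ.+ length p)) p m

  -- The formula of Faà di Bruno for (1 - h) ^ (- α), one derivative at a time: differentiating the
  -- power opens a singleton block, raises the exponent by one and extends the rising factorial;
  -- differentiating a factor enlarges its block. It is stated for all m because the step uses the
  -- case m + 1.
  Φ-partitions : ∀ α k m → Φ α (k ℕ.+ m) ≡ listSum (summand α m) (setPartitions k)
  Φ-partitions α zero m = sym (trans (ℚₚ.+-identityʳ _) (trans (ℚₚ.*-identityˡ _) (cong (λ β → Φ β m) (ℕₚ.+-identityʳ α))))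
  Φ-partitions α (suc k) m = trans (cong (Φ α) (sym (ℕₚ.+-suc k m))) (trans (Φ-partitions α k (suc m))
      (trans (listSum-cong (setPartitions k) one) (sym (listSum-concatMap (summand α m) (λ p → (List.[ suc k ] ∷ p) ∷ insertEach (suc k) p) (setPartitions k)))))
    where
    one : ∀ p → summand α (suc m) p ≡ summand α m (List.[ suc k ] ∷ p) + listSum (summand α m) (insertEach (suc k) p)
    one p = trans (cong (rise α ℓ *_) (∂T (suc k) p (Φ β) m)) (trans (ℚₚ.*-distribˡ-+ (rise α ℓ) (T (∂ (Φ β)) p m) _)
        (cong₂ _+_ new (trans (sym (listSum-* (rise α ℓ) (λ p′ → T (Φ β) p′ m) (insertEach (suc k) p)))
          (listSum-cong∈ (insertEach (suc k) p) (λ {p′} p′∈ → cong (λ l → rise α l * T (Φ (α ℕ.+ l)) p′ m) (sym (insertEach-length (suc k) p p′∈)))))))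
      where
      open ≡-Reasoning
      ℓ = length p
      β = α ℕ.+ ℓ
      new : rise α ℓ * T (∂ (Φ β)) p m ≡ summand α m (List.[ suc k ] ∷ p)
      new = begin
        rise α ℓ * T (∂ (Φ β)) p m                                ≡⟨ cong (rise α ℓ *_) (trans (T-cong p {Ψ′ = ι β ∙ (∂ h ⋆ Φ (suc β))} (∂Φ β) m) (T-scale p (ι β) (∂ h ⋆ Φ (suc β)) m)) ⟩
        rise α ℓ * (ι β * T (∂ h ⋆ Φ (suc β)) p m)              ≡⟨ sym (ℚₚ.*-assoc (rise α ℓ) (ι β) _) ⟩
        rise α ℓ * ι β * T (∂ h ⋆ Φ (suc β)) p m                ≡⟨ cong₂ _*_ (sym (rise-last α ℓ)) (T-⋆ p (∂ h) (Φ (suc β)) m) ⟩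
        rise α (suc ℓ) * (∂ h ⋆ T (Φ (suc β)) p) m                ≡⟨ cong (λ γ → rise α (suc ℓ) * (∂ h ⋆ T (Φ γ) p) m) (sym (ℕₚ.+-suc α ℓ)) ⟩
        summand α m (List.[ suc k ] ∷ p)                            ∎

  blocks : List (List ℕ) → ℚ
  blocks []      = 1ℚ
  blocks (B ∷ p) = h (length B) * blocks p

  T-zero : ∀ p Ψ → Ψ 0 ≡ 1ℚ → T Ψ p 0 ≡ blocks p
  T-zero [] Ψ e = e
  T-zero (B ∷ p) Ψ e = cong₂ _*_ (trans (shift-at (length B) h 0) (cong h (ℕₚ.+-identityʳ (length B)))) (T-zero p Ψ e)

  Φ-blocks : ∀ α k → Φ α k ≡ listSum (λ p → rise α (length p) * blocks p) (setPartitions k)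
  Φ-blocks α k = trans (cong (Φ α) (sym (ℕₚ.+-identityʳ k))) (trans (Φ-partitions α k 0)
    (listSum-cong (setPartitions k) (λ p → cong (rise α (length p) *_) (T-zero p (Φ (α ℕ.+ length p)) refl))))

-- Polynomial identities from their values


module RightHandSide (t : ℚ) where

  open Series t

  block : ℕ → UPoly
  block j = scale (ℤ.+ 1 / suc j) (chibar (suc j))

  -- The constant term is set to 0, whereas `block 0` would be the constant 1: blocks are nonempty,
  -- and 1 - h must have constant term 1.
  h : Seq
  h zero    = 0ℚ
  h (suc k) = eval (block (suc k))

  χ : ℕ → ℚ
  χ j = eval (chibar j)

  h-χ : ∀ k → ι (suc (suc k)) * h (suc k) ≡ χ (suc (suc k))
  h-χ k = begin
    ι (suc (suc k)) * h (suc k)                                ≡⟨ cong (ι (suc (suc k)) *_) (eval-scale (ℤ.+ 1 / suc (suc k)) (chibar (suc (suc k)))) ⟩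
    ι (suc (suc k)) * ((ℤ.+ 1 / suc (suc k)) * χ (suc (suc k))) ≡⟨ sym (ℚₚ.*-assoc (ι (suc (suc k))) (ℤ.+ 1 / suc (suc k)) (χ (suc (suc k)))) ⟩
    ι (suc (suc k)) * (ℤ.+ 1 / suc (suc k)) * χ (suc (suc k))   ≡⟨ cong (_* χ (suc (suc k))) (trans (ℚₚ.*-comm (ι (suc (suc k))) _) (/-cancel 1 (suc (suc k)))) ⟩
    ι 1 * χ (suc (suc k))                                      ≡⟨ ℚₚ.*-identityˡ _ ⟩
    χ (suc (suc k))                                              ∎
    where open ≡-Reasoning

  χ-suc : ∀ k → χ (suc (suc (suc k))) ≡ χ (suc (suc k)) * (t - ι (suc (suc k)))
  χ-suc k = trans (eval-⊗ (chibar (suc (suc k))) (- (ℤ.+ suc (suc k) / 1) ∷ 1ℚ ∷ []))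
    (cong (χ (suc (suc k)) *_) (trans (cong (λ z → - z + t * (1ℚ + t * 0ℚ)) (sym (ι≡/1 (suc (suc k)))))
      (solve 2 (λ i t → :- i :+ t :* (con 1ℚ :+ t :* con 0ℚ) := t :- i) refl (ι (suc (suc k))) t)))
    where open +-*-Solver

  -- For g = u (1 - h), the expected inverse of F, the equation of F turns into (1 + u) g ′ = 1 - t
  -- (u - g), which is this one expanded. Coefficientwise it is the recursion that multiplies χ̄ by
  -- t minus the next integer.
  h-ode : ∀ m → h m + (u ⋆ ∂ h) m + (u ⋆ h) m + (u ⋆ (u ⋆ ∂ h)) m ≡ u m + t * (u ⋆ h) m
  h-ode zero = trans (cong₂ (λ x y → 0ℚ + x + 0ℚ + y) (ℚₚ.*-zeroˡ (h 1)) (ℚₚ.*-zeroˡ ((u ⋆ ∂ h) 0))) (sym (trans (ℚₚ.+-identityˡ _) (ℚₚ.*-zeroʳ t)))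
  h-ode (suc m) = trans (cong₂ _+_ (cong₂ _+_ (cong (h (suc m) +_) (u-⋆∂ h (suc m))) (u-⋆ h m)) (trans (u-⋆ (u ⋆ ∂ h) m) (cong (ι (suc m) *_) (u-⋆∂ h m))))
    (trans (coefficients m) (sym (cong (λ z → δ m + t * z) (u-⋆ h m))))
    where
    open +-*-Solver
    coefficients : ∀ m → h (suc m) + ι (suc m) * h (suc m) + ι (suc m) * h m + ι (suc m) * (ι m * h m) ≡ δ m + t * (ι (suc m) * h m)
    coefficients zero = trans (solve 1 (λ x → x :+ (con 1ℚ :+ con 0ℚ) :* x :+ (con 1ℚ :+ con 0ℚ) :* con 0ℚ :+ (con 1ℚ :+ con 0ℚ) :* (con 0ℚ :* con 0ℚ) := (con 1ℚ :+ (con 1ℚ :+ con 0ℚ)) :* x) refl (h 1))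
      (trans (h-χ 0) (trans (solve 1 (λ t → con 1ℚ :+ t :* con 0ℚ := con 1ℚ :+ t :* ((con 1ℚ :+ con 0ℚ) :* con 0ℚ)) refl t) refl))
    coefficients (suc m) = begin
      x + (1ℚ + i) * x + (1ℚ + i) * y + (1ℚ + i) * (i * y)
        ≡⟨ solve 3 (λ x i y → x :+ (con 1ℚ :+ i) :* x :+ (con 1ℚ :+ i) :* y :+ (con 1ℚ :+ i) :* (i :* y) := (con 1ℚ :+ (con 1ℚ :+ i)) :* x :+ (con 1ℚ :+ i) :* ((con 1ℚ :+ i) :* y)) refl x i y ⟩
      (1ℚ + (1ℚ + i)) * x + (1ℚ + i) * ((1ℚ + i) * y)
        ≡⟨ cong₂ (λ a b → a + (1ℚ + i) * b) (trans (h-χ (suc m)) (χ-suc m)) (h-χ m) ⟩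
      χ (suc (suc m)) * (t - (1ℚ + i)) + (1ℚ + i) * χ (suc (suc m))
        ≡⟨ solve 3 (λ c t i → c :* (t :- (con 1ℚ :+ i)) :+ (con 1ℚ :+ i) :* c := con 0ℚ :+ t :* c) refl (χ (suc (suc m))) t i ⟩
      0ℚ + t * χ (suc (suc m))   ≡⟨ cong (λ z → 0ℚ + t * z) (sym (h-χ m)) ⟩
      0ℚ + t * ((1ℚ + i) * y) ∎
      where
      open ≡-Reasoning
      i = ι (suc m)
      x = h (suc (suc m))
      y = h (suc m)

  open Power h refl
  open Partitions h refl

  blocks-eval : ∀ {p : List (List ℕ)} → All (λ B → 1 ≤ length B) p → eval (uprod (List.map (λ B → block (length B)) p)) ≡ blocks p
  blocks-eval [] = solve 1 (λ t → con 1ℚ :+ t :* con 0ℚ := con 1ℚ) refl t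
    where open +-*-Solver
  blocks-eval {(_ ∷ B) ∷ p} (_ ∷ ne) = trans (eval-⊗ (block (suc (length B))) (uprod (List.map (λ B → block (length B)) p))) (cong (h (suc (length B)) *_) (blocks-eval ne))

  eval-rhs : ∀ m → eval (rhs (suc m)) ≡ P (suc m)
  eval-rhs m = trans (eval-usum (term (suc m)) (setPartitions m))
    (trans (listSum-cong∈ (setPartitions m) one) (trans (sym (Φ-blocks (suc m) m)) (sym (inversion m))))
    where
    open Inversion t h refl h-ode P refl (cut P) P≡ P-ode using (inversion)
    one : ∀ {p} → p ∈ₗ setPartitions m → eval (term (suc m) p) ≡ rise (suc m) (length p) * blocks p
    one {p} p∈ = trans (eval-scale ((ℤ.+ ((m ℕ.+ length p) !) / (m !)) {{m !≢0}}) (uprod (List.map (λ B → block (length B)) p)))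
      (cong₂ _*_ (factorial-ratio m (length p)) (blocks-eval (setPartitions-nonempty m p∈)))

module _ where
  open Series using (eval; eval-⊕; eval-scale)

  coeffAt-⊕ : ∀ i p q → coeffAt i (p ⊕ q) ≡ coeffAt i p + coeffAt i q
  coeffAt-⊕ i [] q = sym (ℚₚ.+-identityˡ _)
  coeffAt-⊕ i (a ∷ p) [] = sym (ℚₚ.+-identityʳ _)
  coeffAt-⊕ zero (a ∷ p) (b ∷ q) = refl
  coeffAt-⊕ (suc i) (a ∷ p) (b ∷ q) = coeffAt-⊕ i p q

  coeffAt-scale : ∀ i c p → coeffAt i (scale c p) ≡ c * coeffAt i p
  coeffAt-scale i c [] = sym (ℚₚ.*-zeroʳ c)
  coeffAt-scale zero c (a ∷ p) = refl
  coeffAt-scale (suc i) c (a ∷ p) = coeffAt-scale i c p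

  -- Synthetic division: p = (x - r) · divide r p + p(r).
  divide : ℚ → UPoly → UPoly
  divide r []      = []
  divide r (a ∷ p) = p ⊕ scale r (divide r p)

  length-⊕ : ∀ {d} p q → length p ≤ d → length q ≤ d → length (p ⊕ q) ≤ d
  length-⊕ [] q _ q≤ = q≤
  length-⊕ (a ∷ p) [] p≤ _ = p≤
  length-⊕ (a ∷ p) (b ∷ q) (s≤s p≤) (s≤s q≤) = s≤s (length-⊕ p q p≤ q≤)

  length-divide : ∀ r p {d} → length p ≤ suc d → length (divide r p) ≤ d
  length-divide r [] _ = z≤n
  length-divide r (a ∷ []) _ = z≤n
  length-divide r (a ∷ p@(_ ∷ _)) {suc d} (s≤s p≤) = length-⊕ p (scale r (divide r p)) p≤
    (subst (_≤ suc d) (sym (Listₚ.length-map (r *_) (divide r p))) (ℕₚ.m≤n⇒m≤1+n (length-divide r p p≤)))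

  eval-divide : ∀ r t p → eval t p ≡ (t - r) * eval t (divide r p) + eval r p
  eval-divide r t [] = sym (trans (ℚₚ.+-identityʳ _) (ℚₚ.*-zeroʳ (t - r)))
  eval-divide r t (a ∷ p) = begin
    a + t * eval t p
      ≡⟨ solve 5 (λ a t r P D → a :+ t :* P := (t :- r) :* P :+ (a :+ r :* P)) refl a t r (eval t p) (eval t p) ⟩
    (t - r) * eval t p + (a + r * eval t p)
      ≡⟨ cong (λ z → (t - r) * eval t p + (a + r * z)) (eval-divide r t p) ⟩
    (t - r) * eval t p + (a + r * ((t - r) * eval t (divide r p) + eval r p))
      ≡⟨ solve 6 (λ a t r P D R → (t :- r) :* P :+ (a :+ r :* ((t :- r) :* D :+ R)) := (t :- r) :* (P :+ r :* D) :+ (a :+ r :* R)) refl a t r (eval t p) (eval t (divide r p)) (eval r p) ⟩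
    (t - r) * (eval t p + r * eval t (divide r p)) + (a + r * eval r p)
      ≡⟨ cong (λ z → (t - r) * z + (a + r * eval r p)) (sym (trans (eval-⊕ t p (scale r (divide r p))) (cong (eval t p +_) (eval-scale t r (divide r p))))) ⟩
    (t - r) * eval t (p ⊕ scale r (divide r p)) + (a + r * eval r p) ∎
    where open ≡-Reasoning
          open +-*-Solver

  coeffAt-divide : ∀ r p i → coeffAt i (divide r p) ≡ coeffAt (suc i) p + r * coeffAt (suc i) (divide r p)
  coeffAt-divide r [] i = sym (trans (ℚₚ.+-identityˡ _) (ℚₚ.*-zeroʳ r))
  coeffAt-divide r (a ∷ p) i = trans (expand i) (cong (λ z → coeffAt i p + r * z) (trans (coeffAt-divide r p i) (sym (expand (suc i)))))
    where
    expand : ∀ i → coeffAt i (p ⊕ scale r (divide r p)) ≡ coeffAt i p + r * coeffAt i (divide r p)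
    expand i = trans (coeffAt-⊕ i p (scale r (divide r p))) (cong (coeffAt i p +_) (coeffAt-scale i r (divide r p)))

  eval-constant : ∀ t p → (∀ i → coeffAt (suc i) p ≡ 0ℚ) → eval t p ≡ coeffAt 0 p
  eval-constant t [] _ = refl
  eval-constant t (a ∷ []) z = trans (cong (a +_) (ℚₚ.*-zeroʳ t)) (ℚₚ.+-identityʳ a)
  eval-constant t (a ∷ b ∷ p) z = trans (cong (λ x → a + t * x) (trans (eval-constant t (b ∷ p) (z ∘ suc)) (z 0))) (trans (cong (a +_) (ℚₚ.*-zeroʳ t)) (ℚₚ.+-identityʳ a))

  -- Dividing by x - k₀ shortens the list and keeps all integers above k₀ as roots. By induction the
  -- quotient is zero, so p is constant, with value p(k₀) = 0.
  roots⇒zero : ∀ d p k₀ → length p ≤ d → (∀ k → k₀ ≤ k → eval (ι k) p ≡ 0ℚ) → ∀ i → coeffAt i p ≡ 0ℚ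
  roots⇒zero d [] k₀ _ _ i = refl
  roots⇒zero (suc d) p@(_ ∷ _) k₀ p≤ z = coefficient
    where
    r = ι k₀
    quotient-root : ∀ k → suc k₀ ≤ k → eval (ι k) (divide r p) ≡ 0ℚ
    quotient-root k k₀<k = cancel-zero nonzero (trans (sym (ℚₚ.+-identityʳ _)) (trans (cong ((ι k - r) * eval (ι k) (divide r p) +_) (sym (z k₀ ℕₚ.≤-refl)))
        (trans (sym (eval-divide r (ι k) p)) (z k (ℕₚ.<⇒≤ k₀<k)))))
      where
      nonzero : ι k - r ≢ 0ℚ
      nonzero e = ι-suc≢0 (k ∸ suc k₀) (trans (sym (plus-minus (ι (suc (k ∸ suc k₀))) r)) (trans (cong (_- r) (trans (sym (ι-+ (suc (k ∸ suc k₀)) k₀))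
        (cong ι (trans (sym (ℕₚ.+-suc (k ∸ suc k₀) k₀)) (ℕₚ.m∸n+n≡m k₀<k))))) e))
    quotient-zero : ∀ i → coeffAt i (divide r p) ≡ 0ℚ
    quotient-zero = roots⇒zero d (divide r p) (suc k₀) (length-divide r p p≤) quotient-root
    higher : ∀ i → coeffAt (suc i) p ≡ 0ℚ
    higher i = trans (sym (trans (cong (λ x → coeffAt (suc i) p + r * x) (quotient-zero (suc i))) (trans (cong (coeffAt (suc i) p +_) (ℚₚ.*-zeroʳ r)) (ℚₚ.+-identityʳ _))))
      (trans (sym (coeffAt-divide r p i)) (quotient-zero i))
    coefficient : ∀ i → coeffAt i p ≡ 0ℚ
    coefficient zero = trans (sym (eval-constant r p higher)) (z k₀ ℕₚ.≤-refl)
    coefficient (suc i) = higher i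

  -- Applied to the difference of p and q. The conclusion is about coefficients because the lists
  -- may end in different numbers of zeros.
  eval-injective : ∀ p q → (∀ t → eval t p ≡ eval t q) → ∀ i → coeffAt i p ≡ coeffAt i q
  eval-injective p q e i = from-difference (trans (sym difference) (roots⇒zero _ (p ⊕ scale (- 1ℚ) q) 0 ℕₚ.≤-refl
      (λ k _ → trans (eval-⊕ (ι k) p (scale (- 1ℚ) q)) (trans (cong₂ _+_ (e (ι k)) (eval-scale (ι k) (- 1ℚ) q)) (negate (eval (ι k) q) (eval (ι k) q) refl))) i))
    where
    open +-*-Solver
    negate : ∀ x y → x ≡ y → x + (- 1ℚ) * y ≡ 0ℚ
    negate x _ refl = solve 1 (λ x → x :+ (:- con 1ℚ) :* x := con 0ℚ) refl x
    difference : coeffAt i (p ⊕ scale (- 1ℚ) q) ≡ coeffAt i p - coeffAt i q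
    difference = trans (coeffAt-⊕ i p (scale (- 1ℚ) q)) (trans (cong (coeffAt i p +_) (coeffAt-scale i (- 1ℚ) q))
      (solve 2 (λ x y → x :+ (:- con 1ℚ) :* y := x :- y) refl (coeffAt i p) (coeffAt i q)))

  monomial : ℕ → UPoly
  monomial zero    = 1ℚ ∷ []
  monomial (suc k) = 0ℚ ∷ monomial k

  eval-monomial : ∀ t k → eval t (monomial k) ≡ Series.power t k
  eval-monomial t zero = trans (cong (1ℚ +_) (ℚₚ.*-zeroʳ t)) (ℚₚ.+-identityʳ 1ℚ)
  eval-monomial t (suc k) = trans (ℚₚ.+-identityˡ _) (cong (t *_) (eval-monomial t k))

  coeffAt-monomial : ∀ i k → coeffAt i (monomial k) ≡ indicator (k ℕ.≟ i)
  coeffAt-monomial zero zero = refl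
  coeffAt-monomial (suc i) zero = refl
  coeffAt-monomial zero (suc k) = refl
  coeffAt-monomial (suc i) (suc k) = trans (coeffAt-monomial i k) (indicator-cong (cong suc) ℕₚ.suc-injective (k ℕ.≟ i) (suc k ℕ.≟ suc i))

  coeffAt-count : ∀ {A : Set} (f : A → ℕ) i xs → coeffAt i (usum (List.map (monomial ∘ f) xs)) ≡ ι (length (filter (λ x → f x ℕ.≟ i) xs))
  coeffAt-count f i [] = refl
  coeffAt-count f i (x ∷ xs) = trans (coeffAt-⊕ i (monomial (f x)) (usum (List.map (monomial ∘ f) xs)))
    (trans (cong₂ _+_ (coeffAt-monomial i (f x)) (coeffAt-count f i xs)) (add (f x ℕ.≟ i) refl))
    where
    rest = length (filter (λ x → f x ℕ.≟ i) xs)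
    add : (d : Dec (f x ≡ i)) → (f x ℕ.≟ i) ≡ d → indicator d + ι rest ≡ ι (length (filter (λ x → f x ℕ.≟ i) (x ∷ xs)))
    add (yes p) _ = cong (ι ∘ length) (sym (Listₚ.filter-accept (λ x → f x ℕ.≟ i) {xs = xs} p))
    add (no ¬p) _ = trans (ℚₚ.+-identityˡ _) (cong (ι ∘ length) (sym (Listₚ.filter-reject (λ x → f x ℕ.≟ i) {xs = xs} ¬p)))

open import Data.Integer using (+_)

theorem1p4 : (n : ℕ) → 2 ≤ n → (i : ℕ) →
    Σ ℕ (λ d → ChowDim n i d × (coeffAt i (rhs n) ≡ (+ d) / 1))
theorem1p4 n@(suc m) 2≤n i = length C.selected , C.chowDim , trans coefficient (ι≡/1 (length C.selected))
  where
  module C = Chow n i (s≤s z≤n) (basisOf (monos (N n) i) (Generators.ideal n i))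
  degree : Item {n} → ℕ
  degree p = length (proj₁ p)
  -- At every t both sides equal the basis counted with the weight t ^ degree, that is
  -- `bounded n n`.
  values : ∀ t → Series.eval t (rhs n) ≡ Series.eval t (usum (List.map (monomial ∘ degree) C.items))
  values t = trans (RightHandSide.eval-rhs t m) (sym (trans (S.eval-usum (monomial ∘ degree) C.items)
    (trans (listSum-cong C.items (λ p → eval-monomial t (degree p))) (trans (S.listSum-basis n C.points) (cong (S.bounded n) C.points-length)))))
    where module S = Series t
  coefficient : coeffAt i (rhs n) ≡ ι (length C.selected)
  coefficient = trans (eval-injective (rhs n) (usum (List.map (monomial ∘ degree) C.items)) values i) (coeffAt-count degree i C.items)
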